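{- (i) There exists an oracle relative to which $\mathsf{P}^{\mathsf{NP}}=\mathsf{PEXP}$, and indeed $\mathsf{P}^{\mathsf{NP}}=\mathsf{P}^{\mathsf{NP}^{\mathsf{PEXP}}}$. (ii) There exists an oracle relative to which $\oplus\mathsf{P}=\mathsf{PEXP}$.
   Context: $\mathsf{PEXP}$ is the exponential-time version of $\mathsf{PP}$: languages accepted by a nondeterministic machine running in time $2^{\mathrm{poly}(n)}$ that accepts iff the majority of its paths accept. $\mathsf{P}^{\mathsf{NP}}$ is deterministic polynomial time with (adaptive) access to an $\mathsf{NP}$ oracle. $\oplus\mathsf{P}$ is the class of languages accepted by a nondeterministic polynomial-time machine that accepts iff the number of accepting paths is odd. All classes are relativized to the same oracle. -}

module Defs where

open import Data.Bool using (Bool; true; false; if_then_else_)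
open import Data.Maybe using (Maybe; just; nothing)
open import Data.List using (List; []; _∷_; length; reverse; mapMaybe; _++_)
open import Data.Vec using (Vec; []; _∷_; toList)
open import Data.Nat using (ℕ; zero; suc; _+_; _*_; _^_; _%_; _<_)
open import Data.Fin using (Fin)
open import Data.Product using (Σ; _×_; ∃; _,_)
open import Function using (id)
open import Function.Bundles using (_⇔_)
open import Relation.Binary.PropositionalEquality using (_≡_)

Lang : Set
Lang = List Bool → Bool

-- Oracle Turing machines with 4 two-way-infinite tapes:
--   tape 1 = input x, tape 2 = auxiliary input (certificate / choice string y),
--   tape 3 = work tape, tape 4 = oracle query tape.
-- Symbols: nothing = blank, just b = bit b.

Sym : Set
Sym = Maybe Bool

record Tape : Set where
  constructor tape
  field
    left  : List Sym   -- cells to the left of the head, nearest first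
    here  : Sym
    right : List Sym   -- cells to the right of the head, nearest first

data Move : Set where
  mL mS mR : Move

blankTape : Tape
blankTape = tape [] nothing []

inputTape : List Bool → Tape
inputTape []       = blankTape
inputTape (b ∷ bs) = tape [] (just b) (Data.List.map just bs)

write : Sym → Tape → Tape
write s (tape l _ r) = tape l s r

move : Move → Tape → Tape
move mL (tape []      h r) = tape [] nothing (h ∷ r)
move mL (tape (a ∷ l) h r) = tape l a (h ∷ r)
move mS t                  = t
move mR (tape l h [])      = tape (h ∷ l) nothing []
move mR (tape l h (a ∷ r)) = tape (h ∷ l) a r

contents : Tape → List Bool
contents (tape l h r) = mapMaybe id (reverse l ++ (h ∷ r))

Tapes : Set
Tapes = Vec Tape 4

data Action (Q : Set) : Set where
  halt  : Bool → Action Q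
  step  : Q → Vec Sym 4 → Vec Move 4 → Action Q
  query : Q → Q → Action Q                       -- ask oracle about query tape contents;
                                                 -- go to first state if yes, second if no;
                                                 -- query tape is then erased

record OTM : Set where
  field
    nstates : ℕ
    start   : Fin nstates
    δ       : Fin nstates → Vec Sym 4 → Action (Fin nstates)

heads : Tapes → Vec Sym 4
heads (a ∷ b ∷ c ∷ d ∷ []) = Tape.here a ∷ Tape.here b ∷ Tape.here c ∷ Tape.here d ∷ []

update : Vec Sym 4 → Vec Move 4 → Tapes → Tapes
update (s1 ∷ s2 ∷ s3 ∷ s4 ∷ []) (m1 ∷ m2 ∷ m3 ∷ m4 ∷ []) (a ∷ b ∷ c ∷ d ∷ []) =
  move m1 (write s1 a) ∷ move m2 (write s2 b) ∷ move m3 (write s3 c) ∷ move m4 (write s4 d) ∷ []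

queryString : Tapes → List Bool
queryString (a ∷ b ∷ c ∷ d ∷ []) = contents d

eraseQuery : Tapes → Tapes
eraseQuery (a ∷ b ∷ c ∷ d ∷ []) = a ∷ b ∷ c ∷ blankTape ∷ []

run : (M : OTM) → Lang → ℕ → Fin (OTM.nstates M) → Tapes → Maybe Bool
run M O zero    q ts = nothing
run M O (suc f) q ts with OTM.δ M q (heads ts)
... | halt b      = just b
... | step q' s m = run M O f q' (update s m ts)
... | query y n   = run M O f (if O (queryString ts) then y else n) (eraseQuery ts)

exec : OTM → Lang → ℕ → List Bool → List Bool → Maybe Bool
exec M O t x y = run M O t (OTM.start M) (inputTape x ∷ inputTape y ∷ blankTape ∷ blankTape ∷ [])

accepts : Maybe Bool → Bool
accepts (just b) = b
accepts nothing  = false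

poly : ℕ → ℕ → ℕ → ℕ
poly k c n = c * n ^ k + c

count : (m : ℕ) → (Vec Bool m → Bool) → ℕ
count zero    f = if f [] then 1 else 0
count (suc m) f = count m (λ y → f (false ∷ y)) + count m (λ y → f (true ∷ y))

Total : OTM → Lang → (ℕ → ℕ) → (ℕ → ℕ) → Set
Total M O T m = ∀ (x : List Bool) (y : Vec Bool (m (length x))) →
  Σ Bool λ b → exec M O (T (length x)) x (toList y) ≡ just b

#acc : OTM → Lang → (ℕ → ℕ) → (ℕ → ℕ) → List Bool → ℕ
#acc M O T m x = count (m (length x)) (λ y → accepts (exec M O (T (length x)) x (toList y)))

-- Relativized complexity classes: Class O L means "L ∈ 𝒞^O".

Class : Set₁
Class = Lang → Lang → Set

P : Class
P O L = Σ OTM λ M → Σ ℕ λ k → Σ ℕ λ c →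
  ∀ x → exec M O (poly k c (length x)) x [] ≡ just (L x)

NP : Class
NP O L = Σ OTM λ M → Σ ℕ λ k → Σ ℕ λ c → Σ ℕ λ d → Σ ℕ λ e →
  Total M O (poly k c) (poly d e) ×
  (∀ x → (L x ≡ true) ⇔ (Σ (Vec Bool (poly d e (length x))) λ y →
            exec M O (poly k c (length x)) x (toList y) ≡ just true))

ParityP : Class
ParityP O L = Σ OTM λ M → Σ ℕ λ k → Σ ℕ λ c → Σ ℕ λ d → Σ ℕ λ e →
  Total M O (poly k c) (poly d e) ×
  (∀ x → (L x ≡ true) ⇔ (#acc M O (poly k c) (poly d e) x % 2 ≡ 1))

PEXP : Class
PEXP O L = Σ OTM λ M → Σ ℕ λ k → Σ ℕ λ c → Σ ℕ λ d → Σ ℕ λ e →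
  Total M O (λ n → 2 ^ poly k c n) (λ n → 2 ^ poly d e n) ×
  (∀ x → (L x ≡ true) ⇔
     (2 ^ (2 ^ poly d e (length x)) < 2 * #acc M O (λ n → 2 ^ poly k c n) (λ n → 2 ^ poly d e n) x))

infixr 8 _^ᶜ_
_^ᶜ_ : Class → Class → Class
(C ^ᶜ D) O L = Σ Lang λ A → D O A × C A L

_≐_at_ : Class → Class → Lang → Set
(C ≐ D at O) = ∀ L → C O L ⇔ D O L

{-# OPTIONS --safe #-}
module Submission where

open import Defs
open import Data.Bool using (Bool; true; false; if_then_else_; not; _∧_; _xor_)
import Data.Bool.Properties as Bool
open import Data.Empty using (⊥; ⊥-elim)
open import Data.Integer using (ℤ; +_; -[1+_]; 0ℤ; 1ℤ; ∣_∣)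
import Data.Integer as ℤ
import Data.Integer.Properties as ℤP
open import Data.Integer.Tactic.RingSolver using () renaming (solve-∀ to ℤ-solve)
open import Data.List using (List; []; _∷_; length; map; _++_; _ʳ++_; filter; upTo; cartesianProduct; replicate; reverse; take; mapMaybe)
open import Data.List.Membership.Propositional using (_∈_; _∉_)
open import Data.List.Membership.Propositional.Properties using (∈-map⁺; ∈-map⁻; ∈-++⁻; ∈-++⁺ˡ; ∈-++⁺ʳ; ∈-upTo⁺; ∈-upTo⁻; ∈-cartesianProduct⁺; ∈-cartesianProduct⁻)
import Data.List.Properties as List
open import Data.List.Relation.Unary.All as All using (All; []; _∷_)
import Data.List.Relation.Unary.All.Properties as All
open import Data.List.Relation.Unary.Any using (here; there; any?)
import Data.List.Relation.Unary.Any.Properties as Any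
open import Data.List.Relation.Unary.Unique.Propositional using (Unique; []; _∷_)
import Data.List.Relation.Unary.Unique.Propositional.Properties as Unique
open import Data.Nat using (ℕ; zero; suc; _+_; _*_; _^_; _∸_; _%_; _≤_; _<_; z≤n; s≤s; _≤?_; _<?_; _≡ᵇ_; _<ᵇ_; NonZero; >-nonZero)
open import Data.Nat.DivMod using (%-distribˡ-+)
open import Data.Nat.ListAction using (sum)
open import Data.Nat.Properties
open import Data.Nat.Tactic.RingSolver using () renaming (solve-∀ to ℕ-solve)
open import Data.Product using (Σ; _×_; _,_; proj₁; proj₂; ∃)
import Data.Product.Properties as Product
open import Data.Sum using (_⊎_; inj₁; inj₂)
open import Function using (id)
open import Function.Bundles using (_⇔_; mk⇔; Equivalence)
open import Relation.Binary.PropositionalEquality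
open import Relation.Nullary using (¬_; Dec; yes; no; does; contradiction)
open import Relation.Nullary.Decidable using (¬?; dec-true; dec-false)

-- A single oracle O serves both parts. A query parses as a pair (u , z); when u names a majority machine M with an
-- input x, the answers at (u , z) with length z = r form the region of the key (u , r). The region records the verdict
-- of M on x twice: as the parity of its number of ones, and as a bit of its lexicographically largest one. So PEXP is
-- contained in ⊕P and, by binary search with NP queries, in P^NP. Other queries of length n simulate computations on
-- the part of O at strings of length ≤ log n, so whatever is computed from O by finitely many P, NP or ⊕P levels is
-- decided in PEXP with one exponentially long query.
--
-- Regions are decided in stages. The excess of accepting over rejecting paths of M is a polynomial of low degree in
-- the oracle bits. Each key contributes a "sieve", a polynomial in the excess which is nine times larger for one sign
-- than for the other, and all choices still open are made so as to nearly maximise the product Φ of the sieves; being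
-- close to the maximum then forces every sign. By a discrete Markov inequality some slot among exponentially many can
-- be set without changing Φ much, so the verdict can be written into the region. The next stage multiplies its sieves
-- with a high power of Φ, which keeps the earlier signs. Bisection of the lexicographic order finds a zone of unused
-- slots such that using it raises the maximum of Φ at most by a factor 2.

-- Finite differences

-- The obstacle is circularity: a machine may query the very region that is to record its verdict,
-- and regions of all later stages, so no finite stage can compute the verdict. A stage instead
-- fixes, for each key, a sign shared by all completions that come close enough to the maximum. The
-- constants form one budget. Bisection costs a factor 2, and writing the bits costs less than a
-- quarter of the maximum, so a stage ends within a factor 4 of its maximum. Completions are allowed
-- to fall to a factor 8, and 8 is still less than the 9 by which a wrong sign would raise the
-- product above its value. Simulation queries would ruin the degree if they were expanded
-- recursively. They see only strings so short that earlier stages have decided them, so within a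
-- stage they count as constants. All arithmetic of the encoding (which zone, how many bits, when to
-- stop) is done by the oracle, so that only two concrete machines have to be programmed.

Δ : (ℤ → ℤ) → ℤ → ℤ
Δ f x = f (x ℤ.+ 1ℤ) ℤ.- f x

-- Degree is defined through vanishing differences, because a vanishing difference is all that the
-- estimate at 0 needs; coefficients never appear.
DegreeBelow : ℕ → (ℤ → ℤ) → Set
DegreeBelow zero    f = ∀ x → f x ≡ 0ℤ
DegreeBelow (suc n) f = DegreeBelow n (Δ f)

DegreeBelow-cong : ∀ n {f g} → (∀ x → f x ≡ g x) → DegreeBelow n f → DegreeBelow n g
DegreeBelow-cong zero    e h x = trans (sym (e x)) (h x)
DegreeBelow-cong (suc n) e h = DegreeBelow-cong n (λ x → cong₂ ℤ._-_ (e _) (e x)) h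

DegreeBelow-+ : ∀ n {f g} → DegreeBelow n f → DegreeBelow n g → DegreeBelow n (λ x → f x ℤ.+ g x)
DegreeBelow-+ zero    h k x rewrite h x | k x = refl
DegreeBelow-+ (suc n) {f} {g} h k =
  DegreeBelow-cong n (λ x → rearrange (f (x ℤ.+ 1ℤ)) (f x) (g (x ℤ.+ 1ℤ)) (g x)) (DegreeBelow-+ n h k)
  where
  rearrange : ∀ a b c d → (a ℤ.- b) ℤ.+ (c ℤ.- d) ≡ (a ℤ.+ c) ℤ.- (b ℤ.+ d)
  rearrange = ℤ-solve

DegreeBelow-scale : ∀ n c {f} → DegreeBelow n f → DegreeBelow n (λ x → c ℤ.* f x)
DegreeBelow-scale zero    c h x rewrite h x = ℤP.*-zeroʳ c
DegreeBelow-scale (suc n) c {f} h =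
  DegreeBelow-cong n (λ x → distrib c (f (x ℤ.+ 1ℤ)) (f x)) (DegreeBelow-scale n c h)
  where
  distrib : ∀ c a b → c ℤ.* (a ℤ.- b) ≡ c ℤ.* a ℤ.- c ℤ.* b
  distrib = ℤ-solve

DegreeBelow-shift : ∀ n {f} → DegreeBelow n f → DegreeBelow n (λ x → f (x ℤ.+ 1ℤ))
DegreeBelow-shift zero    h x = h _
DegreeBelow-shift (suc n) h   = DegreeBelow-shift n h

DegreeBelow-x* : ∀ n {f} → DegreeBelow n f → DegreeBelow (suc n) (λ x → x ℤ.* f x)
DegreeBelow-x* zero    {f} h x rewrite h x | h (x ℤ.+ 1ℤ) | ℤP.*-zeroʳ x | ℤP.*-zeroʳ (x ℤ.+ 1ℤ) = refl
DegreeBelow-x* (suc n) {f} h =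
  DegreeBelow-cong (suc n) (λ x → leibniz x (f (x ℤ.+ 1ℤ)) (f x))
    (DegreeBelow-+ (suc n) {λ x → x ℤ.* Δ f x} {λ x → f (x ℤ.+ 1ℤ)} (DegreeBelow-x* n h) (DegreeBelow-shift (suc n) {f} h))
  where
  leibniz : ∀ x a b → x ℤ.* (a ℤ.- b) ℤ.+ a ≡ (x ℤ.+ 1ℤ) ℤ.* a ℤ.- x ℤ.* b
  leibniz = ℤ-solve

binom : ℕ → ℕ → ℕ
binom n       zero    = 1
binom zero    (suc k) = 0
binom (suc n) (suc k) = binom n k + binom n (suc k)

binom-absorb : ∀ n k → suc k * binom (suc n) (suc k) ≡ suc n * binom n k
binom-absorb zero    zero    = refl
binom-absorb zero    (suc k) = *-zeroʳ (suc (suc k))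
binom-absorb (suc n) zero    = begin
  1 * (1 + binom (suc n) 1) ≡⟨ cong (λ t → 1 * (1 + t)) (trans (sym (*-identityˡ _)) (binom-absorb n 0)) ⟩
  1 * (1 + suc n * 1) ≡⟨ arith n ⟩
  suc (suc n) * 1 ∎
  where
  open ≡-Reasoning
  arith : ∀ n → 1 * (1 + suc n * 1) ≡ suc (suc n) * 1
  arith = ℕ-solve
binom-absorb (suc n) (suc k) = begin
  suc (suc k) * (b + binom (suc n) (suc (suc k))) ≡⟨ split (suc k) b _ ⟩
  suc k * b + (b + suc (suc k) * binom (suc n) (suc (suc k))) ≡⟨ cong₂ (λ s t → s + (b + t)) (binom-absorb n k) (binom-absorb n (suc k)) ⟩
  suc n * binom n k + (b + suc n * binom n (suc k)) ≡⟨ join (suc n) (binom n k) (binom n (suc k)) ⟩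
  suc (suc n) * (binom n k + binom n (suc k)) ∎
  where
  open ≡-Reasoning
  b = binom (suc n) (suc k)
  split : ∀ m b c → suc m * (b + c) ≡ m * b + (b + suc m * c)
  split = ℕ-solve
  join : ∀ m x y → m * x + ((x + y) + m * y) ≡ suc m * (x + y)
  join = ℕ-solve

-- Adding `suc d * binom (suc n) (suc d)` to both sides turns the left one into
-- `suc n * binom (suc n) (suc d)`; Pascal's rule and `binom-absorb` then produce the right one.
binom-middle : ∀ d → suc d * binom (suc (2 * d)) d ≡ suc (2 * d) * binom (2 * d) d
binom-middle zero    = refl
binom-middle (suc d) = +-cancelʳ-≡ (suc d * binom (suc n) (suc d)) _ _ (begin
  suc (suc d) * binom (suc n) (suc d) + suc d * binom (suc n) (suc d)
                                                    ≡⟨ collect d (binom (suc n) (suc d)) ⟩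
  suc n * binom (suc n) (suc d) ≡⟨⟩
  suc n * (binom n d + binom n (suc d)) ≡⟨ *-distribˡ-+ (suc n) (binom n d) _ ⟩
  suc n * binom n d + suc n * binom n (suc d) ≡⟨ cong (_+ suc n * binom n (suc d)) (sym (binom-absorb n d)) ⟩
  suc d * binom (suc n) (suc d) + suc n * binom n (suc d) ≡⟨ +-comm (suc d * binom (suc n) (suc d)) _ ⟩
  suc n * binom n (suc d) + suc d * binom (suc n) (suc d) ∎)
  where
  open ≡-Reasoning
  n = 2 * suc d
  collect : ∀ d b → suc (suc d) * b + suc d * b ≡ suc (2 * suc d) * b
  collect = ℕ-solve

binom-central-step : ∀ d → suc d * binom (2 * suc d) (suc d) ≡ 2 * (suc (2 * d) * binom (2 * d) d)
binom-central-step d = begin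
  suc d * binom (2 * suc d) (suc d) ≡⟨ cong (λ t → suc d * binom t (suc d)) (2*suc d) ⟩
  suc d * binom (suc (suc (2 * d))) (suc d) ≡⟨ binom-absorb (suc (2 * d)) d ⟩
  suc (suc (2 * d)) * binom (suc (2 * d)) d ≡⟨ regroup d (binom (suc (2 * d)) d) ⟩
  2 * (suc d * binom (suc (2 * d)) d) ≡⟨ cong (2 *_) (binom-middle d) ⟩
  2 * (suc (2 * d) * binom (2 * d) d) ∎
  where
  open ≡-Reasoning
  2*suc : ∀ d → 2 * suc d ≡ suc (suc (2 * d))
  2*suc = ℕ-solve
  regroup : ∀ d b → suc (suc (2 * d)) * b ≡ 2 * (suc d * b)
  regroup = ℕ-solve

-- The middle one of 2d + 1 coefficients with sum 4^d is the largest; the recurrence gives the bound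
-- without comparing them. It says that the centre carries a fair share of the total weight of the
-- 2d-th difference.
binom-central-large : ∀ d → 2 ^ (2 * d) ≤ suc (2 * d) * binom (2 * d) d
binom-central-large zero    = ≤-refl
binom-central-large (suc d) = begin
  2 ^ (2 * suc d) ≡⟨ cong (2 ^_) (2*suc d) ⟩
  2 * (2 * 2 ^ (2 * d)) ≤⟨ *-monoʳ-≤ 2 (*-monoʳ-≤ 2 (binom-central-large d)) ⟩
  2 * (2 * (suc (2 * d) * binom (2 * d) d)) ≡⟨ cong (2 *_) (sym (binom-central-step d)) ⟩
  2 * (suc d * binom (2 * suc d) (suc d)) ≡⟨ sym (*-assoc 2 (suc d) _) ⟩
  2 * suc d * binom (2 * suc d) (suc d) ≤⟨ *-monoˡ-≤ (binom (2 * suc d) (suc d)) (n≤1+n (2 * suc d)) ⟩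
  suc (2 * suc d) * binom (2 * suc d) (suc d) ∎
  where
  open ≤-Reasoning
  2*suc : ∀ d → 2 * suc d ≡ suc (suc (2 * d))
  2*suc = ℕ-solve

binom-central-pos : ∀ d → 1 ≤ binom (2 * d) d
binom-central-pos d with binom (2 * d) d | binom-central-large d
... | suc _ | _ = s≤s z≤n
... | zero  | h = contra (≤-trans (m^n>0 2 (2 * d)) (subst (2 ^ (2 * d) ≤_) (*-zeroʳ (suc (2 * d))) h))
  where
  contra : ∀ {A : Set} → 1 ≤ 0 → A
  contra ()

Δ^ : ℕ → (ℤ → ℤ) → ℤ → ℤ
Δ^ zero    f x = f x
Δ^ (suc n) f x = Δ^ n (Δ f) x

Δ^-suc : ∀ n f x → Δ^ (suc n) f x ≡ Δ^ n f (x ℤ.+ 1ℤ) ℤ.- Δ^ n f x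
Δ^-suc zero    f x = refl
Δ^-suc (suc n) f x = Δ^-suc n (Δ f) x

Δ^-vanishes : ∀ n {f} → DegreeBelow n f → ∀ x → Δ^ n f x ≡ 0ℤ
Δ^-vanishes zero    h x = h x
Δ^-vanishes (suc n) h x = Δ^-vanishes n h x

parity± : ℕ → ℤ
parity± zero    = 1ℤ
parity± (suc n) = ℤ.- parity± n

∣parity±∣ : ∀ n → ∣ parity± n ∣ ≡ 1
∣parity±∣ zero    = refl
∣parity±∣ (suc n) = trans (ℤP.∣-i∣≡∣i∣ (parity± n)) (∣parity±∣ n)

coef : ℕ → ℕ → ℤ
coef n k = parity± (n + k) ℤ.* + binom n k

coef-suc : ∀ n k → coef (suc n) (suc k) ≡ coef n k ℤ.- coef n (suc k)
coef-suc n k rewrite +-suc n k | ℤP.pos-+ (binom n k) (binom n (suc k)) =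
  arith (parity± (n + k)) (+ binom n k) (+ binom n (suc k))
  where
  arith : ∀ s a b → (ℤ.- ℤ.- s) ℤ.* (a ℤ.+ b) ≡ s ℤ.* a ℤ.- (ℤ.- s) ℤ.* b
  arith = ℤ-solve

-- Every point but the k-th contributes at most V times its binomial coefficient to the n-th difference.
Δ^-isolate : ∀ n k f x V → (∀ j → j ≤ n → j ≢ k → ∣ f (x ℤ.+ + j) ∣ ≤ V) →
             ∣ Δ^ n f x ℤ.- coef n k ℤ.* f (x ℤ.+ + k) ∣ + V * binom n k ≤ V * 2 ^ n
Δ^-isolate zero zero f x V h = begin
  ∣ f x ℤ.- 1ℤ ℤ.* f (x ℤ.+ 0ℤ) ∣ + V * 1 ≡⟨ cong (λ t → ∣ f x ℤ.- 1ℤ ℤ.* f t ∣ + V * 1) (ℤP.+-identityʳ x) ⟩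
  ∣ f x ℤ.- 1ℤ ℤ.* f x ∣ + V * 1 ≡⟨ cong (λ t → ∣ t ∣ + V * 1) (cancel (f x)) ⟩
  V * 1 ∎
  where
  open ≤-Reasoning
  cancel : ∀ a → a ℤ.- 1ℤ ℤ.* a ≡ 0ℤ
  cancel = ℤ-solve
Δ^-isolate zero (suc k) f x V h = begin
  ∣ f x ℤ.- parity± (suc k) ℤ.* 0ℤ ℤ.* f (x ℤ.+ + suc k) ∣ + V * 0
      ≡⟨ cong₂ (λ s t → ∣ s ∣ + t) (drop (f x) (parity± (suc k)) _) (*-zeroʳ V) ⟩
  ∣ f x ∣ + 0 ≡⟨ +-identityʳ _ ⟩
  ∣ f x ∣ ≡⟨ cong (λ t → ∣ f t ∣) (sym (ℤP.+-identityʳ x)) ⟩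
  ∣ f (x ℤ.+ 0ℤ) ∣ ≤⟨ h 0 z≤n (λ ()) ⟩
  V ≡⟨ sym (*-identityʳ V) ⟩
  V * 1 ∎
  where
  open ≤-Reasoning
  drop : ∀ a s b → a ℤ.- s ℤ.* 0ℤ ℤ.* b ≡ a
  drop = ℤ-solve
Δ^-isolate (suc n) zero f x V h = begin
  ∣ Δ^ (suc n) f x ℤ.- coef (suc n) 0 ℤ.* y ∣ + V * 1
    ≡⟨ cong (λ t → ∣ t ℤ.- coef (suc n) 0 ℤ.* y ∣ + V * 1) (Δ^-suc n f x) ⟩
  ∣ (u ℤ.- v) ℤ.- coef (suc n) 0 ℤ.* y ∣ + V * 1
    ≡⟨ cong (λ t → ∣ t ∣ + V * 1) (regroup u v (parity± (n + 0)) y) ⟩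
  ∣ u ℤ.- (v ℤ.- coef n 0 ℤ.* y) ∣ + V * 1
    ≤⟨ +-monoˡ-≤ (V * 1) (ℤP.∣i-j∣≤∣i∣+∣j∣ u _) ⟩
  ∣ u ∣ + ∣ v ℤ.- coef n 0 ℤ.* y ∣ + V * 1
    ≡⟨ +-assoc ∣ u ∣ _ _ ⟩
  ∣ u ∣ + (∣ v ℤ.- coef n 0 ℤ.* y ∣ + V * 1)
    ≤⟨ +-mono-≤ all-small (Δ^-isolate n 0 f x V (λ j j≤n → h j (m≤n⇒m≤1+n j≤n))) ⟩
  V * 2 ^ n + V * 2 ^ n
    ≡⟨ double V (2 ^ n) ⟩
  V * 2 ^ suc n ∎
  where
  open ≤-Reasoning
  y = f (x ℤ.+ + 0)
  u = Δ^ n f (x ℤ.+ 1ℤ)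
  v = Δ^ n f x
  regroup : ∀ u v s y → (u ℤ.- v) ℤ.- (ℤ.- s ℤ.* 1ℤ) ℤ.* y ≡ u ℤ.- (v ℤ.- (s ℤ.* 1ℤ) ℤ.* y)
  regroup = ℤ-solve
  double : ∀ V p → V * p + V * p ≡ V * (2 * p)
  double = ℕ-solve
  drop : ∀ a s b → a ℤ.- (s ℤ.* 0ℤ) ℤ.* b ≡ a
  drop = ℤ-solve
  binom-out : ∀ m j → binom m (suc (m + j)) ≡ 0
  binom-out zero    j = refl
  binom-out (suc m) j = cong₂ _+_ (binom-out m j) (subst (λ t → binom m t ≡ 0) (cong suc (+-suc m j)) (binom-out m (suc j)))
  -- Induction with an index beyond n: the coefficient there is zero, so no point is singled out and
  -- the plain bound on the whole difference results.
  all-small : ∣ u ∣ ≤ V * 2 ^ n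
  all-small = begin
    ∣ u ∣ ≡⟨ cong ∣_∣ (sym (drop u (parity± (n + suc (n + 0))) _)) ⟩
    ∣ u ℤ.- (parity± (n + suc (n + 0)) ℤ.* 0ℤ) ℤ.* f (x ℤ.+ 1ℤ ℤ.+ + suc (n + 0)) ∣
      ≡⟨ cong (λ t → ∣ u ℤ.- (parity± (n + suc (n + 0)) ℤ.* + t) ℤ.* f (x ℤ.+ 1ℤ ℤ.+ + suc (n + 0)) ∣) (sym (binom-out n 0)) ⟩
    ∣ u ℤ.- coef n (suc (n + 0)) ℤ.* f (x ℤ.+ 1ℤ ℤ.+ + suc (n + 0)) ∣ ≤⟨ m≤m+n _ (V * binom n (suc (n + 0))) ⟩
    _ ≤⟨ Δ^-isolate n (suc (n + 0)) f (x ℤ.+ 1ℤ) V (λ j j≤n _ → subst (λ t → ∣ f t ∣ ≤ V) (sym (ℤP.+-assoc x 1ℤ (+ j))) (h (suc j) (s≤s j≤n) (λ ()))) ⟩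
    V * 2 ^ n ∎
Δ^-isolate (suc n) (suc k) f x V h = begin
  ∣ Δ^ (suc n) f x ℤ.- coef (suc n) (suc k) ℤ.* y ∣ + V * (binom n k + binom n (suc k))
    ≡⟨ cong₂ (λ s t → ∣ s ℤ.- t ℤ.* y ∣ + V * (binom n k + binom n (suc k))) (Δ^-suc n f x) (coef-suc n k) ⟩
  ∣ (u ℤ.- v) ℤ.- (coef n k ℤ.- coef n (suc k)) ℤ.* y ∣ + V * (binom n k + binom n (suc k))
    ≡⟨ cong₂ (λ s t → ∣ s ∣ + t) (regroup u v (coef n k) (coef n (suc k)) y) (*-distribˡ-+ V (binom n k) _) ⟩
  ∣ (u ℤ.- coef n k ℤ.* y) ℤ.- (v ℤ.- coef n (suc k) ℤ.* y) ∣ + (V * binom n k + V * binom n (suc k))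
    ≤⟨ +-monoˡ-≤ _ (ℤP.∣i-j∣≤∣i∣+∣j∣ (u ℤ.- coef n k ℤ.* y) _) ⟩
  ∣ u ℤ.- coef n k ℤ.* y ∣ + ∣ v ℤ.- coef n (suc k) ℤ.* y ∣ + (V * binom n k + V * binom n (suc k))
    ≡⟨ swap ∣ u ℤ.- coef n k ℤ.* y ∣ _ (V * binom n k) _ ⟩
  (∣ u ℤ.- coef n k ℤ.* y ∣ + V * binom n k) + (∣ v ℤ.- coef n (suc k) ℤ.* y ∣ + V * binom n (suc k))
    ≤⟨ +-mono-≤ left (Δ^-isolate n (suc k) f x V (λ j j≤n → h j (m≤n⇒m≤1+n j≤n))) ⟩
  V * 2 ^ n + V * 2 ^ n
    ≡⟨ double V (2 ^ n) ⟩
  V * 2 ^ suc n ∎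
  where
  open ≤-Reasoning
  y = f (x ℤ.+ + suc k)
  u = Δ^ n f (x ℤ.+ 1ℤ)
  v = Δ^ n f x
  regroup : ∀ u v a b y → (u ℤ.- v) ℤ.- (a ℤ.- b) ℤ.* y ≡ (u ℤ.- a ℤ.* y) ℤ.- (v ℤ.- b ℤ.* y)
  regroup = ℤ-solve
  swap : ∀ a b c d → a + b + (c + d) ≡ (a + c) + (b + d)
  swap = ℕ-solve
  double : ∀ V p → V * p + V * p ≡ V * (2 * p)
  double = ℕ-solve
  shift : ∀ j → x ℤ.+ 1ℤ ℤ.+ + j ≡ x ℤ.+ + suc j
  shift j = ℤP.+-assoc x 1ℤ (+ j)
  left : ∣ u ℤ.- coef n k ℤ.* y ∣ + V * binom n k ≤ V * 2 ^ n
  left = subst (λ t → ∣ u ℤ.- coef n k ℤ.* f t ∣ + V * binom n k ≤ V * 2 ^ n) (shift k)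
    (Δ^-isolate n k f (x ℤ.+ 1ℤ) V (λ j j≤n j≢k → subst (λ t → ∣ f t ∣ ≤ V) (sym (shift j)) (h (suc j) (s≤s j≤n) (λ e → j≢k (suc-injective e)))))

-- A discrete substitute for Markov's inequality: apply the 2d-th difference, which kills f, around 0.
value-at-0-small : ∀ d f V → DegreeBelow (2 * d) f → (∀ x → ∣ x ∣ ≤ d → x ≢ 0ℤ → ∣ f x ∣ ≤ V) → ∣ f 0ℤ ∣ ≤ 2 * d * V
value-at-0-small d f V h b = *-cancelˡ-≤ B {{>-nonZero (binom-central-pos d)}} (+-cancelʳ-≤ (V * B) _ _ (begin
  B * ∣ f 0ℤ ∣ + V * B
    ≡⟨ cong (_+ V * B) (trans (sym abs) (trans (cong ∣_∣ (negate (coef (2 * d) d) (f 0ℤ)) ) (ℤP.∣-i∣≡∣i∣ (0ℤ ℤ.- coef (2 * d) d ℤ.* f 0ℤ)))) ⟩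
  ∣ 0ℤ ℤ.- coef (2 * d) d ℤ.* f 0ℤ ∣ + V * B
    ≡⟨ cong₂ (λ s t → ∣ s ℤ.- coef (2 * d) d ℤ.* f t ∣ + V * B) (sym (Δ^-vanishes (2 * d) h (ℤ.- + d))) (sym (ℤP.+-inverseˡ (+ d))) ⟩
  ∣ Δ^ (2 * d) f (ℤ.- + d) ℤ.- coef (2 * d) d ℤ.* f (ℤ.- + d ℤ.+ + d) ∣ + V * B
    ≤⟨ Δ^-isolate (2 * d) d f (ℤ.- + d) V (λ j j≤2d j≢d → b _ (near j j≤2d) (λ e → j≢d (away j e))) ⟩
  V * 2 ^ (2 * d)
    ≤⟨ *-monoʳ-≤ V (binom-central-large d) ⟩
  V * (suc (2 * d) * B)
    ≡⟨ regroup V (2 * d) B ⟩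
  B * (2 * d * V) + V * B ∎))
  where
  open ≤-Reasoning
  B = binom (2 * d) d
  negate : ∀ a y → a ℤ.* y ≡ ℤ.- (0ℤ ℤ.- a ℤ.* y)
  negate = ℤ-solve
  regroup : ∀ V m B → V * (suc m * B) ≡ B * (m * V) + V * B
  regroup = ℕ-solve
  abs : ∣ coef (2 * d) d ℤ.* f 0ℤ ∣ ≡ B * ∣ f 0ℤ ∣
  abs = trans (ℤP.∣i*j∣≡∣i∣*∣j∣ (coef (2 * d) d) (f 0ℤ))
    (cong (_* ∣ f 0ℤ ∣) (trans (ℤP.∣i*j∣≡∣i∣*∣j∣ (parity± (2 * d + d)) (+ B))
      (trans (cong (_* B) (∣parity±∣ (2 * d + d))) (*-identityˡ B))))
  near : ∀ j → j ≤ 2 * d → ∣ ℤ.- + d ℤ.+ + j ∣ ≤ d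
  near j j≤2d = begin
    ∣ ℤ.- + d ℤ.+ + j ∣ ≡⟨ cong ∣_∣ (trans (ℤP.+-comm (ℤ.- + d) (+ j)) (ℤP.m-n≡m⊖n j d)) ⟩
    ∣ j ℤ.⊖ d ∣ ≤⟨ bound (≤-total d j) ⟩
    d ∎
    where
    bound : d ≤ j ⊎ j ≤ d → ∣ j ℤ.⊖ d ∣ ≤ d
    bound (inj₁ d≤j) rewrite ℤP.⊖-≥ d≤j = m≤n+o⇒m∸n≤o j d (≤-trans j≤2d (≤-reflexive (cong (λ t → d + t) (+-identityʳ d))))
    bound (inj₂ j≤d) rewrite ℤP.⊖-≤ j≤d | ℤP.∣-i∣≡∣i∣ (+ (d ∸ j)) = m∸n≤m d j
  away : ∀ j → ℤ.- + d ℤ.+ + j ≡ 0ℤ → j ≡ d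
  away j e = ℤP.+-injective (trans (recentre (+ j) (+ d)) (trans (cong (λ t → + d ℤ.+ t) e) (ℤP.+-identityʳ (+ d))))
    where
    recentre : ∀ a b → a ≡ b ℤ.+ (ℤ.- b ℤ.+ a)
    recentre = ℤ-solve

-- Polynomials over oracle variables

Var : Set
Var = List Bool × List Bool

Assignment : Set
Assignment = Var → Bool

_≟ᵛ_ : (v w : Var) → Dec (v ≡ w)
_≟ᵛ_ = Product.≡-dec (List.≡-dec Bool._≟_) (List.≡-dec Bool._≟_)

_[_≔_] : Assignment → Var → Bool → Assignment
(σ [ v ≔ b ]) w = if does (w ≟ᵛ v) then b else σ w

set-same : ∀ σ v b → (σ [ v ≔ b ]) v ≡ b
set-same σ v b with v ≟ᵛ v
... | yes _ = refl
... | no v≢v = contradiction refl v≢v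

set-other : ∀ σ v b {w} → w ≢ v → (σ [ v ≔ b ]) w ≡ σ w
set-other σ v b {w} w≢v with w ≟ᵛ v
... | yes w≡v = contradiction w≡v w≢v
... | no _ = refl

set-cong : ∀ σ τ v b {w} → (w ≢ v → σ w ≡ τ w) → (σ [ v ≔ b ]) w ≡ (τ [ v ≔ b ]) w
set-cong σ τ v b {w} e with w ≟ᵛ v
... | yes _ = refl
... | no w≢v = e w≢v

bit : Bool → ℤ
bit true  = 1ℤ
bit false = 0ℤ

monomial : List Var → Assignment → Bool
monomial []      σ = true
monomial (w ∷ m) σ = σ w ∧ monomial m σ

indicator : List Var → Assignment → ℤ
indicator m σ = bit (monomial m σ)

polynomial : List (ℤ × List Var) → Assignment → ℤ
polynomial []            σ = 0ℤ
polynomial ((c , m) ∷ p) σ = c ℤ.* bit (monomial m σ) ℤ.+ polynomial p σ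

record HasDegree (D : ℕ) (F : Assignment → ℤ) : Set where
  constructor hasDegree
  field
    terms      : List (ℤ × List Var)
    small      : All (λ t → length (proj₂ t) ≤ D) terms
    represents : ∀ σ → F σ ≡ polynomial terms σ

monomial-cong : ∀ m {σ τ} → (∀ w → w ∈ m → σ w ≡ τ w) → monomial m σ ≡ monomial m τ
monomial-cong []      e = refl
monomial-cong (w ∷ m) e = cong₂ _∧_ (e w (here refl)) (monomial-cong m (λ u u∈m → e u (there u∈m)))

monomial-false : ∀ {m v} σ → v ∈ m → σ v ≡ false → monomial m σ ≡ false
monomial-false σ (here refl) e rewrite e = refl
monomial-false {w ∷ m} σ (there v∈m) e rewrite monomial-false σ v∈m e = Bool.∧-zeroʳ (σ w)

_∖_ : List Var → Var → List Var
m ∖ v = filter (λ w → ¬? (w ≟ᵛ v)) m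

monomial-∖ : ∀ m {v σ} → σ v ≡ true → monomial m σ ≡ monomial (m ∖ v) σ
monomial-∖ []      e = refl
monomial-∖ (w ∷ m) {v} {σ} e with w ≟ᵛ v
... | yes refl rewrite e = monomial-∖ m e
... | no _     = cong (σ w ∧_) (monomial-∖ m e)

∉-∖ : ∀ m v → v ∉ m ∖ v
∉-∖ (w ∷ m) v i with w ≟ᵛ v
... | yes refl = ∉-∖ m v i
∉-∖ (w ∷ m) v (here refl) | no w≢v = w≢v refl
∉-∖ (w ∷ m) v (there i)   | no _   = ∉-∖ m v i

length-∖ : ∀ m {v} → v ∈ m → length (m ∖ v) < length m
length-∖ m v∈m = List.filter-notAll _ m (Data.List.Relation.Unary.Any.map (λ v≡w w≢v → w≢v (sym v≡w)) v∈m)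

-- Up to the factor M ^ length vs, the mean of F when each variable in vs is set independently with probability t / M.
spread : ℤ → ℤ → List Var → (Assignment → ℤ) → Assignment → ℤ
spread M t []       F σ = F σ
spread M t (v ∷ vs) F σ = t ℤ.* spread M t vs F (σ [ v ≔ true ]) ℤ.+ (M ℤ.- t) ℤ.* spread M t vs F σ

total-increment : List Var → (Assignment → ℤ) → Assignment → ℤ
total-increment []       F σ = 0ℤ
total-increment (v ∷ vs) F σ = (F (σ [ v ≔ true ]) ℤ.- F σ) ℤ.+ total-increment vs F σ

ℤpow : ℤ → ℕ → ℤ
ℤpow M zero    = 1ℤ
ℤpow M (suc n) = M ℤ.* ℤpow M n

spread-indep : ∀ M t vs m {σ τ} → (∀ w → w ∈ m → σ w ≡ τ w) →
               spread M t vs (indicator m) σ ≡ spread M t vs (indicator m) τ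
spread-indep M t []       m e = cong bit (monomial-cong m e)
spread-indep M t (v ∷ vs) m {σ} {τ} e =
  cong₂ (λ a b → t ℤ.* a ℤ.+ (M ℤ.- t) ℤ.* b)
    (spread-indep M t vs m (λ w w∈m → set-cong σ τ v true (λ _ → e w w∈m)))
    (spread-indep M t vs m e)

spread-false : ∀ M t vs m {v σ} → v ∈ m → All (v ≢_) vs → σ v ≡ false →
               spread M t vs (indicator m) σ ≡ 0ℤ
spread-false M t []       m v∈m _          e = cong bit (monomial-false _ v∈m e)
spread-false M t (w ∷ vs) m {σ = σ} v∈m (v≢w ∷ nv) e
  rewrite spread-false M t vs m {σ = σ [ w ≔ true ]} v∈m nv (trans (set-other σ w true v≢w) e) | spread-false M t vs m {σ = σ} v∈m nv e =
  zeros t (M ℤ.- t)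
  where
  zeros : ∀ a b → a ℤ.* 0ℤ ℤ.+ b ℤ.* 0ℤ ≡ 0ℤ
  zeros = ℤ-solve

spread-∖ : ∀ M t vs m {v σ} → All (v ≢_) vs → σ v ≡ true →
           spread M t vs (indicator m) σ ≡ spread M t vs (indicator (m ∖ v)) σ
spread-∖ M t []       m _          e = cong bit (monomial-∖ m e)
spread-∖ M t (w ∷ vs) m {σ = σ} (v≢w ∷ nv) e =
  cong₂ (λ a b → t ℤ.* a ℤ.+ (M ℤ.- t) ℤ.* b)
    (spread-∖ M t vs m nv (trans (set-other σ w true v≢w) e)) (spread-∖ M t vs m nv e)

total-increment-false : ∀ vs m {v σ} → v ∈ m → All (v ≢_) vs → σ v ≡ false →
                        total-increment vs (indicator m) σ ≡ 0ℤ
total-increment-false []       m v∈m _          e = refl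
total-increment-false (w ∷ vs) m {σ = σ} v∈m (v≢w ∷ nv) e
  rewrite total-increment-false vs m {σ = σ} v∈m nv e
        | monomial-false (σ [ w ≔ true ]) v∈m (trans (set-other σ w true v≢w) e) | monomial-false σ v∈m e = refl

-- The spread is a polynomial in t; `slope` is what remains after removing the constant term and
-- dividing by t, so its value at 0 is the derivative there, which is the total increment up to a
-- power of M. The degree is recorded after t = x², because the slope will be estimated at squares.
record Expansion (D : ℕ) (M : ℤ) (vs : List Var) (F : Assignment → ℤ) (σ : Assignment) : Set where
  field
    slope   : ℤ → ℤ
    slope-degree  : DegreeBelow (2 * D) (λ x → slope (x ℤ.* x))
    expand  : ∀ t → spread M t vs F σ ≡ ℤpow M (length vs) ℤ.* F σ ℤ.+ t ℤ.* slope t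
    initial : M ℤ.* slope 0ℤ ≡ ℤpow M (length vs) ℤ.* total-increment vs F σ

open Expansion

DegreeBelow-zero : ∀ n → DegreeBelow n (λ _ → 0ℤ)
DegreeBelow-zero zero    x = refl
DegreeBelow-zero (suc n) = DegreeBelow-cong n (λ _ → refl) (DegreeBelow-zero n)

DegreeBelow-const : ∀ n c → DegreeBelow (suc n) (λ _ → c)
DegreeBelow-const n c = DegreeBelow-cong n (λ _ → sym (ℤP.+-inverseʳ c)) (DegreeBelow-zero n)

-- A slot that occurs in the monomial is still false and must be set: this yields a factor t and
-- removes the variable, so the degree in t is at most the length of the monomial. Any other slot
-- only multiplies by M.
expansion-monomial : ∀ D M vs m σ → Unique vs → All (λ v → σ v ≡ false) vs → length m ≤ D →
                     Expansion D M vs (indicator m) σ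
expansion-monomial D M [] m σ _ _ _ = record
  { slope = λ _ → 0ℤ ; slope-degree = DegreeBelow-zero (2 * D) ; expand = λ t → base t (bit (monomial m σ))
  ; initial = trans (ℤP.*-zeroʳ M) refl }
  where
  base : ∀ t a → a ≡ 1ℤ ℤ.* a ℤ.+ t ℤ.* 0ℤ
  base = ℤ-solve
expansion-monomial D M (v ∷ vs) m σ (v∉vs ∷ uniq) (σv ∷ σvs) len with any? (v ≟ᵛ_) m
... | no v∉m = record
  { slope = λ t → M ℤ.* slope rec t
  ; slope-degree = DegreeBelow-scale (2 * D) M (slope-degree rec)
  ; expand = λ t → trans (cong (λ a → t ℤ.* a ℤ.+ (M ℤ.- t) ℤ.* spread M t vs F σ) (spread-indep M t vs m unchanged))
      (trans (cong (λ a → t ℤ.* a ℤ.+ (M ℤ.- t) ℤ.* a) (expand rec t)) (collect M t (q) (F σ) (slope rec t)))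
  ; initial = begin
      M ℤ.* (M ℤ.* slope rec 0ℤ) ≡⟨ cong (M ℤ.*_) (initial rec) ⟩
      M ℤ.* (q ℤ.* total-increment vs F σ) ≡⟨ drop M (q) (F σ) _ ⟩
      M ℤ.* q ℤ.* ((F σ ℤ.- F σ) ℤ.+ total-increment vs F σ)
        ≡⟨ cong (λ a → M ℤ.* q ℤ.* ((a ℤ.- F σ) ℤ.+ total-increment vs F σ)) (sym (cong bit (monomial-cong m unchanged))) ⟩
      _ ∎ }
  where
  open ≡-Reasoning
  F = indicator m
  q = ℤpow M (length vs)
  rec = expansion-monomial D M vs m σ uniq σvs len
  unchanged : ∀ w → w ∈ m → (σ [ v ≔ true ]) w ≡ σ w
  unchanged w w∈m = set-other σ v true (λ { refl → v∉m w∈m })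
  collect : ∀ M t p a s → t ℤ.* (p ℤ.* a ℤ.+ t ℤ.* s) ℤ.+ (M ℤ.- t) ℤ.* (p ℤ.* a ℤ.+ t ℤ.* s) ≡ M ℤ.* p ℤ.* a ℤ.+ t ℤ.* (M ℤ.* s)
  collect = ℤ-solve
  drop : ∀ M p a s → M ℤ.* (p ℤ.* s) ≡ M ℤ.* p ℤ.* ((a ℤ.- a) ℤ.+ s)
  drop = ℤ-solve
expansion-monomial zero    M (v ∷ vs) (_ ∷ _) σ _ _ () | yes v∈m
expansion-monomial (suc D) M (v ∷ vs) m σ (v∉vs ∷ uniq) (σv ∷ σvs) len | yes v∈m = record
  { slope = λ t → q ℤ.* G σ ℤ.+ t ℤ.* slope rec t
  ; slope-degree = subst (λ n → DegreeBelow n (λ x → q ℤ.* G σ ℤ.+ (x ℤ.* x) ℤ.* slope rec (x ℤ.* x))) (2*suc D)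
      (DegreeBelow-+ (suc (suc (2 * D))) {λ _ → q ℤ.* G σ} {λ x → (x ℤ.* x) ℤ.* slope rec (x ℤ.* x)}
        (DegreeBelow-const (suc (2 * D)) (q ℤ.* G σ))
        (DegreeBelow-cong (suc (suc (2 * D))) (λ x → sym (ℤP.*-assoc x x _))
          (DegreeBelow-x* (suc (2 * D)) {λ x → x ℤ.* slope rec (x ℤ.* x)} (DegreeBelow-x* (2 * D) (slope-degree rec)))))
  ; expand = λ t → begin
      t ℤ.* spread M t vs F (σ [ v ≔ true ]) ℤ.+ (M ℤ.- t) ℤ.* spread M t vs F σ
        ≡⟨ cong₂ (λ a b → t ℤ.* a ℤ.+ (M ℤ.- t) ℤ.* b)
             (trans (spread-∖ M t vs m v∉vs (set-same σ v true)) (spread-indep M t vs (m ∖ v) unchanged))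
             (spread-false M t vs m v∈m v∉vs σv) ⟩
      t ℤ.* spread M t vs G σ ℤ.+ (M ℤ.- t) ℤ.* 0ℤ
        ≡⟨ cong (λ a → t ℤ.* a ℤ.+ (M ℤ.- t) ℤ.* 0ℤ) (expand rec t) ⟩
      t ℤ.* (q ℤ.* G σ ℤ.+ t ℤ.* slope rec t) ℤ.+ (M ℤ.- t) ℤ.* 0ℤ
        ≡⟨ regroup M t (q ℤ.* G σ ℤ.+ t ℤ.* slope rec t) (M ℤ.* q) ⟩
      M ℤ.* q ℤ.* 0ℤ ℤ.+ t ℤ.* (q ℤ.* G σ ℤ.+ t ℤ.* slope rec t)
        ≡⟨ cong (λ b → M ℤ.* q ℤ.* bit b ℤ.+ t ℤ.* (q ℤ.* G σ ℤ.+ t ℤ.* slope rec t)) (sym (monomial-false σ v∈m σv)) ⟩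
      _ ∎
  ; initial = begin
      M ℤ.* (q ℤ.* G σ ℤ.+ 0ℤ ℤ.* slope rec 0ℤ)
        ≡⟨ tidy M (q) (G σ) (slope rec 0ℤ) ⟩
      M ℤ.* q ℤ.* ((G σ ℤ.- 0ℤ) ℤ.+ 0ℤ)
        ≡⟨ cong₂ (λ a b → M ℤ.* q ℤ.* ((a ℤ.- bit b) ℤ.+ 0ℤ))
             (sym (trans (cong bit (monomial-∖ m (set-same σ v true))) (cong bit (monomial-cong (m ∖ v) unchanged))))
             (sym (monomial-false σ v∈m σv)) ⟩
      M ℤ.* q ℤ.* ((F (σ [ v ≔ true ]) ℤ.- F σ) ℤ.+ 0ℤ)
        ≡⟨ cong (λ a → M ℤ.* q ℤ.* ((F (σ [ v ≔ true ]) ℤ.- F σ) ℤ.+ a)) (sym (total-increment-false vs m v∈m v∉vs σv)) ⟩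
      _ ∎ }
  where
  open ≡-Reasoning
  F = indicator m
  q = ℤpow M (length vs)
  G = indicator (m ∖ v)
  rec = expansion-monomial D M vs (m ∖ v) σ uniq σvs (≤-pred (≤-trans (length-∖ m v∈m) len))
  2*suc : ∀ D → suc (suc (2 * D)) ≡ 2 * suc D
  2*suc = ℕ-solve
  unchanged : ∀ w → w ∈ m ∖ v → (σ [ v ≔ true ]) w ≡ σ w
  unchanged w w∈ = set-other σ v true (λ { refl → ∉-∖ m v w∈ })
  regroup : ∀ M t s p → t ℤ.* s ℤ.+ (M ℤ.- t) ℤ.* 0ℤ ≡ p ℤ.* 0ℤ ℤ.+ t ℤ.* s
  regroup = ℤ-solve
  tidy : ∀ M p a s → M ℤ.* (p ℤ.* a ℤ.+ 0ℤ ℤ.* s) ≡ M ℤ.* p ℤ.* ((a ℤ.- 0ℤ) ℤ.+ 0ℤ)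
  tidy = ℤ-solve

spread-linear : ∀ M t vs c F G σ → spread M t vs (λ ρ → c ℤ.* F ρ ℤ.+ G ρ) σ ≡ c ℤ.* spread M t vs F σ ℤ.+ spread M t vs G σ
spread-linear M t []       c F G σ = refl
spread-linear M t (v ∷ vs) c F G σ
  rewrite spread-linear M t vs c F G (σ [ v ≔ true ]) | spread-linear M t vs c F G σ =
  distrib t (M ℤ.- t) c (spread M t vs F (σ [ v ≔ true ])) (spread M t vs G (σ [ v ≔ true ])) (spread M t vs F σ) (spread M t vs G σ)
  where
  distrib : ∀ t s c a b a′ b′ → t ℤ.* (c ℤ.* a ℤ.+ b) ℤ.+ s ℤ.* (c ℤ.* a′ ℤ.+ b′) ≡ c ℤ.* (t ℤ.* a ℤ.+ s ℤ.* a′) ℤ.+ (t ℤ.* b ℤ.+ s ℤ.* b′)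
  distrib = ℤ-solve

spread-zero : ∀ M t vs σ → spread M t vs (λ _ → 0ℤ) σ ≡ 0ℤ
spread-zero M t []       σ = refl
spread-zero M t (v ∷ vs) σ rewrite spread-zero M t vs (σ [ v ≔ true ]) | spread-zero M t vs σ = zeros t M
  where
  zeros : ∀ t M → t ℤ.* 0ℤ ℤ.+ (M ℤ.- t) ℤ.* 0ℤ ≡ 0ℤ
  zeros = ℤ-solve

spread-cong : ∀ M t vs {F G} → (∀ ρ → F ρ ≡ G ρ) → ∀ σ → spread M t vs F σ ≡ spread M t vs G σ
spread-cong M t []       e σ = e σ
spread-cong M t (v ∷ vs) e σ = cong₂ (λ a b → t ℤ.* a ℤ.+ (M ℤ.- t) ℤ.* b) (spread-cong M t vs e _) (spread-cong M t vs e σ)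

total-increment-linear : ∀ vs c F G σ → total-increment vs (λ ρ → c ℤ.* F ρ ℤ.+ G ρ) σ ≡ c ℤ.* total-increment vs F σ ℤ.+ total-increment vs G σ
total-increment-linear []       c F G σ = zero-case c
  where
  zero-case : ∀ c → 0ℤ ≡ c ℤ.* 0ℤ ℤ.+ 0ℤ
  zero-case = ℤ-solve
total-increment-linear (v ∷ vs) c F G σ rewrite total-increment-linear vs c F G σ =
  distrib c (F (σ [ v ≔ true ])) (G (σ [ v ≔ true ])) (F σ) (G σ) (total-increment vs F σ) (total-increment vs G σ)
  where
  distrib : ∀ c a b a′ b′ s s′ → ((c ℤ.* a ℤ.+ b) ℤ.- (c ℤ.* a′ ℤ.+ b′)) ℤ.+ (c ℤ.* s ℤ.+ s′) ≡ c ℤ.* ((a ℤ.- a′) ℤ.+ s) ℤ.+ ((b ℤ.- b′) ℤ.+ s′)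
  distrib = ℤ-solve

total-increment-zero : ∀ vs σ → total-increment vs (λ _ → 0ℤ) σ ≡ 0ℤ
total-increment-zero []       σ = refl
total-increment-zero (v ∷ vs) σ rewrite total-increment-zero vs σ = refl

total-increment-cong : ∀ vs {F G} → (∀ ρ → F ρ ≡ G ρ) → ∀ σ → total-increment vs F σ ≡ total-increment vs G σ
total-increment-cong []       e σ = refl
total-increment-cong (v ∷ vs) e σ rewrite e (σ [ v ≔ true ]) | e σ | total-increment-cong vs e σ = refl

expansion-polynomial : ∀ D M vs p σ → Unique vs → All (λ v → σ v ≡ false) vs → All (λ t → length (proj₂ t) ≤ D) p →
                       Expansion D M vs (polynomial p) σ
expansion-polynomial D M vs [] σ u z _ = record
  { slope = λ _ → 0ℤ ; slope-degree = DegreeBelow-zero (2 * D)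
  ; expand = λ t → trans (spread-zero M t vs σ) (zeros t (ℤpow M (length vs)))
  ; initial = trans (ℤP.*-zeroʳ M) (sym (trans (cong (ℤpow M (length vs) ℤ.*_) (total-increment-zero vs σ)) (ℤP.*-zeroʳ (ℤpow M (length vs))))) }
  where
  zeros : ∀ t p → 0ℤ ≡ p ℤ.* 0ℤ ℤ.+ t ℤ.* 0ℤ
  zeros = ℤ-solve
expansion-polynomial D M vs ((c , m) ∷ p) σ u z (s ∷ ss) = record
  { slope = λ t → c ℤ.* slope e₁ t ℤ.+ slope e₂ t
  ; slope-degree = DegreeBelow-+ (2 * D) {λ x → c ℤ.* slope e₁ (x ℤ.* x)} {λ x → slope e₂ (x ℤ.* x)}
      (DegreeBelow-scale (2 * D) c (slope-degree e₁)) (slope-degree e₂)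
  ; expand = λ t → trans (spread-linear M t vs c F (polynomial p) σ)
      (trans (cong₂ (λ a b → c ℤ.* a ℤ.+ b) (expand e₁ t) (expand e₂ t))
        (distrib c t (ℤpow M (length vs)) (F σ) (polynomial p σ) (slope e₁ t) (slope e₂ t)))
  ; initial = begin
      M ℤ.* (c ℤ.* slope e₁ 0ℤ ℤ.+ slope e₂ 0ℤ) ≡⟨ out M c (slope e₁ 0ℤ) (slope e₂ 0ℤ) ⟩
      c ℤ.* (M ℤ.* slope e₁ 0ℤ) ℤ.+ M ℤ.* slope e₂ 0ℤ ≡⟨ cong₂ (λ a b → c ℤ.* a ℤ.+ b) (initial e₁) (initial e₂) ⟩
      c ℤ.* (q ℤ.* total-increment vs F σ) ℤ.+ q ℤ.* total-increment vs (polynomial p) σ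
                                                              ≡⟨ sym (out q c _ _) ⟩
      q ℤ.* (c ℤ.* total-increment vs F σ ℤ.+ total-increment vs (polynomial p) σ)
                                                              ≡⟨ cong (q ℤ.*_) (sym (total-increment-linear vs c F (polynomial p) σ)) ⟩
      _ ∎ }
  where
  open ≡-Reasoning
  F = indicator m
  q = ℤpow M (length vs)
  e₁ = expansion-monomial D M vs m σ u z s
  e₂ = expansion-polynomial D M vs p σ u z ss
  distrib : ∀ c t q a b s₁ s₂ → c ℤ.* (q ℤ.* a ℤ.+ t ℤ.* s₁) ℤ.+ (q ℤ.* b ℤ.+ t ℤ.* s₂) ≡ q ℤ.* (c ℤ.* a ℤ.+ b) ℤ.+ t ℤ.* (c ℤ.* s₁ ℤ.+ s₂)
  distrib = ℤ-solve
  out : ∀ M c a b → M ℤ.* (c ℤ.* a ℤ.+ b) ≡ c ℤ.* (M ℤ.* a) ℤ.+ M ℤ.* b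
  out = ℤ-solve

expansion : ∀ {D F} M vs σ → HasDegree D F → Unique vs → All (λ v → σ v ≡ false) vs → Expansion D M vs F σ
expansion {D} {F} M vs σ (hasDegree p s e) u z = record
  { slope = slope ex ; slope-degree = slope-degree ex
  ; expand = λ t → trans (spread-cong M t vs e σ) (trans (expand ex t) (cong (λ a → ℤpow M (length vs) ℤ.* a ℤ.+ t ℤ.* slope ex t) (sym (e σ))))
  ; initial = trans (initial ex) (cong (ℤpow M (length vs) ℤ.*_) (sym (total-increment-cong vs e σ))) }
  where
  ex = expansion-polynomial D M vs p σ u z s

open Expansion

ℤpow-pos : ∀ M n → ℤpow (+ M) n ≡ + (M ^ n)
ℤpow-pos M zero    = refl
ℤpow-pos M (suc n) rewrite ℤpow-pos M n = sym (ℤP.pos-* M (M ^ n))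

-- For t ≤ M both weights are nonnegative, so the spread is a scaled mean of values of `φ`. `Q`
-- restricts the bound to assignments that are reached by setting slots.
spread-bounded : ∀ {M t} vs (φ : Assignment → ℕ) V (Q : Assignment → Set) → t ≤ M →
                 (∀ τ v → v ∈ vs → Q τ → Q (τ [ v ≔ true ])) → (∀ τ → Q τ → φ τ ≤ V) → ∀ σ → Q σ →
                 Σ ℕ λ b → spread (+ M) (+ t) vs (λ τ → + φ τ) σ ≡ + b × b ≤ V * M ^ length vs
spread-bounded [] φ V Q t≤M closed ub σ q = φ σ , refl , ≤-trans (ub σ q) (≤-reflexive (sym (*-identityʳ V)))
spread-bounded {M} {t} (v ∷ vs) φ V Q t≤M closed ub σ q
  with spread-bounded {M} {t} vs φ V Q t≤M (λ τ w i → closed τ w (there i)) ub (σ [ v ≔ true ]) (closed σ v (here refl) q)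
     | spread-bounded {M} {t} vs φ V Q t≤M (λ τ w i → closed τ w (there i)) ub σ q
... | a , ea , a≤ | b , eb , b≤ = t * a + (M ∸ t) * b , eq , (begin
  t * a + (M ∸ t) * b ≤⟨ +-mono-≤ (*-monoʳ-≤ t a≤) (*-monoʳ-≤ (M ∸ t) b≤) ⟩
  t * W + (M ∸ t) * W ≡⟨ sym (*-distribʳ-+ W t (M ∸ t)) ⟩
  (t + (M ∸ t)) * W ≡⟨ cong (_* W) (m+[n∸m]≡n t≤M) ⟩
  M * W ≡⟨ swap M V (M ^ length vs) ⟩
  V * M ^ length (v ∷ vs) ∎)
  where
  open ≤-Reasoning
  W = V * M ^ length vs
  swap : ∀ M V p → M * (V * p) ≡ V * (M * p)
  swap = ℕ-solve
  eq : spread (+ M) (+ t) (v ∷ vs) (λ τ → + φ τ) σ ≡ + (t * a + (M ∸ t) * b)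
  eq rewrite ea | eb | ℤP.m-n≡m⊖n M t | ℤP.⊖-≥ t≤M | sym (ℤP.pos-* t a) | sym (ℤP.pos-* (M ∸ t) b) = refl

difference-bounded : ∀ a b {W} → a ≤ W → b ≤ W → ∣ + a ℤ.- + b ∣ ≤ W
difference-bounded a b a≤ b≤ rewrite ℤP.m-n≡m⊖n a b = ≤-trans (ℤP.∣m⊝n∣≤m⊔n a b) (⊔-lub a≤ b≤)

-- With M = D², every t = x² with |x| ≤ D is a legitimate weight. At such t ≠ 0 the product of t and
-- the slope is a difference of two numbers between 0 and V M^N, N the number of slots, so the slope
-- is bounded; `value-at-0-small` carries the bound to 0. That lemma needs points on both sides of 0
-- while t cannot be negative, which is why squares are substituted.
total-increment-small :
  ∀ D V vs σ (φ : Assignment → ℕ) → 1 ≤ D → HasDegree D (λ τ → + φ τ) → Unique vs → All (λ v → σ v ≡ false) vs →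
  (Q : Assignment → Set) → (∀ τ v → v ∈ vs → Q τ → Q (τ [ v ≔ true ])) → (∀ τ → Q τ → φ τ ≤ V) → Q σ →
  ∣ total-increment vs (λ τ → + φ τ) σ ∣ ≤ D * D * (2 * D * V)
total-increment-small D V vs σ φ 1≤D deg u z Q closed ub q =
  *-cancelˡ-≤ p {{m^n≢0 M (length vs) {{>-nonZero (*-mono-≤ 1≤D 1≤D)}}}} (begin
    p * ∣ S ∣ ≡⟨ cong (_* ∣ S ∣) (cong ∣_∣ (sym (ℤpow-pos M (length vs)))) ⟩
    ∣ ℤpow (+ M) (length vs) ∣ * ∣ S ∣ ≡⟨ sym (ℤP.∣i*j∣≡∣i∣*∣j∣ (ℤpow (+ M) (length vs)) S) ⟩
    ∣ ℤpow (+ M) (length vs) ℤ.* S ∣ ≡⟨ cong ∣_∣ (sym (initial ex)) ⟩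
    ∣ + M ℤ.* slope ex 0ℤ ∣ ≡⟨ ℤP.∣i*j∣≡∣i∣*∣j∣ (+ M) (slope ex 0ℤ) ⟩
    M * ∣ slope ex 0ℤ ∣ ≤⟨ *-monoʳ-≤ M (value-at-0-small D (λ x → slope ex (x ℤ.* x)) (V * p) (slope-degree ex) at-squares) ⟩
    M * (2 * D * (V * p)) ≡⟨ regroup M D V p ⟩
    p * (M * (2 * D * V)) ∎)
  where
  open ≤-Reasoning
  M = D * D
  p = M ^ length vs
  S = total-increment vs (λ τ → + φ τ) σ
  ex = expansion (+ M) vs σ deg u z
  regroup : ∀ M D V p → M * (2 * D * (V * p)) ≡ p * (M * (2 * D * V))
  regroup = ℕ-solve
  isolate : ∀ a b c → a ≡ b ℤ.+ c → c ≡ a ℤ.- b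
  isolate a b c refl = cancel b c
    where
    cancel : ∀ b c → c ≡ (b ℤ.+ c) ℤ.- b
    cancel = ℤ-solve
  at-squares : ∀ x → ∣ x ∣ ≤ D → x ≢ 0ℤ → ∣ slope ex (x ℤ.* x) ∣ ≤ V * p
  at-squares x x≤D x≢0 with spread-bounded {M} {∣ x ∣ * ∣ x ∣} vs φ V Q (*-mono-≤ x≤D x≤D) closed ub σ q
  ... | b , eb , b≤ = begin
    ∣ slope ex (x ℤ.* x) ∣ ≤⟨ m≤n*m _ (∣ x ∣ * ∣ x ∣) {{>-nonZero (*-mono-≤ 1≤x 1≤x)}} ⟩
    ∣ x ∣ * ∣ x ∣ * ∣ slope ex (x ℤ.* x) ∣ ≡⟨ cong (_* ∣ slope ex (x ℤ.* x) ∣) (sym (ℤP.∣i*j∣≡∣i∣*∣j∣ x x)) ⟩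
    ∣ x ℤ.* x ∣ * ∣ slope ex (x ℤ.* x) ∣ ≡⟨ sym (ℤP.∣i*j∣≡∣i∣*∣j∣ (x ℤ.* x) _) ⟩
    ∣ x ℤ.* x ℤ.* slope ex (x ℤ.* x) ∣ ≡⟨ cong ∣_∣ (isolate _ _ _ (expand ex (x ℤ.* x))) ⟩
    ∣ spread (+ M) (x ℤ.* x) vs (λ τ → + φ τ) σ ℤ.- ℤpow (+ M) (length vs) ℤ.* + φ σ ∣
      ≡⟨ cong₂ (λ a c → ∣ a ℤ.- c ∣)
           (trans (cong (λ t → spread (+ M) t vs (λ τ → + φ τ) σ) square) eb)
           (trans (cong (ℤ._* + φ σ) (ℤpow-pos M (length vs))) (sym (ℤP.pos-* p (φ σ)))) ⟩
    ∣ + b ℤ.- + (p * φ σ) ∣ ≤⟨ difference-bounded b (p * φ σ) b≤ (≤-trans (*-monoʳ-≤ p (ub σ q)) (≤-reflexive (*-comm p V))) ⟩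
    V * p ∎
    where
    1≤x : 1 ≤ ∣ x ∣
    1≤x with ∣ x ∣ in e
    ... | zero  = contradiction (ℤP.∣i∣≡0⇒i≡0 e) x≢0
    ... | suc _ = s≤s z≤n
    square : x ℤ.* x ≡ + (∣ x ∣ * ∣ x ∣)
    square = square′ x
      where
      square′ : ∀ x → x ℤ.* x ≡ + (∣ x ∣ * ∣ x ∣)
      square′ (+ n)    = sym (ℤP.pos-* n n)
      square′ -[1+ n ] = refl

-- Multiplying by `c` replaces the tolerance V / c. A slot that fails loses at least `suc V` after
-- scaling, and if all fail these losses add up to the total increment.
gentle-or-steep : ∀ c V vs σ (φ : Assignment → ℕ) →
  (∃ λ v → v ∈ vs × c * φ σ ≤ c * φ (σ [ v ≔ true ]) + V) ⊎
  (∃ λ k → + c ℤ.* total-increment vs (λ τ → + φ τ) σ ≡ ℤ.- + k × length vs * suc V ≤ k)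
gentle-or-steep c V [] σ φ = inj₂ (0 , ℤP.*-zeroʳ (+ c) , z≤n)
gentle-or-steep c V (v ∷ vs) σ φ with c * φ σ ≤? c * φ (σ [ v ≔ true ]) + V | gentle-or-steep c V vs σ φ
... | yes h | _ = inj₁ (v , here refl , h)
... | no  _ | inj₁ (w , w∈ , h) = inj₁ (w , there w∈ , h)
... | no ¬h | inj₂ (k , e , h) = inj₂ (suc V + d + k , eq , (begin
    suc V + length vs * suc V ≤⟨ +-mono-≤ (m≤m+n (suc V) d) h ⟩
    suc V + d + k ∎))
  where
  open ≤-Reasoning
  a = φ (σ [ v ≔ true ])
  d = c * φ σ ∸ suc (c * a + V)
  S = total-increment vs (λ τ → + φ τ) σ
  gap : + c ℤ.* + φ σ ≡ + c ℤ.* + a ℤ.+ + (suc V + d)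
  gap = trans (sym (ℤP.pos-* c (φ σ)))
    (trans (cong +_ (trans (sym (m+[n∸m]≡n (≰⇒> ¬h))) (assoc (c * a) V d)))
      (trans (ℤP.pos-+ (c * a) (suc V + d)) (cong (ℤ._+ + (suc V + d)) (ℤP.pos-* c a))))
    where
    assoc : ∀ x V d → suc (x + V) + d ≡ x + (suc V + d)
    assoc = ℕ-solve
  eq : + c ℤ.* ((+ a ℤ.- + φ σ) ℤ.+ S) ≡ ℤ.- + (suc V + d + k)
  eq = E.begin
    + c ℤ.* ((+ a ℤ.- + φ σ) ℤ.+ S) E.≡⟨ split (+ c) (+ a) (+ φ σ) S ⟩
    (+ c ℤ.* + a ℤ.- + c ℤ.* + φ σ) ℤ.+ + c ℤ.* S E.≡⟨ cong₂ (λ x y → (+ c ℤ.* + a ℤ.- x) ℤ.+ y) gap e ⟩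
    (+ c ℤ.* + a ℤ.- (+ c ℤ.* + a ℤ.+ + (suc V + d))) ℤ.+ (ℤ.- + k) E.≡⟨ merge (+ c ℤ.* + a) (+ (suc V + d)) (+ k) ⟩
    ℤ.- (+ (suc V + d) ℤ.+ + k) E.≡⟨ cong ℤ.-_ (sym (ℤP.pos-+ (suc V + d) k)) ⟩
    ℤ.- + (suc V + d + k) E.∎
    where
    module E = ≡-Reasoning
    split : ∀ c a b s → c ℤ.* ((a ℤ.- b) ℤ.+ s) ≡ (c ℤ.* a ℤ.- c ℤ.* b) ℤ.+ c ℤ.* s
    split = ℤ-solve
    merge : ∀ x y z → (x ℤ.- (x ℤ.+ y)) ℤ.+ (ℤ.- z) ≡ ℤ.- (y ℤ.+ z)
    merge = ℤ-solve

-- The total loss is at most 2 D³ V by `total-increment-small`, so 2 c D³ slots cannot all lose more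
-- than V / c.
gentle-flip :
  ∀ D c V vs σ (φ : Assignment → ℕ) → 1 ≤ D → HasDegree D (λ τ → + φ τ) → Unique vs → All (λ v → σ v ≡ false) vs →
  (Q : Assignment → Set) → (∀ τ v → v ∈ vs → Q τ → Q (τ [ v ≔ true ])) → (∀ τ → Q τ → φ τ ≤ V) → Q σ →
  1 ≤ length vs → c * (D * D * (2 * D)) ≤ length vs →
  ∃ λ v → v ∈ vs × c * φ σ ≤ c * φ (σ [ v ≔ true ]) + V
gentle-flip D c V vs σ φ 1≤D deg u z Q closed ub q 1≤N many with gentle-or-steep c V vs σ φ
... | inj₁ found = found
... | inj₂ (k , e , steep) = contradiction impossible (<⇒≱ (*-monoʳ-< N {{>-nonZero 1≤N}} (n<1+n V)))
  where
  open ≤-Reasoning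
  N = length vs
  S = total-increment vs (λ τ → + φ τ) σ
  regroup : ∀ c M D V → c * (M * (2 * D * V)) ≡ c * (M * (2 * D)) * V
  regroup = ℕ-solve
  impossible : N * suc V ≤ N * V
  impossible = begin
    N * suc V ≤⟨ steep ⟩
    k ≡⟨ sym (ℤP.∣-i∣≡∣i∣ (+ k)) ⟩
    ∣ ℤ.- + k ∣ ≡⟨ cong ∣_∣ (sym e) ⟩
    ∣ + c ℤ.* S ∣ ≡⟨ ℤP.∣i*j∣≡∣i∣*∣j∣ (+ c) S ⟩
    c * ∣ S ∣ ≤⟨ *-monoʳ-≤ c (total-increment-small D V vs σ φ 1≤D deg u z Q closed ub q) ⟩
    c * (D * D * (2 * D * V)) ≡⟨ regroup c (D * D) D V ⟩
    c * (D * D * (2 * D)) * V ≤⟨ *-monoˡ-≤ V many ⟩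
    N * V ∎

-- Closure properties of the degree

HasDegree-cong : ∀ {D F G} → (∀ σ → F σ ≡ G σ) → HasDegree D F → HasDegree D G
HasDegree-cong e (hasDegree p s r) = hasDegree p s (λ σ → trans (sym (e σ)) (r σ))

HasDegree-≤ : ∀ {D E F} → D ≤ E → HasDegree D F → HasDegree E F
HasDegree-≤ D≤E (hasDegree p s r) = hasDegree p (All.map (λ l → ≤-trans l D≤E) s) r

HasDegree-const : ∀ {D} c → HasDegree D (λ _ → c)
HasDegree-const c = hasDegree ((c , []) ∷ []) (z≤n ∷ []) (λ _ → unit c)
  where
  unit : ∀ c → c ≡ c ℤ.* 1ℤ ℤ.+ 0ℤ
  unit = ℤ-solve

HasDegree-var : ∀ v → HasDegree 1 (λ σ → bit (σ v))
HasDegree-var v = hasDegree ((1ℤ , v ∷ []) ∷ []) (≤-refl ∷ [])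
  (λ σ → trans (cong bit (sym (Bool.∧-identityʳ (σ v)))) (unit (bit (σ v ∧ true))))
  where
  unit : ∀ c → c ≡ 1ℤ ℤ.* c ℤ.+ 0ℤ
  unit = ℤ-solve

polynomial-++ : ∀ p q σ → polynomial (p ++ q) σ ≡ polynomial p σ ℤ.+ polynomial q σ
polynomial-++ []            q σ = sym (ℤP.+-identityˡ _)
polynomial-++ ((c , m) ∷ p) q σ rewrite polynomial-++ p q σ = sym (ℤP.+-assoc (c ℤ.* bit (monomial m σ)) _ _)

HasDegree-+ : ∀ {D F G} → HasDegree D F → HasDegree D G → HasDegree D (λ σ → F σ ℤ.+ G σ)
HasDegree-+ (hasDegree p s r) (hasDegree p′ s′ r′) =
  hasDegree (p ++ p′) (All.++⁺ s s′) (λ σ → trans (cong₂ ℤ._+_ (r σ) (r′ σ)) (sym (polynomial-++ p p′ σ)))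

monomial-++ : ∀ m m′ σ → bit (monomial (m ++ m′) σ) ≡ bit (monomial m σ) ℤ.* bit (monomial m′ σ)
monomial-++ []      m′ σ = sym (ℤP.*-identityˡ _)
monomial-++ (w ∷ m) m′ σ with σ w
... | true  = monomial-++ m m′ σ
... | false = refl

scale-terms : ℤ → List Var → List (ℤ × List Var) → List (ℤ × List Var)
scale-terms c m []              = []
scale-terms c m ((c′ , m′) ∷ q) = (c ℤ.* c′ , m ++ m′) ∷ scale-terms c m q

multiply-terms : List (ℤ × List Var) → List (ℤ × List Var) → List (ℤ × List Var)
multiply-terms []            q = []
multiply-terms ((c , m) ∷ p) q = scale-terms c m q ++ multiply-terms p q

polynomial-scale : ∀ c m q σ → polynomial (scale-terms c m q) σ ≡ c ℤ.* bit (monomial m σ) ℤ.* polynomial q σ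
polynomial-scale c m []              σ = sym (ℤP.*-zeroʳ (c ℤ.* bit (monomial m σ)))
polynomial-scale c m ((c′ , m′) ∷ q) σ rewrite polynomial-scale c m q σ | monomial-++ m m′ σ =
  distrib c c′ (bit (monomial m σ)) (bit (monomial m′ σ)) (polynomial q σ)
  where
  distrib : ∀ c c′ a b r → c ℤ.* c′ ℤ.* (a ℤ.* b) ℤ.+ c ℤ.* a ℤ.* r ≡ c ℤ.* a ℤ.* (c′ ℤ.* b ℤ.+ r)
  distrib = ℤ-solve

polynomial-multiply : ∀ p q σ → polynomial (multiply-terms p q) σ ≡ polynomial p σ ℤ.* polynomial q σ
polynomial-multiply []            q σ = refl
polynomial-multiply ((c , m) ∷ p) q σ
  rewrite polynomial-++ (scale-terms c m q) (multiply-terms p q) σ | polynomial-scale c m q σ | polynomial-multiply p q σ =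
  sym (ℤP.*-distribʳ-+ (polynomial q σ) (c ℤ.* bit (monomial m σ)) (polynomial p σ))

scale-terms-small : ∀ {D E} c m q → length m ≤ D → All (λ t → length (proj₂ t) ≤ E) q →
                    All (λ t → length (proj₂ t) ≤ D + E) (scale-terms c m q)
scale-terms-small c m []              l []       = []
scale-terms-small c m ((c′ , m′) ∷ q) l (s ∷ ss) =
  ≤-trans (≤-reflexive (List.length-++ m)) (+-mono-≤ l s) ∷ scale-terms-small c m q l ss

multiply-terms-small : ∀ {D E} p q → All (λ t → length (proj₂ t) ≤ D) p → All (λ t → length (proj₂ t) ≤ E) q →
                       All (λ t → length (proj₂ t) ≤ D + E) (multiply-terms p q)
multiply-terms-small []            q []       s′ = []
multiply-terms-small ((c , m) ∷ p) q (s ∷ ss) s′ = All.++⁺ (scale-terms-small c m q s s′) (multiply-terms-small p q ss s′)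

HasDegree-* : ∀ {D E F G} → HasDegree D F → HasDegree E G → HasDegree (D + E) (λ σ → F σ ℤ.* G σ)
HasDegree-* (hasDegree p s r) (hasDegree p′ s′ r′) =
  hasDegree (multiply-terms p p′) (multiply-terms-small p p′ s s′)
    (λ σ → trans (cong₂ ℤ._*_ (r σ) (r′ σ)) (sym (polynomial-multiply p p′ σ)))

HasDegree-^ : ∀ {D} (φ : Assignment → ℕ) K → HasDegree D (λ σ → + φ σ) → HasDegree (K * D) (λ σ → + (φ σ ^ K))
HasDegree-^ φ zero    h = HasDegree-const 1ℤ
HasDegree-^ φ (suc K) h = HasDegree-cong (λ σ → sym (ℤP.pos-* (φ σ) (φ σ ^ K))) (HasDegree-* h (HasDegree-^ φ K h))

-- Finite support and maxima

FinitelySupported : {B : Set} → (Assignment → B) → Set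
FinitelySupported F = Σ (List Var) λ vs → ∀ σ τ → (∀ v → v ∈ vs → σ v ≡ τ v) → F σ ≡ F τ

polynomial-supported : ∀ p → FinitelySupported (polynomial p)
polynomial-supported []            = [] , λ _ _ _ → refl
polynomial-supported ((c , m) ∷ p) with polynomial-supported p
... | vs , e = m ++ vs , λ σ τ h → cong₂ (λ a b → c ℤ.* bit a ℤ.+ b)
  (monomial-cong m (λ w i → h w (Any.++⁺ˡ i))) (e σ τ (λ w i → h w (Any.++⁺ʳ m i)))

HasDegree-supported : ∀ {D F} → HasDegree D F → FinitelySupported F
HasDegree-supported (hasDegree p _ r) with polynomial-supported p
... | vs , e = vs , λ σ τ h → trans (r σ) (trans (e σ τ h) (sym (r τ)))

Varies : Assignment → (Var → Bool) → Assignment → Set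
Varies ρ free σ = ∀ v → free v ≡ false → σ v ≡ ρ v

maximum-over : ∀ (A : Assignment → ℕ) vs → (∀ σ τ → (∀ v → σ v ≡ τ v) → A σ ≡ A τ) → ∀ ρ free →
               Σ Assignment λ σ* → Varies ρ free σ* × (∀ σ → Varies ρ free σ → (∀ v → v ∉ vs → σ v ≡ ρ v) → A σ ≤ A σ*)
maximum-over A [] cong-A ρ free = ρ , (λ _ _ → refl) , λ σ _ e → ≤-reflexive (cong-A σ ρ (λ v → e v (λ ())))
maximum-over A (v ∷ vs) cong-A ρ free with free v in fv
... | false with maximum-over A vs cong-A ρ free
...   | σ* , in* , max = σ* , in* , λ σ σ∈ e → max σ σ∈ (λ w w∉ → off w w∉ σ∈ e)
  where
  off : ∀ {σ} w → w ∉ vs → Varies ρ free σ → (∀ u → u ∉ v ∷ vs → σ u ≡ ρ u) → σ w ≡ ρ w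
  off w w∉ σ∈ e with w ≟ᵛ v
  ... | yes refl = σ∈ w fv
  ... | no w≢v   = e w (λ { (here w≡v) → w≢v w≡v ; (there i) → w∉ i })
maximum-over A (v ∷ vs) cong-A ρ free | true
  with maximum-over A vs cong-A (ρ [ v ≔ false ]) free | maximum-over A vs cong-A (ρ [ v ≔ true ]) free
... | σ₀ , in₀ , max₀ | σ₁ , in₁ , max₁ = choose (≤-total (A σ₀) (A σ₁))
  where
  Result = Σ Assignment λ σ* → Varies ρ free σ* × (∀ σ → Varies ρ free σ → (∀ w → w ∉ v ∷ vs → σ w ≡ ρ w) → A σ ≤ A σ*)
  not-v : ∀ {w} → free w ≡ false → w ≢ v
  not-v fw refl with () ← trans (sym fv) fw
  into : ∀ {σ} b → Varies ρ free σ → Varies (ρ [ v ≔ b ]) free σ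
  into b σ∈ w fw = trans (σ∈ w fw) (sym (set-other ρ v b (not-v fw)))
  out : ∀ {σ} b → Varies (ρ [ v ≔ b ]) free σ → Varies ρ free σ
  out b σ∈ w fw = trans (σ∈ w fw) (set-other ρ v b (not-v fw))
  off : ∀ σ → (∀ w → w ∉ v ∷ vs → σ w ≡ ρ w) → ∀ b → σ v ≡ b → ∀ w → w ∉ vs → σ w ≡ (ρ [ v ≔ b ]) w
  off σ e b σv w w∉ with w ≟ᵛ v
  ... | yes refl = σv
  ... | no w≢v   = e w (λ { (here w≡v) → w≢v w≡v ; (there i) → w∉ i })
  either : ∀ σ → Varies ρ free σ → (∀ w → w ∉ v ∷ vs → σ w ≡ ρ w) → ∀ {m} → A σ₀ ≤ m → A σ₁ ≤ m → A σ ≤ m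
  either σ σ∈ e l₀ l₁ with σ v in σv
  ... | false = ≤-trans (max₀ σ (into false σ∈) (off σ e false σv)) l₀
  ... | true  = ≤-trans (max₁ σ (into true σ∈) (off σ e true σv)) l₁
  choose : A σ₀ ≤ A σ₁ ⊎ A σ₁ ≤ A σ₀ → Result
  choose (inj₁ le) = σ₁ , out true in₁ , λ σ σ∈ e → either σ σ∈ e le ≤-refl
  choose (inj₂ ge) = σ₀ , out false in₀ , λ σ σ∈ e → either σ σ∈ e ≤-refl ge

-- There are infinitely many assignments, but only the values on the support matter: `merge` keeps
-- those and resets everything else to `ρ`, which turns any competitor into one that `maximum-over`
-- has considered.
maximum : ∀ (A : Assignment → ℕ) → FinitelySupported A → ∀ ρ free →
          Σ Assignment λ σ* → Varies ρ free σ* × (∀ σ → Varies ρ free σ → A σ ≤ A σ*)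
maximum A (vs , supp) ρ free with maximum-over A vs (λ σ τ e → supp σ τ (λ v _ → e v)) ρ free
... | σ* , in* , max = σ* , in* , λ σ σ∈ → ≤-trans (≤-reflexive (supp σ (merge σ) (λ v i → sym (merge-in σ i)))) (max (merge σ) (merge-∈ σ∈) (λ v → merge-out σ {v}))
  where
  merge : Assignment → Assignment
  merge σ v = if does (any? (v ≟ᵛ_) vs) then σ v else ρ v
  merge-in : ∀ σ {v} → v ∈ vs → merge σ v ≡ σ v
  merge-in σ {v} i with any? (v ≟ᵛ_) vs
  ... | yes _ = refl
  ... | no ¬i = contradiction i ¬i
  merge-out : ∀ σ {v} → v ∉ vs → merge σ v ≡ ρ v
  merge-out σ {v} ¬i with any? (v ≟ᵛ_) vs
  ... | yes i = contradiction i ¬i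
  ... | no _  = refl
  merge-∈ : ∀ {σ} → Varies ρ free σ → Varies ρ free (merge σ)
  merge-∈ σ∈ v fv with any? (v ≟ᵛ_) vs
  ... | yes _ = σ∈ v fv
  ... | no _  = refl

-- Separating signs

Key : Set
Key = List Bool × ℕ

nonNegative : ℤ → Bool
nonNegative (+ _)    = true
nonNegative -[1+ _ ] = false

signed : Bool → ℤ → ℤ
signed true  t = t
signed false t = ℤ.- t

-- The square makes the factor a nonnegative polynomial: it is (|t| + 2^j)² if t has the sign `η`,
-- and (|t| - 2^j)² otherwise.
factor : ℕ → Bool → ℤ → ℕ
factor j η t = ∣ signed η t ℤ.+ + (2 ^ j) ∣ * ∣ signed η t ℤ.+ + (2 ^ j) ∣

-- For 0 < |t| < 2 ^ n this integer polynomial in t is at least nine times larger when t has the sign η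
-- than when it has the opposite one: a factor with 2 ^ j ≤ |t| < 2 ^ (j + 1) already separates them.
sieve : ℕ → Bool → ℤ → ℕ
sieve zero    η t = 1
sieve (suc n) η t = factor n η t * sieve n η t

∣signed∣ : ∀ t → signed (nonNegative t) t ≡ + ∣ t ∣
∣signed∣ (+ n)    = refl
∣signed∣ -[1+ n ] = refl

-∣signed∣ : ∀ t → signed (not (nonNegative t)) t ≡ ℤ.- + ∣ t ∣
-∣signed∣ (+ n)    = refl
-∣signed∣ -[1+ n ] = refl

factor-right : ∀ j t → factor j (nonNegative t) t ≡ (∣ t ∣ + 2 ^ j) * (∣ t ∣ + 2 ^ j)
factor-right j t rewrite ∣signed∣ t = refl

wrong-root : ∀ j t → ∣ signed (not (nonNegative t)) t ℤ.+ + (2 ^ j) ∣ ≡ ∣ 2 ^ j ℤ.⊖ ∣ t ∣ ∣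
wrong-root j t rewrite -∣signed∣ t | ℤP.+-comm (ℤ.- + ∣ t ∣) (+ (2 ^ j)) | ℤP.m-n≡m⊖n (2 ^ j) ∣ t ∣ = refl

factor-wrong≤right : ∀ j t → factor j (not (nonNegative t)) t ≤ factor j (nonNegative t) t
factor-wrong≤right j t rewrite factor-right j t | wrong-root j t = *-mono-≤ le le
  where
  le : ∣ 2 ^ j ℤ.⊖ ∣ t ∣ ∣ ≤ ∣ t ∣ + 2 ^ j
  le = ≤-trans (ℤP.∣m⊝n∣≤m⊔n (2 ^ j) ∣ t ∣) (⊔-lub (m≤n+m (2 ^ j) ∣ t ∣) (m≤m+n ∣ t ∣ (2 ^ j)))

-- For q ≤ a ≤ 2q the distance a - q is at most a third of a + q; squaring gives the nine.
factor-separates : ∀ j t → 2 ^ j ≤ ∣ t ∣ → ∣ t ∣ ≤ 2 ^ suc j → 9 * factor j (not (nonNegative t)) t ≤ factor j (nonNegative t) t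
factor-separates j t lo hi rewrite factor-right j t | wrong-root j t =
  ≤-trans (≤-reflexive (nine ∣ 2 ^ j ℤ.⊖ ∣ t ∣ ∣)) (*-mono-≤ third third)
  where
  open ≤-Reasoning
  nine : ∀ x → 9 * (x * x) ≡ (3 * x) * (3 * x)
  nine = ℕ-solve
  a = ∣ t ∣
  q = 2 ^ j
  third : 3 * ∣ q ℤ.⊖ a ∣ ≤ a + q
  third rewrite ℤP.∣m⊖n∣≡∣n⊖m∣ q a | ℤP.⊖-≥ lo = +-cancelʳ-≤ (3 * q) _ _ (begin
    3 * (a ∸ q) + 3 * q ≡⟨ sym (*-distribˡ-+ 3 (a ∸ q) q) ⟩
    3 * (a ∸ q + q) ≡⟨ cong (3 *_) (m∸n+n≡m lo) ⟩
    3 * a ≡⟨ three a ⟩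
    a + 2 * a ≤⟨ +-monoʳ-≤ a (*-monoʳ-≤ 2 hi) ⟩
    a + 2 * (2 * q) ≡⟨ regroup a q ⟩
    a + q + 3 * q ∎)
    where
    three : ∀ a → 3 * a ≡ a + 2 * a
    three = ℕ-solve
    regroup : ∀ a q → a + 2 * (2 * q) ≡ a + q + 3 * q
    regroup = ℕ-solve

sieve-wrong≤right : ∀ n t → sieve n (not (nonNegative t)) t ≤ sieve n (nonNegative t) t
sieve-wrong≤right zero    t = ≤-refl
sieve-wrong≤right (suc n) t = *-mono-≤ (factor-wrong≤right n t) (sieve-wrong≤right n t)

sieve≤right : ∀ n η t → sieve n η t ≤ sieve n (nonNegative t) t
sieve≤right n η t with nonNegative t | η | sieve-wrong≤right n t
... | true  | true  | _ = ≤-refl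
... | true  | false | h = h
... | false | true  | h = h
... | false | false | _ = ≤-refl

sieve-separates : ∀ n t → 1 ≤ ∣ t ∣ → ∣ t ∣ < 2 ^ n → 9 * sieve n (not (nonNegative t)) t ≤ sieve n (nonNegative t) t
sieve-separates zero    t lo hi = contradiction lo (<⇒≱ hi)
sieve-separates (suc n) t lo hi with 2 ^ n ≤? ∣ t ∣
... | yes big = begin
  9 * (factor n η t * sieve n η t) ≡⟨ sym (*-assoc 9 (factor n η t) _) ⟩
  9 * factor n η t * sieve n η t ≤⟨ *-mono-≤ (factor-separates n t big (<⇒≤ hi)) (sieve-wrong≤right n t) ⟩
  _ ∎
  where
  open ≤-Reasoning
  η = not (nonNegative t)
... | no small = begin
  9 * (factor n η t * sieve n η t) ≡⟨ swap (factor n η t) _ ⟩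
  factor n η t * (9 * sieve n η t) ≤⟨ *-mono-≤ (factor-wrong≤right n t) (sieve-separates n t lo (≰⇒> small)) ⟩
  _ ∎
  where
  open ≤-Reasoning
  η = not (nonNegative t)
  swap : ∀ f s → 9 * (f * s) ≡ f * (9 * s)
  swap = ℕ-solve

sieve-pos : ∀ n t → 1 ≤ sieve n (nonNegative t) t
sieve-pos zero    t = ≤-refl
sieve-pos (suc n) t rewrite factor-right n t = *-mono-≤ (*-mono-≤ pos pos) (sieve-pos n t)
  where
  pos : 1 ≤ ∣ t ∣ + 2 ^ n
  pos = ≤-trans (m^n>0 2 n) (m≤n+m (2 ^ n) ∣ t ∣)

sieve-bounded : ∀ n m t → m ≤ n → ∣ t ∣ ≤ 2 ^ n → sieve m (nonNegative t) t ≤ 2 ^ (m * (2 * suc n))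
sieve-bounded n zero    t _   _ = ≤-refl
sieve-bounded n (suc m) t m<n b rewrite factor-right m t = begin
  (∣ t ∣ + 2 ^ m) * (∣ t ∣ + 2 ^ m) * sieve m (nonNegative t) t
    ≤⟨ *-mono-≤ (*-mono-≤ root root) (sieve-bounded n m t (<⇒≤ m<n) b) ⟩
  2 ^ suc n * 2 ^ suc n * 2 ^ (m * (2 * suc n))
    ≡⟨ cong (_* 2 ^ (m * (2 * suc n))) (sym (^-distribˡ-+-* 2 (suc n) (suc n))) ⟩
  2 ^ (suc n + suc n) * 2 ^ (m * (2 * suc n))
    ≡⟨ sym (^-distribˡ-+-* 2 (suc n + suc n) (m * (2 * suc n))) ⟩
  2 ^ (suc n + suc n + m * (2 * suc n))
    ≡⟨ cong (λ e → 2 ^ (suc n + e + m * (2 * suc n))) (sym (+-identityʳ (suc n))) ⟩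
  2 ^ (suc m * (2 * suc n)) ∎
  where
  open ≤-Reasoning
  root : ∣ t ∣ + 2 ^ m ≤ 2 ^ suc n
  root = ≤-trans (+-mono-≤ b (^-monoʳ-≤ 2 (<⇒≤ m<n))) (≤-reflexive (cong (λ e → 2 ^ n + e) (sym (+-identityʳ (2 ^ n)))))

HasDegree-signed : ∀ {D F} η → HasDegree D F → HasDegree D (λ σ → signed η (F σ))
HasDegree-signed true  h = h
HasDegree-signed {D} {F} false h =
  HasDegree-cong (λ σ → ℤP.-1*i≡-i (F σ)) (HasDegree-* {0} {D} (HasDegree-const (ℤ.- 1ℤ)) h)

square : ∀ x → x ℤ.* x ≡ + (∣ x ∣ * ∣ x ∣)
square (+ n)    = sym (ℤP.pos-* n n)
square -[1+ n ] = refl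

HasDegree-sieve : ∀ {D F} n η → HasDegree D F → HasDegree (n * (2 * D)) (λ σ → + sieve n η (F σ))
HasDegree-sieve zero    η h = HasDegree-const 1ℤ
HasDegree-sieve {D} {F} (suc n) η h =
  HasDegree-cong (λ σ → sym (ℤP.pos-* (factor n η (F σ)) (sieve n η (F σ))))
    (HasDegree-* {2 * D}
      (HasDegree-≤ (≤-reflexive (cong (λ e → D + e) (sym (+-identityʳ D))))
        (HasDegree-cong (λ σ → square (signed η (F σ) ℤ.+ + (2 ^ n))) (HasDegree-* root root)))
      (HasDegree-sieve n η h))
  where
  root = HasDegree-+ (HasDegree-signed η h) (HasDegree-const (+ (2 ^ n)))

weight : ℕ → (Key → Assignment → ℤ) → (Key → Bool) → List Key → Assignment → ℕ
weight n p η []       σ = 1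
weight n p η (κ ∷ ks) σ = sieve n (η κ) (p κ σ) * weight n p η ks σ

signs : (Key → Assignment → ℤ) → Assignment → Key → Bool
signs p σ κ = nonNegative (p κ σ)

-- The maximum of `weight` over all sign vectors, since each sieve is largest for the true sign. It
-- need not be a polynomial, whereas `weight` for fixed signs is one.
peak : ℕ → (Key → Assignment → ℤ) → List Key → Assignment → ℕ
peak n p ks σ = weight n p (signs p σ) ks σ

weight≤peak : ∀ n p η ks σ → weight n p η ks σ ≤ peak n p ks σ
weight≤peak n p η ks σ = go ks
  where
  go : ∀ ks → weight n p η ks σ ≤ weight n p (signs p σ) ks σ
  go []       = ≤-refl
  go (κ ∷ ks) = *-mono-≤ (sieve≤right n (η κ) (p κ σ)) (go ks)

weight-separates : ∀ n p η ks σ → (∀ κ → 1 ≤ ∣ p κ σ ∣ × ∣ p κ σ ∣ < 2 ^ n) → ∀ {κ} → κ ∈ ks →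
                   η κ ≢ signs p σ κ → 9 * weight n p η ks σ ≤ peak n p ks σ
weight-separates n p η (κ ∷ ks) σ b (here refl) wrong = begin
  9 * (sieve n (η κ) t * weight n p η ks σ) ≡⟨ sym (*-assoc 9 (sieve n (η κ) t) _) ⟩
  9 * sieve n (η κ) t * weight n p η ks σ ≤⟨ *-mono-≤ separate (weight-≤ ks) ⟩
  _ ∎
  where
  open ≤-Reasoning
  t = p κ σ
  weight-≤ : ∀ ks → weight n p η ks σ ≤ weight n p (signs p σ) ks σ
  weight-≤ ks = weight≤peak n p η ks σ
  separate : 9 * sieve n (η κ) t ≤ sieve n (nonNegative t) t
  separate = subst (λ e → 9 * sieve n e t ≤ sieve n (nonNegative t) t) (sym (Bool.¬-not wrong))
    (sieve-separates n t (proj₁ (b κ)) (proj₂ (b κ)))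
weight-separates n p η (κ ∷ ks) σ b (there i) wrong = begin
  9 * (sieve n (η κ) (p κ σ) * weight n p η ks σ) ≡⟨ swap (sieve n (η κ) (p κ σ)) _ ⟩
  sieve n (η κ) (p κ σ) * (9 * weight n p η ks σ) ≤⟨ *-mono-≤ (sieve≤right n (η κ) (p κ σ)) (weight-separates n p η ks σ b i wrong) ⟩
  _ ∎
  where
  open ≤-Reasoning
  swap : ∀ f s → 9 * (f * s) ≡ f * (9 * s)
  swap = ℕ-solve

peak-pos : ∀ n p ks σ → 1 ≤ peak n p ks σ
peak-pos n p []       σ = ≤-refl
peak-pos n p (κ ∷ ks) σ = *-mono-≤ (sieve-pos n (p κ σ)) (peak-pos n p ks σ)

peak-bounded : ∀ n p ks σ → (∀ κ → ∣ p κ σ ∣ ≤ 2 ^ n) → peak n p ks σ ≤ 2 ^ (length ks * (n * (2 * suc n)))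
peak-bounded n p []       σ b = ≤-refl
peak-bounded n p (κ ∷ ks) σ b = ≤-trans
  (*-mono-≤ (sieve-bounded n n (p κ σ) ≤-refl (b κ)) (peak-bounded n p ks σ b))
  (≤-reflexive (sym (^-distribˡ-+-* 2 (n * (2 * suc n)) _)))

HasDegree-weight : ∀ {D} n p η ks → (∀ κ → HasDegree D (p κ)) → HasDegree (length ks * (n * (2 * D))) (λ σ → + weight n p η ks σ)
HasDegree-weight n p η []       h = HasDegree-const 1ℤ
HasDegree-weight n p η (κ ∷ ks) h =
  HasDegree-cong (λ σ → sym (ℤP.pos-* (sieve n (η κ) (p κ σ)) (weight n p η ks σ)))
    (HasDegree-* (HasDegree-sieve n (η κ) (h κ)) (HasDegree-weight n p η ks h))

peak-supported : ∀ n p ks → (∀ κ → FinitelySupported (p κ)) → FinitelySupported (peak n p ks)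
peak-supported n p []       h = [] , λ _ _ _ → refl
peak-supported n p (κ ∷ ks) h with h κ | peak-supported n p ks h
... | vs , e | ws , f = vs ++ ws , λ σ τ g → cong₂ _*_
  (cong (λ t → sieve n (nonNegative t) t) (e σ τ (λ v i → g v (Any.++⁺ˡ i)))) (f σ τ (λ v i → g v (Any.++⁺ʳ vs i)))

-- Lexicographic zones

-- The prefix `π` stands for the interval of its extensions. `atMost` admits that interval and
-- everything under it, `below` only what is under it, so their difference is the interval itself. A
-- string that ends inside `π` counts as lying under it.
atMost : List Bool → List Bool → Bool
atMost []          z           = true
atMost (_ ∷ _)     []          = true
atMost (true ∷ π)  (false ∷ z) = true
atMost (false ∷ π) (true ∷ z)  = false
atMost (true ∷ π)  (true ∷ z)  = atMost π z
atMost (false ∷ π) (false ∷ z) = atMost π z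

below : List Bool → List Bool → Bool
below []          z           = false
below (_ ∷ _)     []          = true
below (true ∷ π)  (false ∷ z) = true
below (false ∷ π) (true ∷ z)  = false
below (true ∷ π)  (true ∷ z)  = below π z
below (false ∷ π) (false ∷ z) = below π z

below-extend : ∀ π τ z → below π z ≡ true → below (π ++ τ) z ≡ true
below-extend (_ ∷ π)     τ []          e = refl
below-extend (true ∷ π)  τ (false ∷ z) e = refl
below-extend (true ∷ π)  τ (true ∷ z)  e = below-extend π τ z e
below-extend (false ∷ π) τ (false ∷ z) e = below-extend π τ z e

atMost-restrict : ∀ π τ z → atMost (π ++ τ) z ≡ true → atMost π z ≡ true
atMost-restrict []          τ z           e = refl
atMost-restrict (_ ∷ π)     τ []          e = refl
atMost-restrict (true ∷ π)  τ (false ∷ z) e = refl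
atMost-restrict (true ∷ π)  τ (true ∷ z)  e = atMost-restrict π τ z e
atMost-restrict (false ∷ π) τ (false ∷ z) e = atMost-restrict π τ z e

atMost⇒below : ∀ π z → atMost (π ++ false ∷ []) z ≡ true → below (π ++ true ∷ []) z ≡ true
atMost⇒below []          []          e = refl
atMost⇒below []          (false ∷ z) e = refl
atMost⇒below (_ ∷ π)     []          e = refl
atMost⇒below (true ∷ π)  (false ∷ z) e = refl
atMost⇒below (true ∷ π)  (true ∷ z)  e = atMost⇒below π z e
atMost⇒below (false ∷ π) (false ∷ z) e = atMost⇒below π z e

below⇒atMost : ∀ π z → below π z ≡ true → atMost π z ≡ true
below⇒atMost (_ ∷ π)     []          e = refl
below⇒atMost (true ∷ π)  (false ∷ z) e = refl
below⇒atMost (true ∷ π)  (true ∷ z)  e = below⇒atMost π z e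
below⇒atMost (false ∷ π) (false ∷ z) e = below⇒atMost π z e

below-prefix : ∀ π z → below π (π ++ z) ≡ false
below-prefix []          z = refl
below-prefix (true ∷ π)  z = below-prefix π z
below-prefix (false ∷ π) z = below-prefix π z

atMost-prefix : ∀ π z → atMost π (π ++ z) ≡ true
atMost-prefix []          z = refl
atMost-prefix (true ∷ π)  z = atMost-prefix π z
atMost-prefix (false ∷ π) z = atMost-prefix π z

atMost-prefix-++ : ∀ π τ z → atMost (π ++ τ) (π ++ τ ++ z) ≡ true
atMost-prefix-++ []          τ z = atMost-prefix τ z
atMost-prefix-++ (true ∷ π)  τ z = atMost-prefix-++ π τ z
atMost-prefix-++ (false ∷ π) τ z = atMost-prefix-++ π τ z

above⇒not-below : ∀ π τ z → atMost (π ++ τ) z ≡ false → below π z ≡ false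
above⇒not-below π τ z a with below π z in e
... | false = refl
... | true with () ← trans (sym a) (below⇒atMost (π ++ τ) z (below-extend π τ z e))

atMost-lower : ∀ π τ z → atMost (π ++ true ∷ τ) (π ++ false ∷ z) ≡ true
atMost-lower []          τ z = refl
atMost-lower (true ∷ π)  τ z = atMost-lower π τ z
atMost-lower (false ∷ π) τ z = atMost-lower π τ z

-- The variables (u , z) with length z < onset i are decided before stage i.
opaque
  onset : ℕ → ℕ
  onset i = 2 ^ (10 + i)

  onset-def : ∀ i → onset i ≡ 2 ^ (10 + i)
  onset-def i = refl

later? : ∀ i (v : Var) → Dec (onset i ≤ length (proj₂ v))
later? i v = onset i ≤? length (proj₂ v)

later : ℕ → (List Bool → Bool) → Var → Bool
later i f v = does (later? i v) ∧ f (proj₂ v)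

-- Forgets the tentative choices for slots of later regions, so that the next stage can maximise
-- over them afresh.
decided : ℕ → Assignment → Assignment
decided i σ v = if does (later? i v) then false else σ v

later-yes : ∀ i f u z → onset i ≤ length z → later i f (u , z) ≡ f z
later-yes i f u z l rewrite dec-true (later? i (u , z)) l = refl

later-no : ∀ i f u z → length z < onset i → later i f (u , z) ≡ false
later-no i f u z l rewrite dec-false (later? i (u , z)) (<⇒≱ l) = refl

decided-yes : ∀ i σ u z → length z < onset i → decided i σ (u , z) ≡ σ (u , z)
decided-yes i σ u z l rewrite dec-false (later? i (u , z)) (<⇒≱ l) = refl

decided-no : ∀ i σ u z → onset i ≤ length z → decided i σ (u , z) ≡ false
decided-no i σ u z l rewrite dec-true (later? i (u , z)) l = refl

later-mono : ∀ i {f g} → (∀ z → f z ≡ true → g z ≡ true) → ∀ v → later i g v ≡ false → later i f v ≡ false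
later-mono i {f} {g} f⊆g v e with does (later? i v) | f (proj₂ v) in fz
... | false | _     = refl
... | true  | false = refl
... | true  | true  with () ← trans (sym (f⊆g _ fz)) e

Varies-mono : ∀ {ρ} i {f g} → (∀ z → f z ≡ true → g z ≡ true) → ∀ {σ} → Varies ρ (later i f) σ → Varies ρ (later i g) σ
Varies-mono i f⊆g h v e = h v (later-mono i f⊆g v e)

record Refinement (π : List Bool) (a : ℕ) : Set where
  field
    prefix  : List Bool
    longer  : length prefix ≡ length π + a
    inner   : ∀ z → below π z ≡ true → below prefix z ≡ true
    outer   : ∀ z → atMost prefix z ≡ true → atMost π z ≡ true

module Descent (A : Assignment → ℕ) (supp : FinitelySupported A) (i : ℕ) (ρ : Assignment) where

  best : (List Bool → Bool) → Assignment
  best f = proj₁ (maximum A supp ρ (later i f))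

  best-varies : ∀ f → Varies ρ (later i f) (best f)
  best-varies f = proj₁ (proj₂ (maximum A supp ρ (later i f)))

  best-max : ∀ f σ → Varies ρ (later i f) σ → A σ ≤ A (best f)
  best-max f = proj₂ (proj₂ (maximum A supp ρ (later i f)))

  best-mono : ∀ {f g} → (∀ z → f z ≡ true → g z ≡ true) → A (best f) ≤ A (best g)
  best-mono {f} {g} f⊆g = best-max g (best f) (Varies-mono i f⊆g (best-varies f))

  -- The ratio between the maxima over the outer and the inner zone is the product of the two ratios for the
  -- halves of the interval, so one bit of refinement takes its square root.
  descend : ∀ a π → A (best (atMost π)) ≤ 2 ^ (2 ^ a) * A (best (below π)) →
            Σ (Refinement π a) λ R → A (best (atMost (Refinement.prefix R))) ≤ 2 * A (best (below (Refinement.prefix R)))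
  descend zero    π h = record { prefix = π ; longer = sym (+-identityʳ _) ; inner = λ _ e → e ; outer = λ _ e → e } , h
  descend (suc a) π h with A (best (atMost (π ++ false ∷ []))) ≤? 2 ^ (2 ^ a) * A (best (below (π ++ false ∷ [])))
  ... | yes small = extend (descend a (π ++ false ∷ []) small)
    where
    extend : (Σ (Refinement (π ++ false ∷ []) a) λ R → A (best (atMost (Refinement.prefix R))) ≤ 2 * A (best (below (Refinement.prefix R)))) →
             Σ (Refinement π (suc a)) λ R → A (best (atMost (Refinement.prefix R))) ≤ 2 * A (best (below (Refinement.prefix R)))
    extend (R , r) = record
      { prefix = Refinement.prefix R
      ; longer = trans (Refinement.longer R) (trans (cong (_+ a) (List.length-++ π)) (+-assoc (length π) 1 a))
      ; inner = λ z e → Refinement.inner R z (below-extend π _ z e)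
      ; outer = λ z e → atMost-restrict π _ z (Refinement.outer R z e) } , r
  ... | no large = extend (descend a (π ++ true ∷ []) small)
    where
    open ≤-Reasoning
    X = 2 ^ (2 ^ a)
    square-root : ∀ x l → x * x * l ≡ x * (x * l)
    square-root = ℕ-solve
    small : A (best (atMost (π ++ true ∷ []))) ≤ X * A (best (below (π ++ true ∷ [])))
    small = begin
      A (best (atMost (π ++ true ∷ []))) ≤⟨ best-mono (atMost-restrict π (true ∷ [])) ⟩
      A (best (atMost π)) ≤⟨ h ⟩
      2 ^ (2 ^ suc a) * A (best (below π)) ≡⟨ cong (λ e → 2 ^ (2 ^ a + e) * A (best (below π))) (+-identityʳ (2 ^ a)) ⟩
      2 ^ (2 ^ a + 2 ^ a) * A (best (below π)) ≡⟨ cong (_* A (best (below π))) (^-distribˡ-+-* 2 (2 ^ a) (2 ^ a)) ⟩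
      X * X * A (best (below π)) ≡⟨ square-root X _ ⟩
      X * (X * A (best (below π))) ≤⟨ *-monoʳ-≤ X (*-monoʳ-≤ X (best-mono (below-extend π (false ∷ [])))) ⟩
      X * (X * A (best (below (π ++ false ∷ [])))) ≤⟨ *-monoʳ-≤ X (<⇒≤ (≰⇒> large)) ⟩
      -- Everything up to the lower half lies under the upper half, so the two ratios can be
      -- chained.
      X * A (best (atMost (π ++ false ∷ []))) ≤⟨ *-monoʳ-≤ X (best-mono (atMost⇒below π)) ⟩
      X * A (best (below (π ++ true ∷ []))) ∎
    extend : (Σ (Refinement (π ++ true ∷ []) a) λ R → A (best (atMost (Refinement.prefix R))) ≤ 2 * A (best (below (Refinement.prefix R)))) →
             Σ (Refinement π (suc a)) λ R → A (best (atMost (Refinement.prefix R))) ≤ 2 * A (best (below (Refinement.prefix R)))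
    extend (R , r) = record
      { prefix = Refinement.prefix R
      ; longer = trans (Refinement.longer R) (trans (cong (_+ a) (List.length-++ π)) (+-assoc (length π) 1 a))
      ; inner = λ z e → Refinement.inner R z (below-extend π _ z e)
      ; outer = λ z e → atMost-restrict π _ z (Refinement.outer R z e) } , r

-- Strings of fixed length and the parity of a region

strings : ℕ → List (List Bool)
strings zero    = [] ∷ []
strings (suc b) = map (false ∷_) (strings b) ++ map (true ∷_) (strings b)

length-strings : ∀ b → length (strings b) ≡ 2 ^ b
length-strings zero    = refl
length-strings (suc b) = begin
  length (strings (suc b))
    ≡⟨ List.length-++ (map (false ∷_) (strings b)) ⟩
  length (map (false ∷_) (strings b)) + length (map (true ∷_) (strings b))
    ≡⟨ cong₂ _+_ (trans (List.length-map _ (strings b)) (length-strings b)) (trans (List.length-map _ (strings b)) (length-strings b)) ⟩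
  2 ^ b + 2 ^ b
    ≡⟨ cong (λ e → 2 ^ b + e) (sym (+-identityʳ (2 ^ b))) ⟩
  2 ^ suc b ∎
  where open ≡-Reasoning

strings-length : ∀ b {y} → y ∈ strings b → length y ≡ b
strings-length zero    (here refl) = refl
strings-length (suc b) y∈ with ∈-++⁻ (map (false ∷_) (strings b)) y∈
... | inj₁ i with ∈-map⁻ (false ∷_) i
...   | _ , j , refl = cong suc (strings-length b j)
strings-length (suc b) y∈ | inj₂ i with ∈-map⁻ (true ∷_) i
...   | _ , j , refl = cong suc (strings-length b j)

∈-strings : ∀ y → y ∈ strings (length y)
∈-strings []          = here refl
∈-strings (false ∷ y) = ∈-++⁺ˡ (∈-map⁺ (false ∷_) (∈-strings y))
∈-strings (true ∷ y)  = ∈-++⁺ʳ (map (false ∷_) (strings (length y))) (∈-map⁺ (true ∷_) (∈-strings y))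

strings-unique : ∀ b → Unique (strings b)
strings-unique zero    = [] ∷ []
strings-unique (suc b) = Unique.++⁺ (Unique.map⁺ List.∷-injectiveʳ (strings-unique b)) (Unique.map⁺ List.∷-injectiveʳ (strings-unique b)) disjoint
  where
  disjoint : ∀ {v} → ¬ (v ∈ map (false ∷_) (strings b) × v ∈ map (true ∷_) (strings b))
  disjoint (i , j) with ∈-map⁻ (false ∷_) i | ∈-map⁻ (true ∷_) j
  ... | _ , _ , refl | _ , _ , ()

parityOn : ℕ → (List Bool → Bool) → Bool
parityOn zero    f = f []
parityOn (suc r) f = parityOn r (λ z → f (false ∷ z)) xor parityOn r (λ z → f (true ∷ z))

parityOn-cong : ∀ r {f g : List Bool → Bool} → (∀ z → length z ≡ r → f z ≡ g z) → parityOn r f ≡ parityOn r g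
parityOn-cong zero    e = e [] refl
parityOn-cong (suc r) e = cong₂ _xor_ (parityOn-cong r (λ z l → e (false ∷ z) (cong suc l))) (parityOn-cong r (λ z l → e (true ∷ z) (cong suc l)))

parityOn-toggle : ∀ z {f g : List Bool → Bool} → g z ≡ not (f z) → (∀ w → w ≢ z → g w ≡ f w) →
                  parityOn (length z) g ≡ not (parityOn (length z) f)
parityOn-toggle []          e h = e
parityOn-toggle (false ∷ z) {f} {g} e h = trans
  (cong₂ _xor_ (parityOn-toggle z e (λ w w≢z → h (false ∷ w) (λ q → w≢z (List.∷-injectiveʳ q))))
               (parityOn-cong (length z) (λ w _ → h (true ∷ w) (λ ()))))
  (sym (Bool.not-distribˡ-xor (parityOn (length z) (λ w → f (false ∷ w))) _))
parityOn-toggle (true ∷ z)  {f} {g} e h = trans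
  (cong₂ _xor_ (parityOn-cong (length z) (λ w _ → h (false ∷ w) (λ ())))
               (parityOn-toggle z e (λ w w≢z → h (true ∷ w) (λ q → w≢z (List.∷-injectiveʳ q)))))
  (sym (Bool.not-distribʳ-xor (parityOn (length z) (λ w → f (false ∷ w))) _))

_≟ᵏ_ : (κ κ′ : Key) → Dec (κ ≡ κ′)
_≟ᵏ_ = Product.≡-dec (List.≡-dec Bool._≟_) _≟_

-- The largest one of the region extends π 1 b, so the bit after π 1 is the verdict, and the parity
-- repeats it. The fixed 1 after `π` keeps the lower half of the interval free for a correction of
-- the parity.
record Settled (π : List Bool) (b : Bool) (σ : Assignment) (u : List Bool) (r : ℕ) : Set where
  field
    top     : List Bool
    top-len : length (π ++ true ∷ b ∷ top) ≡ r
    top-set : σ (u , π ++ true ∷ b ∷ top) ≡ true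
    nothing-above : ∀ z → length z ≡ r → atMost (π ++ true ∷ b ∷ []) z ≡ false → σ (u , z) ≡ false
    parity  : parityOn r (λ z → σ (u , z)) ≡ b

Settled-cong : ∀ {π b u r} σ τ → (∀ z → length z ≡ r → σ (u , z) ≡ τ (u , z)) → Settled π b σ u r → Settled π b τ u r
Settled-cong {π} {b} {u} {r} σ τ e s = record
  { top = top ; top-len = top-len ; top-set = trans (sym (e _ top-len)) top-set
  ; nothing-above = λ z l a → trans (sym (e z l)) (nothing-above z l a)
  ; parity = trans (sym (parityOn-cong r e)) parity }
  where open Settled s

-- Writing verdicts into regions

module Placement
  (i : ℕ) (ρ : Assignment) (π : List Bool) (φ : Assignment → ℕ) (V c D : ℕ)
  (1≤D : 1 ≤ D) (deg : HasDegree D (λ σ → + φ σ))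
  (ub : ∀ σ → Varies ρ (later i (atMost π)) σ → φ σ ≤ V)
  where

  Allowed : Assignment → Set
  Allowed = Varies ρ (later i (atMost π))

  -- `many` is the hypothesis of `gentle-flip` for the slots that extend `π` by two prescribed bits.
  record Roomy (r : ℕ) : Set where
    field
      undecided : onset i ≤ r
      long      : length π + 2 ≤ r
      many      : c * (D * D * (2 * D)) ≤ 2 ^ (r ∸ (length π + 2))

  set-allowed : ∀ τ u z → onset i ≤ length z → atMost π z ≡ true → Allowed τ → Allowed (τ [ (u , z) ≔ true ])
  set-allowed τ u z l a h v e = trans (set-other τ (u , z) true (λ { refl → clash e })) (h v e)
    where
    clash : later i (atMost π) (u , z) ≡ false → ⊥
    clash e with () ← trans (sym a) (trans (sym (later-yes i (atMost π) u z l)) e)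

  place : ∀ u r d₁ d₂ σ → Allowed σ → Roomy r →
          (∀ y → length (π ++ d₁ ∷ d₂ ∷ y) ≡ r → σ (u , π ++ d₁ ∷ d₂ ∷ y) ≡ false) →
          ∃ λ y → length (π ++ d₁ ∷ d₂ ∷ y) ≡ r × c * φ σ ≤ c * φ (σ [ (u , π ++ d₁ ∷ d₂ ∷ y) ≔ true ]) + V
  place u r d₁ d₂ σ ok room empty
    with gentle-flip D c V slots σ φ 1≤D deg slots-unique (All.tabulate slot-empty) Allowed closed ub ok
           (subst (1 ≤_) (sym slots-length) (m^n>0 2 b)) (subst (c * (D * D * (2 * D)) ≤_) (sym slots-length) many)
    where
    open Roomy room
    b = r ∸ (length π + 2)
    slot : List Bool → Var
    slot y = u , π ++ d₁ ∷ d₂ ∷ y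
    slots = map slot (strings b)
    slots-length : length slots ≡ 2 ^ b
    slots-length = trans (List.length-map slot (strings b)) (length-strings b)
    slots-unique : Unique slots
    slots-unique = Unique.map⁺ (λ {x} {y} e → List.∷-injectiveʳ (List.∷-injectiveʳ (List.++-cancelˡ π (d₁ ∷ d₂ ∷ x) (d₁ ∷ d₂ ∷ y) (cong proj₂ e)))) (strings-unique b)
    slot-length : ∀ y → y ∈ strings b → length (π ++ d₁ ∷ d₂ ∷ y) ≡ r
    slot-length y y∈ = trans (List.length-++ π) (trans (cong (λ l → length π + (2 + l)) (strings-length b y∈))
      (trans (sym (+-assoc (length π) 2 b)) (m+[n∸m]≡n long)))
    slot-empty : ∀ {v} → v ∈ slots → σ v ≡ false
    slot-empty v∈ with ∈-map⁻ slot v∈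
    ... | y , y∈ , refl = empty y (slot-length y y∈)
    closed : ∀ τ v → v ∈ slots → Allowed τ → Allowed (τ [ v ≔ true ])
    closed τ v v∈ h with ∈-map⁻ slot v∈
    ... | y , y∈ , refl = set-allowed τ u _ (subst (onset i ≤_) (sym (slot-length y y∈)) undecided) (atMost-prefix π _) h
  ... | v , v∈ , gentle with ∈-map⁻ (λ y → u , π ++ d₁ ∷ d₂ ∷ y) v∈
  ... | y , y∈ , refl = y , len , gentle
    where
    open Roomy room
    len : length (π ++ d₁ ∷ d₂ ∷ y) ≡ r
    len = trans (List.length-++ π) (trans (cong (λ l → length π + (2 + l)) (strings-length (r ∸ (length π + 2)) y∈))
      (trans (sym (+-assoc (length π) 2 _)) (m+[n∸m]≡n long)))

  record Improved (σ : Assignment) (ks : List Key) (b : Key → Bool) (loss : ℕ) : Set where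
    field
      result    : Assignment
      allowed   : Allowed result
      unchanged : ∀ u z → (u , length z) ∉ ks → result (u , z) ≡ σ (u , z)
      settled   : ∀ u r → (u , r) ∈ ks → Settled π (b (u , r)) result u r
      gentle    : c * φ σ ≤ c * φ result + loss

  other-region : ∀ τ u z {u′ z′} → (u′ , length z′) ≢ (u , length z) → (τ [ (u , z) ≔ true ]) (u′ , z′) ≡ τ (u′ , z′)
  other-region τ u z ne = set-other τ (u , z) true (λ e → ne (cong (λ v → proj₁ v , length (proj₂ v)) e))

  above-set : ∀ τ u ζ z₀ {r} → atMost ζ z₀ ≡ true → (∀ z → length z ≡ r → atMost ζ z ≡ false → τ (u , z) ≡ false) →
              ∀ z → length z ≡ r → atMost ζ z ≡ false → (τ [ (u , z₀) ≔ true ]) (u , z) ≡ false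
  above-set τ u ζ z₀ hit h z l a = trans (set-other τ (u , z₀) true (λ { refl → clash (trans (sym hit) a) })) (h z l a)
    where
    clash : true ≢ false
    clash ()

  -- The first new one goes under π 1 b and becomes the largest of the region. If the parity is then
  -- wrong, a second one under π 00 corrects it and, being lower, leaves the largest one alone. Each
  -- of the two costs at most V on the scale `c`.
  settle-one : ∀ u r (b : Key → Bool) σ → Allowed σ → Roomy r →
               (∀ z → length z ≡ r → below π z ≡ false → σ (u , z) ≡ false) → Improved σ ((u , r) ∷ []) b (2 * V)
  settle-one u r b σ ok room empty with place u r true (b (u , r)) σ ok room (λ y l → empty _ l (below-prefix π _))
  ... | y₁ , len₁ , gentle₁ with parityOn r (λ z → (σ [ (u , π ++ true ∷ b (u , r) ∷ y₁) ≔ true ]) (u , z)) Bool.≟ b (u , r)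
  ...   | yes right = record
    { result = σ₁ ; allowed = allowed₁
    ; unchanged = λ u′ z ∉ → other-region σ u z₁ (λ e → ∉ (here (trans e (cong (u ,_) len₁))))
    ; settled = λ { _ _ (here refl) → record
        { top = y₁ ; top-len = len₁ ; top-set = set-same σ (u , z₁) true ; nothing-above = above₁ ; parity = right } }
    ; gentle = ≤-trans gentle₁ (+-monoʳ-≤ (c * φ σ₁) (m≤m+n V _)) }
    where
    ζ = π ++ true ∷ b (u , r) ∷ []
    z₁ = π ++ true ∷ b (u , r) ∷ y₁
    σ₁ = σ [ (u , z₁) ≔ true ]
    allowed₁ = set-allowed σ u z₁ (subst (onset i ≤_) (sym len₁) (Roomy.undecided room)) (atMost-prefix π _) ok
    above₁ = above-set σ u ζ z₁ {r} (atMost-prefix-++ π (true ∷ b (u , r) ∷ []) y₁) (λ z l a → empty z l (above⇒not-below π _ z a))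
  ...   | no wrong with place u r false false (σ [ (u , π ++ true ∷ b (u , r) ∷ y₁) ≔ true ])
                          (set-allowed σ u _ (subst (onset i ≤_) (sym len₁) (Roomy.undecided room)) (atMost-prefix π _) ok) room
                          (λ y l → trans (set-other σ _ true (λ e → distinct y (cong proj₂ e))) (empty _ l (below-prefix π _)))
    where
    distinct : ∀ y → π ++ false ∷ false ∷ y ≢ π ++ true ∷ b (u , r) ∷ y₁
    distinct y e with () ← List.++-cancelˡ π (false ∷ false ∷ y) (true ∷ b (u , r) ∷ y₁) e
  ...     | y₂ , len₂ , gentle₂ = record
    { result = σ₂
    ; allowed = set-allowed σ₁ u z₂ (subst (onset i ≤_) (sym len₂) (Roomy.undecided room)) (atMost-prefix π _) allowed₁
    ; unchanged = λ u′ z ∉ → trans (other-region σ₁ u z₂ (λ e → ∉ (here (trans e (cong (u ,_) len₂)))))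
        (other-region σ u z₁ (λ e → ∉ (here (trans e (cong (u ,_) len₁)))))
    ; settled = λ { _ _ (here refl) → record
        { top = y₁ ; top-len = len₁
        ; top-set = trans (set-other σ₁ (u , z₂) true (λ e → distinct (cong proj₂ e))) (set-same σ (u , z₁) true)
        ; nothing-above = above₂
        ; parity = trans toggled (sym (Bool.¬-not (λ e → wrong (sym e)))) } }
    ; gentle = begin
        c * φ σ ≤⟨ gentle₁ ⟩
        c * φ σ₁ + V ≤⟨ +-monoˡ-≤ V gentle₂ ⟩
        c * φ σ₂ + V + V ≡⟨ twice (c * φ σ₂) V ⟩
        c * φ σ₂ + 2 * V ∎ }
    where
    open ≤-Reasoning
    ζ = π ++ true ∷ b (u , r) ∷ []
    z₁ = π ++ true ∷ b (u , r) ∷ y₁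
    z₂ = π ++ false ∷ false ∷ y₂
    σ₁ = σ [ (u , z₁) ≔ true ]
    σ₂ = σ₁ [ (u , z₂) ≔ true ]
    twice : ∀ x V → x + V + V ≡ x + 2 * V
    twice = ℕ-solve
    allowed₁ = set-allowed σ u z₁ (subst (onset i ≤_) (sym len₁) (Roomy.undecided room)) (atMost-prefix π _) ok
    distinct : z₁ ≢ z₂
    distinct e with () ← List.++-cancelˡ π (true ∷ b (u , r) ∷ y₁) (false ∷ false ∷ y₂) e
    z₂-empty : σ₁ (u , z₂) ≡ false
    z₂-empty = trans (set-other σ (u , z₁) true (λ e → distinct (sym (cong proj₂ e)))) (empty z₂ len₂ (below-prefix π _))
    toggled : parityOn r (λ z → σ₂ (u , z)) ≡ not (parityOn r (λ z → σ₁ (u , z)))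
    toggled = subst (λ n → parityOn n (λ z → σ₂ (u , z)) ≡ not (parityOn n (λ z → σ₁ (u , z)))) len₂
      (parityOn-toggle z₂ {λ z → σ₁ (u , z)} {λ z → σ₂ (u , z)}
        (trans (set-same σ₁ (u , z₂) true) (cong not (sym z₂-empty)))
        (λ w w≢z₂ → set-other σ₁ (u , z₂) true (λ e → w≢z₂ (cong proj₂ e))))
    above₂ = above-set σ₁ u ζ z₂ {r} (atMost-lower π (b (u , r) ∷ []) (false ∷ y₂))
      (above-set σ u ζ z₁ (atMost-prefix-++ π (true ∷ b (u , r) ∷ []) y₁) (λ z l a → empty z l (above⇒not-below π _ z a)))

  settle : ∀ ks (b : Key → Bool) σ → Allowed σ → (∀ u r → (u , r) ∈ ks → Roomy r) →
           (∀ u z → (u , length z) ∈ ks → below π z ≡ false → σ (u , z) ≡ false) →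
           Improved σ ks b (length ks * (2 * V))
  settle [] b σ ok room empty = record
    { result = σ ; allowed = ok ; unchanged = λ _ _ _ → refl ; settled = λ _ _ () ; gentle = m≤m+n _ 0 }
  settle ((u , r) ∷ ks) b σ ok room empty with any? ((u , r) ≟ᵏ_) ks
  -- The region of a repeated key is no longer empty; the earlier placement serves for both
  -- occurrences.
  ... | yes again = record
    { result = result ; allowed = allowed ; unchanged = λ u′ z ∉ → unchanged u′ z (λ i → ∉ (there i))
    ; settled = λ { _ _ (here refl) → settled _ _ again ; _ _ (there i) → settled _ _ i }
    ; gentle = ≤-trans gentle (+-monoʳ-≤ (c * φ result) (m≤n+m _ (2 * V))) }
    where open Improved (settle ks b σ ok (λ u r i → room u r (there i)) (λ u z i → empty u z (there i)))
  ... | no new = record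
    { result = N.result ; allowed = N.allowed
    ; unchanged = λ u′ z ∉ → trans (N.unchanged u′ z (λ { (here e) → ∉ (here e) })) (I.unchanged u′ z (λ i → ∉ (there i)))
    ; settled = λ { _ _ (here refl) → N.settled u r (here refl)
                  ; u′ r′ (there i) → Settled-cong I.result N.result
                      (λ z l → sym (N.unchanged u′ z (λ { (here e) → new (subst (_∈ ks) (trans (cong (u′ ,_) (sym l)) e) i) }))) (I.settled u′ r′ i) }
    ; gentle = begin
        c * φ σ ≤⟨ I.gentle ⟩
        c * φ I.result + length ks * (2 * V) ≤⟨ +-monoˡ-≤ _ N.gentle ⟩
        c * φ N.result + 2 * V + length ks * (2 * V) ≡⟨ +-assoc (c * φ N.result) (2 * V) _ ⟩
        c * φ N.result + (2 * V + length ks * (2 * V)) ∎ }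
    where
    open ≤-Reasoning
    module I = Improved (settle ks b σ ok (λ u r i → room u r (there i)) (λ u z i → empty u z (there i)))
    module N = Improved (settle-one u r b I.result I.allowed (room u r (here refl))
      (λ z l e → trans (I.unchanged u z (λ i → new (subst (λ n → (u , n) ∈ ks) l i))) (empty u z (here (cong (u ,_) l)) e)))

-- The stage construction

opaque
  budget : ℕ → ℕ
  budget i = 24 * 2 ^ i

  budget-def : ∀ i → budget i ≡ 24 * 2 ^ i
  budget-def i = refl

-- The maximum over the zone up to `π` is at most four times the value at `σ`, and `σ` uses only
-- slots strictly under `π`. Hence the interval of `π` is still empty in all undecided regions, yet
-- opening it can gain little. The same `budget` measures the length of `π` and the logarithm of the
-- degree.
record Stage (i : ℕ) : Set where
  field
    σ        : Assignment
    π        : List Bool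
    φ        : Assignment → ℕ
    v        : ℕ
    π-length : length π ≡ budget i
    degree   : HasDegree (2 ^ budget i) (λ τ → + φ τ)
    bounded  : ∀ τ → Varies (decided i σ) (later i (atMost π)) τ → φ τ ≤ v
    near     : v ≤ 4 * φ σ
    inner    : Varies (decided i σ) (later i (below π)) σ
    positive : 1 ≤ v

Extends : ∀ {i} → Stage i → Assignment → Set
Extends {i} s = Varies (decided i (Stage.σ s)) (later i (atMost (Stage.π s)))

-- The final oracle is not known yet, so `correct` speaks about every extension that stays within a
-- factor 8 of the maximum; `keep` hands this nearness back to the preceding stage.
record Advance {i : ℕ} (s : Stage i) (ks : List Key) (p : Key → Assignment → ℤ) : Set where
  private module S = Stage s
  field
    next : Stage (suc i)
  module N = Stage next
  field
    bits    : Key → Bool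
    same    : ∀ u z → length z < onset i → N.σ (u , z) ≡ S.σ (u , z)
    settled : ∀ u r → (u , r) ∈ ks → Settled N.π (bits (u , r)) N.σ u r
    shrink  : ∀ τ → Extends next τ → Extends s τ
    keep    : ∀ τ → Extends next τ → N.v ≤ 8 * N.φ τ → S.v ≤ 8 * S.φ τ
    correct : ∀ τ → Extends next τ → N.v ≤ 8 * N.φ τ → ∀ κ → κ ∈ ks → signs p τ κ ≡ bits κ

^-distribʳ : ∀ a b k → (a * b) ^ k ≡ a ^ k * b ^ k
^-distribʳ a b zero    = refl
^-distribʳ a b (suc k) rewrite ^-distribʳ a b k = swap a b (a ^ k) (b ^ k)
  where
  swap : ∀ a b x y → a * b * (x * y) ≡ a * x * (b * y)
  swap = ℕ-solve

module Advancing
  (i : ℕ) (s : Stage i) (ks : List Key) (p : Key → Assignment → ℤ) (d n : ℕ)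
  (p-degree : ∀ κ → HasDegree d (p κ)) (p-bounds : ∀ κ τ → 1 ≤ ∣ p κ τ ∣ × ∣ p κ τ ∣ < 2 ^ n)
  (ks-range : ∀ u r → (u , r) ∈ ks → onset i ≤ r × r < onset (suc i))
  (onset≤ : onset i ≤ onset (suc i))
  (budget-suc : budget (suc i) ≡ budget i + budget i)
  (small-ratio : 6 + 3 * (length ks * (n * (2 * suc n))) ≤ 2 ^ budget i)
  (small-degree : (3 + length ks * (n * (2 * suc n))) * 2 ^ budget i + length ks * (n * (2 * d)) ≤ 2 ^ budget (suc i))
  (room : ∀ r → onset i ≤ r → budget (suc i) + 2 ≤ r × (8 * suc (length ks)) * (2 ^ budget (suc i) * 2 ^ budget (suc i) * (2 * 2 ^ budget (suc i))) ≤ 2 ^ (r ∸ (budget (suc i) + 2)))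
  where

  open Stage s

  opaque
    R K : ℕ
    R = length ks * (n * (2 * suc n))
    -- 2 ^ R bounds the peak and 2 ^ 3 is the 8 of nearness, so the K-th power turns a loss of a
    -- factor 2 in the old `φ` into more than both can repair.
    K = 3 + R

    R-def : R ≡ length ks * (n * (2 * suc n))
    R-def = refl

    K-def : K ≡ 3 + R
    K-def = refl

    K-nonZero : NonZero K
    K-nonZero = _

  ρ : Assignment
  ρ = decided i σ

  A : Assignment → ℕ
  A τ = φ τ ^ K * peak n p ks τ

  A-supported : FinitelySupported A
  A-supported with HasDegree-supported degree | peak-supported n p ks (λ κ → HasDegree-supported (p-degree κ))
  ... | vs , e | ws , f = vs ++ ws , λ τ τ′ h → cong₂ (λ a b → a ^ K * b)
    (ℤP.+-injective (e τ τ′ (λ v i → h v (Any.++⁺ˡ i)))) (f τ τ′ (λ v i → h v (Any.++⁺ʳ vs i)))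

  open Descent A A-supported i ρ

  φ^K≤A : ∀ τ → φ τ ^ K ≤ A τ
  φ^K≤A τ = ≤-trans (≤-reflexive (sym (*-identityʳ (φ τ ^ K)))) (*-monoʳ-≤ (φ τ ^ K) (peak-pos n p ks τ))

  peak≤ : ∀ τ → peak n p ks τ ≤ 2 ^ R
  peak≤ τ = subst (λ r → peak n p ks τ ≤ 2 ^ r) (sym R-def) (peak-bounded n p ks τ (λ κ → <⇒≤ (proj₂ (p-bounds κ τ))))

  -- Between the maximum and `σ` the old `φ` changes by a factor of at most 4, its power by at most
  -- 2 ^ (2K), and the peak by at most 2 ^ R. The resulting 2 ^ (2 ^ budget i) is what `budget i`
  -- bisections bring down to 2, and they double the length of the prefix.
  initial-ratio : A (best (atMost π)) ≤ 2 ^ (2 ^ budget i) * A (best (below π))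
  initial-ratio = begin
    φ τ ^ K * peak n p ks τ ≤⟨ *-mono-≤ (^-monoˡ-≤ K (bounded τ (best-varies (atMost π)))) (peak≤ τ) ⟩
    v ^ K * 2 ^ R ≤⟨ *-monoˡ-≤ (2 ^ R) (^-monoˡ-≤ K near) ⟩
    (4 * φ σ) ^ K * 2 ^ R ≡⟨ cong (_* 2 ^ R) (trans (^-distribʳ 4 (φ σ) K) (cong (_* φ σ ^ K) (^-*-assoc 2 2 K))) ⟩
    2 ^ (2 * K) * φ σ ^ K * 2 ^ R ≡⟨ swap (2 ^ (2 * K)) _ _ ⟩
    2 ^ (2 * K) * 2 ^ R * φ σ ^ K ≡⟨ cong (_* φ σ ^ K) (sym (^-distribˡ-+-* 2 (2 * K) R)) ⟩
    2 ^ (2 * K + R) * φ σ ^ K ≤⟨ *-mono-≤ (^-monoʳ-≤ 2 (≤-trans (≤-reflexive collect) small-ratio)) (≤-trans (φ^K≤A σ) (best-max (below π) σ inner)) ⟩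
    2 ^ (2 ^ budget i) * A (best (below π)) ∎
    where
    open ≤-Reasoning
    τ = best (atMost π)
    swap : ∀ a b c → a * b * c ≡ a * c * b
    swap = ℕ-solve
    arith : ∀ R → 2 * (3 + R) + R ≡ 6 + 3 * R
    arith = ℕ-solve
    collect : 2 * K + R ≡ 6 + 3 * (length ks * (n * (2 * suc n)))
    collect rewrite K-def | sym R-def = arith R

  refined : Σ (Refinement π (budget i)) λ R → A (best (atMost (Refinement.prefix R))) ≤ 2 * A (best (below (Refinement.prefix R)))
  refined = descend (budget i) π initial-ratio

  open Refinement (proj₁ refined) renaming (inner to inner⊆; outer to outer⊆)

  prefix-length : length prefix ≡ budget (suc i)
  prefix-length = trans longer (trans (cong (_+ budget i) π-length) (sym budget-suc))

  σ* : Assignment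
  σ* = best (below prefix)

  V : ℕ
  V = A (best (atMost prefix))

  signs* : Key → Bool
  signs* = signs p σ*

  -- With the signs frozen at the maximiser, `φ′` is a polynomial, equals `A` at `σ*` and is nowhere
  -- above `A`. So the maximum of `A` can serve as its bound in `gentle-flip`.
  φ′ : Assignment → ℕ
  φ′ τ = φ τ ^ K * weight n p signs* ks τ

  φ′≤A : ∀ τ → φ′ τ ≤ A τ
  φ′≤A τ = *-monoʳ-≤ (φ τ ^ K) (weight≤peak n p signs* ks τ)

  φ′-degree : HasDegree (2 ^ budget (suc i)) (λ τ → + φ′ τ)
  φ′-degree = HasDegree-≤ (subst (λ k → k * 2 ^ budget i + length ks * (n * (2 * d)) ≤ 2 ^ budget (suc i)) (sym (trans K-def (cong (λ r → 3 + r) R-def))) small-degree)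
    (HasDegree-cong (λ τ → sym (ℤP.pos-* (φ τ ^ K) (weight n p signs* ks τ)))
      (HasDegree-* (HasDegree-^ φ K degree) (HasDegree-weight n p signs* ks p-degree)))

  φ′≤V : ∀ τ → Varies ρ (later i (atMost prefix)) τ → φ′ τ ≤ V
  φ′≤V τ h = ≤-trans (φ′≤A τ) (best-max (atMost prefix) τ h)

  opaque
    c : ℕ
    -- Each of the L keys loses at most 2V / c, so together they lose less than V / 4.
    c = 8 * suc (length ks)

    c-def : c ≡ 8 * suc (length ks)
    c-def = refl

  open Placement i ρ prefix φ′ V c (2 ^ budget (suc i)) (m^n>0 2 (budget (suc i))) φ′-degree φ′≤V

  σ*-empty : ∀ u z → onset i ≤ length z → below prefix z ≡ false → σ* (u , z) ≡ false
  σ*-empty u z l e = trans (best-varies (below prefix) (u , z) (trans (later-yes i (below prefix) u z l) e)) (decided-no i σ u z l)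

  opaque
   improved : Improved σ* ks signs* (length ks * (2 * V))
   improved = settle ks signs* σ* (Varies-mono i (below⇒atMost prefix) (best-varies (below prefix)))
    (λ u r κ∈ → record
      { undecided = proj₁ (ks-range u r κ∈)
      ; long = subst (λ l → l + 2 ≤ r) (sym prefix-length) (proj₁ (room r (proj₁ (ks-range u r κ∈))))
      ; many = subst₂ (λ c l → c * (2 ^ budget (suc i) * 2 ^ budget (suc i) * (2 * 2 ^ budget (suc i))) ≤ 2 ^ (r ∸ (l + 2))) (sym c-def) (sym prefix-length) (proj₂ (room r (proj₁ (ks-range u r κ∈)))) })
    (λ u z κ∈ e → σ*-empty u z (proj₁ (ks-range u (length z) κ∈)) e)

  open Improved improved using (allowed; unchanged; settled; gentle) renaming (result to σ′)

  σ≤V : A σ ≤ V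
  σ≤V = ≤-trans (best-max (below prefix) σ (Varies-mono i inner⊆ inner)) (best-mono (below⇒atMost prefix))

  φσ-positive : 1 ≤ φ σ
  φσ-positive with φ σ | near
  ... | zero  | h = contradiction (≤-trans positive h) (λ ())
  ... | suc _ | _ = s≤s z≤n

  V-positive : 1 ≤ V
  V-positive = ≤-trans (≤-trans (≤-reflexive (sym (^-zeroˡ K))) (^-monoˡ-≤ K φσ-positive)) (≤-trans (φ^K≤A σ) σ≤V)

  -- Bisection gives at least V / 2 at `σ*`, and the placements take away less than V / 4.
  -- Everything is multiplied out to stay in the natural numbers.
  near′ : V ≤ 4 * φ′ σ′
  near′ = *-cancelˡ-≤ (4 * suc L) (+-cancelʳ-≤ (4 * L * V) _ _ (begin
    4 * suc L * V + 4 * L * V ≤⟨ m≤m+n _ (4 * V) ⟩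
    4 * suc L * V + 4 * L * V + 4 * V ≡⟨ trans (eight L V) (cong (_* V) (sym c-def)) ⟩
    c * V ≤⟨ *-monoʳ-≤ c (proj₂ refined) ⟩
    c * (2 * φ′ σ*) ≡⟨ double c (φ′ σ*) ⟩
    2 * (c * φ′ σ*) ≤⟨ *-monoʳ-≤ 2 gentle ⟩
    2 * (c * φ′ σ′ + L * (2 * V)) ≡⟨ trans (cong (λ c → 2 * (c * φ′ σ′ + L * (2 * V))) c-def) (collect L (φ′ σ′) V) ⟩
    4 * suc L * (4 * φ′ σ′) + 4 * L * V ∎))
    where
    open ≤-Reasoning
    L = length ks
    eight : ∀ L V → 4 * suc L * V + 4 * L * V + 4 * V ≡ 8 * suc L * V
    eight = ℕ-solve
    double : ∀ c x → c * (2 * x) ≡ 2 * (c * x)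
    double = ℕ-solve
    collect : ∀ L x V → 2 * (8 * suc L * x + L * (2 * V)) ≡ 4 * suc L * (4 * x) + 4 * L * V
    collect = ℕ-solve

  not-key : ∀ u (z : List Bool) → onset (suc i) ≤ length z → (u , length z) ∉ ks
  not-key u z l κ∈ = <⇒≱ (proj₂ (ks-range u (length z) κ∈)) l

  inner′ : Varies (decided (suc i) σ′) (later (suc i) (below prefix)) σ′
  inner′ (u , z) e = go (onset (suc i) ≤? length z)
   where
   go : Dec (onset (suc i) ≤ length z) → σ′ (u , z) ≡ decided (suc i) σ′ (u , z)
   go (no ¬l) = sym (decided-yes (suc i) σ′ u z (≰⇒> ¬l))
   go (yes l) = trans (trans (unchanged u z (not-key u z l))
      (σ*-empty u z (≤-trans onset≤ l) (trans (sym (later-yes (suc i) (below prefix) u z l)) e)))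
    (sym (decided-no (suc i) σ′ u z l))

  shrink′ : ∀ τ → Varies (decided (suc i) σ′) (later (suc i) (atMost prefix)) τ → Varies ρ (later i (atMost prefix)) τ
  shrink′ τ h (u , z) e = go (onset (suc i) ≤? length z)
   where
   go : Dec (onset (suc i) ≤ length z) → τ (u , z) ≡ ρ (u , z)
   go (no ¬l) = trans (h (u , z) (later-no (suc i) (atMost prefix) u z (≰⇒> ¬l)))
      (trans (decided-yes (suc i) σ′ u z (≰⇒> ¬l)) (allowed (u , z) e))
   go (yes l) = trans (h (u , z) (trans (later-yes (suc i) (atMost prefix) u z l) (trans (sym (later-yes i (atMost prefix) u z (≤-trans onset≤ l))) e)))
      (trans (decided-no (suc i) σ′ u z l) (sym (decided-no i σ u z (≤-trans onset≤ l))))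

  -- Otherwise 2 φ τ < φ σ, and the K-th power would give 8 φ′ τ < φ σ ^ K ≤ A σ ≤ V.
  keep′ : ∀ τ → V ≤ 8 * φ′ τ → v ≤ 8 * φ τ
  keep′ τ h = go (v ≤? 8 * φ τ)
   where
   open ≤-Reasoning
   swap : ∀ a b → 8 * (a * b) ≡ 2 * (2 * (2 * b)) * a
   swap = ℕ-solve
   eight : ∀ a → 4 * (2 * a) ≡ 8 * a
   eight = ℕ-solve
   doubled : ¬ (v ≤ 8 * φ τ) → 2 * φ τ < φ σ
   doubled ¬ok = *-cancelˡ-< 4 (2 * φ τ) (φ σ) (≤-trans (≤-trans (s≤s (≤-reflexive (eight (φ τ)))) (≰⇒> ¬ok)) near)
   go : Dec (v ≤ 8 * φ τ) → v ≤ 8 * φ τ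
   go (yes ok) = ok
   go (no ¬ok) = contradiction (begin
    suc (8 * φ′ τ) ≤⟨ s≤s (*-monoʳ-≤ 8 (*-monoʳ-≤ (φ τ ^ K) (≤-trans (weight≤peak n p signs* ks τ) (peak≤ τ)))) ⟩
    suc (8 * (φ τ ^ K * 2 ^ R)) ≡⟨ cong suc (trans (swap (φ τ ^ K) (2 ^ R)) (cong (λ k → 2 ^ k * φ τ ^ K) (sym K-def))) ⟩
    suc (2 ^ K * φ τ ^ K) ≡⟨ cong suc (sym (^-distribʳ 2 (φ τ) K)) ⟩
    suc ((2 * φ τ) ^ K) ≤⟨ ^-monoˡ-< K {{K-nonZero}} (doubled ¬ok) ⟩
    φ σ ^ K ≤⟨ φ^K≤A σ ⟩
    A σ ≤⟨ σ≤V ⟩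
    V ∎) (<⇒≱ (s≤s h))

  -- A wrong sign would give 9 φ′ τ ≤ A τ ≤ V ≤ 8 φ′ τ, although φ′ τ is positive.
  correct′ : ∀ τ → Varies ρ (later i (atMost prefix)) τ → V ≤ 8 * φ′ τ → ∀ κ → κ ∈ ks → signs p τ κ ≡ signs* κ
  correct′ τ ok h κ κ∈ = go (signs p τ κ Bool.≟ signs* κ)
   where
   open ≤-Reasoning
   nine : ∀ a w → 8 * (a * w) + a * w ≡ a * (9 * w)
   nine = ℕ-solve
   positive-of : ∀ x → V ≤ 8 * x → 1 ≤ x
   positive-of zero    h = contradiction (≤-trans V-positive h) (λ ())
   positive-of (suc _) _ = s≤s z≤n
   go : Dec (signs p τ κ ≡ signs* κ) → signs p τ κ ≡ signs* κ
   go (yes e) = e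
   go (no ne) = contradiction (begin
    V + φ′ τ ≤⟨ +-monoˡ-≤ (φ′ τ) h ⟩
    8 * φ′ τ + φ′ τ ≡⟨ nine (φ τ ^ K) _ ⟩
    φ τ ^ K * (9 * weight n p signs* ks τ) ≤⟨ *-monoʳ-≤ (φ τ ^ K) (weight-separates n p signs* ks τ (λ κ → p-bounds κ τ) κ∈ (λ e → ne (sym e))) ⟩
    A τ ≤⟨ best-max (atMost prefix) τ ok ⟩
    V ∎) (<⇒≱ (≤-trans (≤-reflexive (+-comm 1 V)) (+-monoʳ-≤ V (positive-of (φ′ τ) h))))

  advance : Advance s ks p
  advance = record
    { next = record
        { σ = σ′ ; π = prefix ; φ = φ′ ; v = V ; π-length = prefix-length ; degree = φ′-degree
        ; bounded = λ τ h → φ′≤V τ (shrink′ τ h) ; near = near′ ; inner = inner′ ; positive = V-positive }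
    ; bits = signs*
    ; same = λ u z l → trans (allowed (u , z) (later-no i (atMost prefix) u z l)) (decided-yes i σ u z l)
    ; settled = settled
    ; shrink = λ τ h → Varies-mono i outer⊆ (shrink′ τ h)
    ; keep = λ τ _ h → keep′ τ h
    ; correct = λ τ ok h → correct′ τ (shrink′ τ ok) h }

-- Numerical bounds for the stages

module Exponents (e : ℕ) (1≤e : 1 ≤ e) where

  opaque
    -- Measuring everything in powers of 2 ^ e turns products into sums of small coefficients;
    -- adding two terms costs one more unit because e is at least 1.
    X : ℕ → ℕ
    X k = 2 ^ (k * e)

    X-def : ∀ k → X k ≡ 2 ^ (k * e)
    X-def k = refl

    X-mono : ∀ {j k} → j ≤ k → X j ≤ X k
    X-mono j≤k = ^-monoʳ-≤ 2 (*-monoˡ-≤ e j≤k)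

    X-* : ∀ j k → X j * X k ≡ X (j + k)
    X-* j k = trans (sym (^-distribˡ-+-* 2 (j * e) (k * e))) (cong (2 ^_) (sym (*-distribʳ-+ e j k)))

    literal : ∀ k → 2 ^ k ≤ X k
    literal k = ^-monoʳ-≤ 2 (m≤m*n k e {{>-nonZero 1≤e}})

  X-mul : ∀ {a b} j k → a ≤ X j → b ≤ X k → a * b ≤ X (j + k)
  X-mul j k p q = ≤-trans (*-mono-≤ p q) (≤-reflexive (X-* j k))

  X-pos : ∀ k → 1 ≤ X k
  X-pos k = ≤-trans (m^n>0 2 k) (literal k)

  X-add : ∀ {a b} k → a ≤ X k → b ≤ X k → a + b ≤ X (suc k)
  X-add {a} {b} k p q = begin
    a + b ≤⟨ +-mono-≤ p q ⟩
    X k + X k ≡⟨ cong (λ t → X k + t) (sym (+-identityʳ (X k))) ⟩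
    2 * X k ≤⟨ X-mul 1 k (literal 1) ≤-refl ⟩
    X (suc k) ∎
    where open ≤-Reasoning

-- A stage i region has at least 2 ^ (1024 e) slots, e = 2 ^ i, while all other quantities are at most 2 ^ (k e) with small k.
module Numerics (i : ℕ) (L : ℕ) (L≤ : L ≤ 2 ^ (13 * 2 ^ i)) where

  e n d : ℕ
  e = 2 ^ i
  d = 2 ^ e
  n = d + 2

  open Exponents e (m^n>0 2 i)

  L≤X : L ≤ X 13
  L≤X = ≤-trans L≤ (≤-reflexive (sym (X-def 13)))

  d≤X : d ≤ X 1
  d≤X = ≤-reflexive (trans (cong (2 ^_) (sym (+-identityʳ e))) (sym (X-def 1)))

  n≤X : suc n ≤ X 3
  n≤X = ≤-trans (≤-reflexive (trans (cong suc (+-comm d 2)) (+-comm 3 d)))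
    (X-add 2 (≤-trans d≤X (X-mono (s≤s z≤n))) (≤-trans (n≤1+n 3) (literal 2)))

  R : ℕ
  R = L * (n * (2 * suc n))

  R≤X : R ≤ X 20
  R≤X = X-mul 13 7 L≤X (X-mul 3 4 (≤-trans (n≤1+n n) n≤X) (X-mul 1 3 (literal 1) n≤X))

  budget≡ : budget i ≡ 24 * e
  budget≡ = budget-def i

  budget-suc≡ : budget (suc i) ≡ 48 * e
  budget-suc≡ = trans (budget-def (suc i)) (trans (sym (*-assoc 24 2 e)) refl)

  budget-suc : budget (suc i) ≡ budget i + budget i
  budget-suc = trans budget-suc≡ (trans (*-distribʳ-+ e 24 24) (sym (cong₂ _+_ budget≡ budget≡)))

  2^budget : 2 ^ budget i ≡ X 24
  2^budget = trans (cong (2 ^_) budget≡) (sym (X-def 24))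

  2^budget-suc : 2 ^ budget (suc i) ≡ X 48
  2^budget-suc = trans (cong (2 ^_) budget-suc≡) (sym (X-def 48))

  small-ratio : 6 + 3 * R ≤ 2 ^ budget i
  small-ratio = begin
    6 + 3 * R ≤⟨ X-add 22 (≤-trans (m≤m+n 6 2) (≤-trans (literal 3) (X-mono (m≤m+n 3 19)))) (X-mul 2 20 (≤-trans (n≤1+n 3) (literal 2)) R≤X) ⟩
    X 23 ≤⟨ X-mono (n≤1+n 23) ⟩
    X 24 ≡⟨ sym 2^budget ⟩
    2 ^ budget i ∎
    where open ≤-Reasoning

  small-degree : (3 + R) * 2 ^ budget i + L * (n * (2 * d)) ≤ 2 ^ budget (suc i)
  small-degree = begin
    (3 + R) * 2 ^ budget i + L * (n * (2 * d))
      ≤⟨ X-add 47 (≤-trans (X-mul 21 24 (X-add 20 (≤-trans (n≤1+n 3) (≤-trans (literal 2) (X-mono (m≤m+n 2 18)))) R≤X) (≤-reflexive 2^budget)) (X-mono (m≤m+n 45 2)))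
                  (≤-trans (X-mul 13 5 L≤X (X-mul 3 2 (≤-trans (n≤1+n n) n≤X) (X-mul 1 1 (literal 1) d≤X))) (X-mono (m≤m+n 18 29))) ⟩
    X 48 ≡⟨ sym 2^budget-suc ⟩
    2 ^ budget (suc i) ∎
    where open ≤-Reasoning

  onset≡ : onset i ≡ 1024 * e
  onset≡ = trans (onset-def i) (^-distribˡ-+-* 2 10 i)

  -- The demand for slots is at most 2 ^ (162 e), the prefix with its two extra bits takes at most
  -- 50 e positions, and a region has strings of length at least 1024 e.
  room : ∀ r → onset i ≤ r → budget (suc i) + 2 ≤ r ×
         (8 * suc L) * (2 ^ budget (suc i) * 2 ^ budget (suc i) * (2 * 2 ^ budget (suc i))) ≤ 2 ^ (r ∸ (budget (suc i) + 2))
  room r h = ≤-trans (subst (λ b → b + 2 ≤ 1024 * e) (sym budget-suc≡) fits) r≥ , (begin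
    (8 * suc L) * (2 ^ B * 2 ^ B * (2 * 2 ^ B))
      ≤⟨ X-mul 17 145 (X-mul 3 14 (literal 3) (X-add 13 (X-pos 13) L≤X))
           (X-mul 96 49 (X-mul 48 48 (≤-reflexive 2^budget-suc) (≤-reflexive 2^budget-suc)) (X-mul 1 48 (literal 1) (≤-reflexive 2^budget-suc))) ⟩
    X 162 ≡⟨ X-def 162 ⟩
    2 ^ (162 * e) ≤⟨ ^-monoʳ-≤ 2 (m+n≤o⇒n≤o∸m (B + 2) (subst (λ b → b + 2 + 162 * e ≤ r) (sym budget-suc≡) (≤-trans wide r≥))) ⟩
    2 ^ (r ∸ (B + 2)) ∎)
    where
    open ≤-Reasoning
    B = budget (suc i)
    r≥ : 1024 * e ≤ r
    r≥ = subst (_≤ r) onset≡ h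
    m+n≤o⇒n≤o∸m : ∀ m {n o} → m + n ≤ o → n ≤ o ∸ m
    m+n≤o⇒n≤o∸m m {n} {o} p = ≤-trans (≤-reflexive (sym (m+n∸m≡n m n))) (∸-monoˡ-≤ m p)
    2≤ : 2 ≤ 2 * e
    2≤ = ≤-trans (≤-reflexive (sym (*-identityʳ 2))) (*-monoʳ-≤ 2 (m^n>0 2 i))
    fits : 48 * e + 2 ≤ 1024 * e
    fits = ≤-trans (+-monoʳ-≤ (48 * e) 2≤) (≤-trans (≤-reflexive (sym (*-distribʳ-+ e 48 2))) (*-monoˡ-≤ e (m≤m+n 50 974)))
    wide : 48 * e + 2 + 162 * e ≤ 1024 * e
    wide = ≤-trans (+-monoˡ-≤ (162 * e) (≤-trans (+-monoʳ-≤ (48 * e) 2≤) (≤-reflexive (sym (*-distribʳ-+ e 48 2)))))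
      (≤-trans (≤-reflexive (sym (*-distribʳ-+ e 50 162))) (*-monoˡ-≤ e (m≤m+n 212 812)))

onset-suc : ∀ i → onset (suc i) ≡ onset i + onset i
onset-suc i rewrite onset-def (suc i) | onset-def i | +-suc 9 i =
  trans (cong (2 ^_) (+-suc 10 i)) (cong (λ t → 2 ^ (10 + i) + t) (+-identityʳ (2 ^ (10 + i))))

onset≤onset-suc : ∀ i → onset i ≤ onset (suc i)
onset≤onset-suc i = ≤-trans (m≤m+n _ (onset i)) (≤-reflexive (sym (onset-suc i)))

i<2^i : ∀ i → i < 2 ^ i
i<2^i zero    = s≤s z≤n
i<2^i (suc i) = +-mono-≤ (m^n>0 2 i) (≤-trans (i<2^i i) (≤-reflexive (sym (+-identityʳ (2 ^ i)))))

i<onset : ∀ i → i < onset i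
i<onset i = ≤-trans (i<2^i i) (≤-trans (^-monoʳ-≤ 2 (m≤n+m i 10)) (≤-reflexive (sym (onset-def i))))

short-strings : ℕ → List (List Bool)
short-strings zero    = strings 0
short-strings (suc b) = strings (suc b) ++ short-strings b

length-short-strings : ∀ b → length (short-strings b) ≤ 2 ^ suc b
length-short-strings zero    = s≤s z≤n
length-short-strings (suc b) = begin
  length (strings (suc b) ++ short-strings b) ≡⟨ List.length-++ (strings (suc b)) ⟩
  length (strings (suc b)) + length (short-strings b) ≤⟨ +-mono-≤ (≤-reflexive (length-strings (suc b))) (length-short-strings b) ⟩
  2 ^ suc b + 2 ^ suc b ≡⟨ cong (λ t → 2 ^ suc b + t) (sym (+-identityʳ (2 ^ suc b))) ⟩
  2 ^ suc (suc b) ∎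
  where open ≤-Reasoning

∈-short-strings : ∀ b y → length y ≤ b → y ∈ short-strings b
∈-short-strings zero    []      z≤n = here refl
∈-short-strings (suc b) y l with length y ≤? b
... | yes l′ = ∈-++⁺ʳ (strings (suc b)) (∈-short-strings b y l′)
... | no ¬l  = ∈-++⁺ˡ (subst (λ n → y ∈ strings n) (≤-antisym l (≰⇒> ¬l)) (∈-strings y))

-- Names of length up to 2 ^ i keep the list within 2 ^ (13 * 2 ^ i) entries, while every name is
-- covered from some stage on.
keys : ℕ → List Key
keys i = cartesianProduct (short-strings (2 ^ i)) (map (λ j → onset i + j) (upTo (onset i)))

length-cartesianProduct : ∀ {A B : Set} (xs : List A) (ys : List B) → length (cartesianProduct xs ys) ≡ length xs * length ys
length-cartesianProduct []       ys = refl
length-cartesianProduct (x ∷ xs) ys = trans (List.length-++ (map (x ,_) ys))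
  (cong₂ _+_ (List.length-map (x ,_) ys) (length-cartesianProduct xs ys))

length-keys : ∀ i → length (keys i) ≤ 2 ^ (13 * 2 ^ i)
length-keys i = begin
  length (keys i)
    ≡⟨ length-cartesianProduct (short-strings (2 ^ i)) _ ⟩
  length (short-strings (2 ^ i)) * length (map (λ j → onset i + j) (upTo (onset i)))
    ≤⟨ *-mono-≤ (length-short-strings (2 ^ i)) (≤-reflexive (trans (List.length-map _ (upTo (onset i))) (trans (List.length-upTo (onset i)) (onset-def i)))) ⟩
  2 ^ suc (2 ^ i) * 2 ^ (10 + i)
    ≡⟨ sym (^-distribˡ-+-* 2 (suc (2 ^ i)) (10 + i)) ⟩
  2 ^ (suc (2 ^ i) + (10 + i))
    ≤⟨ ^-monoʳ-≤ 2 (+-mono-≤ (+-monoˡ-≤ (2 ^ i) (m^n>0 2 i)) (+-mono-≤ (≤-trans (≤-reflexive (sym (*-identityʳ 10))) (*-monoʳ-≤ 10 (m^n>0 2 i))) (<⇒≤ (i<2^i i)))) ⟩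
  2 ^ (2 ^ i + 2 ^ i + (10 * 2 ^ i + 2 ^ i))
    ≡⟨ cong (2 ^_) (thirteen (2 ^ i)) ⟩
  2 ^ (13 * 2 ^ i) ∎
  where
  open ≤-Reasoning
  thirteen : ∀ e → e + e + (10 * e + e) ≡ 13 * e
  thirteen = ℕ-solve

keys-range : ∀ i u r → (u , r) ∈ keys i → onset i ≤ r × r < onset (suc i)
keys-range i u r κ∈ with ∈-map⁻ (λ j → onset i + j) (proj₂ (∈-cartesianProduct⁻ (short-strings (2 ^ i)) (map (λ j → onset i + j) (upTo (onset i))) κ∈))
... | j , j∈ , refl = m≤m+n (onset i) j , ≤-trans (+-monoʳ-< (onset i) (∈-upTo⁻ j∈)) (≤-reflexive (sym (onset-suc i)))

∈-keys : ∀ i u r → length u ≤ 2 ^ i → onset i ≤ r → r < onset (suc i) → (u , r) ∈ keys i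
∈-keys i u r l lo hi = ∈-cartesianProduct⁺ (∈-short-strings (2 ^ i) u l)
  (subst (_∈ map (λ j → onset i + j) (upTo (onset i))) (m+[n∸m]≡n lo)
    (∈-map⁺ (λ j → onset i + j) (∈-upTo⁺ (+-cancelˡ-< (onset i) _ _
      (subst₂ _<_ (sym (m+[n∸m]≡n lo)) (onset-suc i) hi)))))

onset-mono : ∀ {i j} → i ≤ j → onset i ≤ onset j
onset-mono {i} {j} i≤j rewrite onset-def i | onset-def j = ^-monoʳ-≤ 2 (+-monoʳ-≤ 10 i≤j)

-- The polynomials of a stage may depend on the state reached before it; the simulation queries will
-- be answered from that state.
module Encoding
  (p : ℕ → Assignment → Key → Assignment → ℤ)
  (p-degree : ∀ i ρ κ → HasDegree (2 ^ (2 ^ i)) (p i ρ κ))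
  (p-bounds : ∀ i ρ κ τ → 1 ≤ ∣ p i ρ κ τ ∣ × ∣ p i ρ κ τ ∣ < 2 ^ (2 ^ (2 ^ i) + 2))
  where

  initial-stage : Stage 0
  initial-stage = record
    { σ = λ _ → false ; π = replicate (budget 0) false ; φ = λ _ → 1 ; v = 1
    ; π-length = List.length-replicate (budget 0)
    ; degree = HasDegree-const 1ℤ
    ; bounded = λ _ _ → ≤-refl
    ; near = s≤s z≤n
    ; inner = λ v _ → all-false v
    ; positive = ≤-refl }
    where
    all-false : ∀ v → false ≡ decided 0 (λ _ → false) v
    all-false v with does (later? 0 v)
    ... | true  = refl
    ... | false = refl

  opaque
    advance-stage : ∀ i (s : Stage i) → Advance s (keys i) (p i (Stage.σ s))
    advance-stage i s = Advancing.advance i s (keys i) (p i (Stage.σ s)) N.d N.n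
      (p-degree i _) (p-bounds i _) (keys-range i) (onset≤onset-suc i) N.budget-suc N.small-ratio N.small-degree N.room
      where module N = Numerics i (length (keys i)) (length-keys i)

  stage : ∀ i → Stage i
  stage zero    = initial-stage
  stage (suc i) = Advance.next (advance-stage i (stage i))

  advance : ∀ i → Advance (stage i) (keys i) (p i (Stage.σ (stage i)))
  advance i = advance-stage i (stage i)

  state : ℕ → Assignment
  state i = Stage.σ (stage i)

  state-stable : ∀ {i j} → i ≤ j → ∀ u z → length z < onset i → state j (u , z) ≡ state i (u , z)
  state-stable {j = zero}  z≤n u z l = refl
  state-stable {i} {suc j} i≤sj u z l with m≤n⇒m<n∨m≡n i≤sj
  ... | inj₂ refl      = refl
  ... | inj₁ (s≤s i≤j) = trans (Advance.same (advance j) u z (≤-trans l (onset-mono i≤j))) (state-stable i≤j u z l)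

  -- The limit of the states. Since n < onset n, stage `length z` has already decided the bit at (u
  -- , z).
  core : Assignment
  core (u , z) = state (length z) (u , z)

  core-state : ∀ i u z → length z < onset i → core (u , z) ≡ state i (u , z)
  core-state i u z l with ≤-total i (length z)
  ... | inj₁ i≤z = state-stable i≤z u z l
  ... | inj₂ z≤i = sym (state-stable z≤i u z (i<onset (length z)))

  Near : ∀ i → Assignment → Set
  Near i τ = Extends (stage i) τ × Stage.v (stage i) ≤ 8 * Stage.φ (stage i) τ

  near-state : ∀ i → Near i (state i)
  near-state i = Varies-mono i (below⇒atMost (Stage.π (stage i))) (Stage.inner (stage i)) ,
    ≤-trans (Stage.near (stage i)) (*-monoˡ-≤ (Stage.φ (stage i) (state i)) (m≤m+n 4 4))

  near-earlier : ∀ {i j} → i ≤ j → ∀ τ → Near j τ → Near i τ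
  near-earlier {j = zero}  z≤n τ h = h
  near-earlier {i} {suc j} i≤sj τ (ext , h) with m≤n⇒m<n∨m≡n i≤sj
  ... | inj₂ refl      = ext , h
  ... | inj₁ (s≤s i≤j) = near-earlier i≤j τ (Advance.shrink (advance j) τ ext , Advance.keep (advance j) τ ext h)

  level : ℕ → List Bool
  level i = Stage.π (stage (suc i))

  level-length : ∀ i → length (level i) ≡ budget (suc i)
  level-length i = Stage.π-length (stage (suc i))

  -- The margin depends on finitely many bits, so at the limit it equals its value at some later
  -- state. That state is near the maximum of its own stage, hence by `near-earlier` of stage
  -- `suc i`, where nearness forces the recorded sign.
  core-settled : ∀ i u r → (u , r) ∈ keys i → Settled (level i) (nonNegative (p i (state i) (u , r) core)) core u r
  core-settled i u r κ∈ = subst (λ b → Settled (level i) b core u r) (sym correct)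
    (Settled-cong (state (suc i)) core (λ z l → sym (core-state (suc i) u z (subst (_< onset (suc i)) (sym l) (proj₂ (keys-range i u r κ∈)))))
      (Advance.settled (advance i) u r κ∈))
    where
    margin-of = p i (state i) (u , r)
    support = HasDegree-supported (p-degree i (state i) (u , r))
    -- The sum dominates the length of every variable in the support, so all of them are decided by
    -- that stage.
    horizon = suc i + sum (map (λ v → length (proj₂ v)) (proj₁ support))
    ≤sum : ∀ vs {v : Var} → v ∈ vs → length (proj₂ v) ≤ sum (map (λ v → length (proj₂ v)) vs)
    ≤sum (v ∷ vs) (here refl) = m≤m+n _ _
    ≤sum (w ∷ vs) (there i)   = ≤-trans (≤sum vs i) (m≤n+m _ (length (proj₂ w)))
    same : margin-of core ≡ margin-of (state horizon)
    same = proj₂ support core (state horizon) (λ v v∈ → core-state horizon (proj₁ v) (proj₂ v)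
      (≤-trans (i<onset (length (proj₂ v))) (onset-mono (≤-trans (≤sum (proj₁ support) v∈) (m≤n+m _ (suc i))))))
    correct : nonNegative (margin-of core) ≡ Advance.bits (advance i) (u , r)
    correct with near-earlier {suc i} {horizon} (m≤m+n (suc i) _) (state horizon) (near-state horizon)
    ... | ext , h = trans (cong nonNegative same) (Advance.correct (advance i) (state horizon) ext h (u , r) κ∈)

open import Data.Fin using (Fin; zero; suc; toℕ; #_)
open import Data.Maybe using (Maybe; just; nothing)
open import Data.Maybe.Properties using (just-injective)
open import Data.Vec using (Vec; []; _∷_; toList; lookup; tabulate)
import Data.Vec as Vec
import Data.Vec.Properties as Vec

-- Machines as strings

-- `contents` skips blanks, so the length of a query is the number of nonblank cells, wherever the
-- head has wandered.
nonblanks : List Sym → ℕ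
nonblanks l = length (mapMaybe id l)

nonblanks-++ : ∀ l r → nonblanks (l ++ r) ≡ nonblanks l + nonblanks r
nonblanks-++ []            r = refl
nonblanks-++ (just _ ∷ l)  r = cong suc (nonblanks-++ l r)
nonblanks-++ (nothing ∷ l) r = nonblanks-++ l r

nonblanks-∷ : ∀ s l → nonblanks (s ∷ l) ≡ nonblanks l + nonblanks (s ∷ [])
nonblanks-∷ (just _) l = +-comm 1 (nonblanks l)
nonblanks-∷ nothing  l = sym (+-identityʳ (nonblanks l))

nonblanks-reverse : ∀ l → nonblanks (reverse l) ≡ nonblanks l
nonblanks-reverse []      = refl
nonblanks-reverse (s ∷ l) = begin
  nonblanks (reverse (s ∷ l)) ≡⟨ cong nonblanks (List.unfold-reverse s l) ⟩
  nonblanks (reverse l ++ s ∷ []) ≡⟨ nonblanks-++ (reverse l) (s ∷ []) ⟩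
  nonblanks (reverse l) + nonblanks (s ∷ []) ≡⟨ cong (_+ nonblanks (s ∷ [])) (nonblanks-reverse l) ⟩
  nonblanks l + nonblanks (s ∷ []) ≡⟨ sym (nonblanks-∷ s l) ⟩
  nonblanks (s ∷ l) ∎
  where open ≡-Reasoning

tape-size : Tape → ℕ
tape-size (tape l h r) = nonblanks l + (nonblanks (h ∷ []) + nonblanks r)

contents-size : ∀ t → length (contents t) ≡ tape-size t
contents-size (tape l h r) = trans (nonblanks-++ (reverse l) (h ∷ r))
  (cong₂ _+_ (nonblanks-reverse l) (trans (nonblanks-∷ h r) (+-comm (nonblanks r) _)))

nonblank≤1 : ∀ s → nonblanks (s ∷ []) ≤ 1
nonblank≤1 (just _) = ≤-refl
nonblank≤1 nothing  = z≤n

move-size : ∀ m t → tape-size (move m t) ≡ tape-size t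
move-size mL (tape [] h r)      = trans (nonblanks-∷ h r) (+-comm (nonblanks r) _)
move-size mL (tape (a ∷ l) h r) = begin
  nonblanks l + (nonblanks (a ∷ []) + nonblanks (h ∷ r))
    ≡⟨ cong (λ n → nonblanks l + (nonblanks (a ∷ []) + n)) (trans (nonblanks-∷ h r) (+-comm (nonblanks r) _)) ⟩
  nonblanks l + (nonblanks (a ∷ []) + (nonblanks (h ∷ []) + nonblanks r))
    ≡⟨ sym (+-assoc (nonblanks l) _ _) ⟩
  nonblanks l + nonblanks (a ∷ []) + (nonblanks (h ∷ []) + nonblanks r)
    ≡⟨ cong (_+ (nonblanks (h ∷ []) + nonblanks r)) (sym (nonblanks-∷ a l)) ⟩
  _ ∎
  where open ≡-Reasoning
move-size mS t                  = refl
move-size mR (tape l h [])      = trans (+-identityʳ _) (trans (nonblanks-∷ h l) (cong (λ t → nonblanks l + t) (sym (+-identityʳ _))))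
move-size mR (tape l h (a ∷ r)) = begin
  nonblanks (h ∷ l) + (nonblanks (a ∷ []) + nonblanks r)
    ≡⟨ cong₂ _+_ (nonblanks-∷ h l) (trans (+-comm _ (nonblanks r)) (sym (nonblanks-∷ a r))) ⟩
  nonblanks l + nonblanks (h ∷ []) + nonblanks (a ∷ r)
    ≡⟨ +-assoc (nonblanks l) _ _ ⟩
  _ ∎
  where open ≡-Reasoning

write-size : ∀ s t → tape-size (write s t) ≤ suc (tape-size t)
write-size s (tape l h r) = begin
  nonblanks l + (nonblanks (s ∷ []) + nonblanks r) ≤⟨ +-monoʳ-≤ (nonblanks l) (+-monoˡ-≤ (nonblanks r) (nonblank≤1 s)) ⟩
  nonblanks l + suc (nonblanks r) ≡⟨ +-suc (nonblanks l) _ ⟩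
  suc (nonblanks l + nonblanks r) ≤⟨ s≤s (+-monoʳ-≤ (nonblanks l) (m≤n+m (nonblanks r) (nonblanks (h ∷ [])))) ⟩
  suc (nonblanks l + (nonblanks (h ∷ []) + nonblanks r)) ∎
  where open ≤-Reasoning

update-size : ∀ ss ms ts → length (queryString (update ss ms ts)) ≤ suc (length (queryString ts))
update-size (_ ∷ _ ∷ _ ∷ s ∷ []) (_ ∷ _ ∷ _ ∷ m ∷ []) (_ ∷ _ ∷ _ ∷ t ∷ []) = begin
  length (contents (move m (write s t))) ≡⟨ trans (contents-size (move m (write s t))) (move-size m (write s t)) ⟩
  tape-size (write s t) ≤⟨ write-size s t ⟩
  suc (tape-size t) ≡⟨ cong suc (sym (contents-size t)) ⟩
  suc (length (contents t)) ∎
  where open ≤-Reasoning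

-- Locality of runs

AgreeUpTo : ℕ → Lang → Lang → Set
AgreeUpTo N A B = ∀ w → length w ≤ N → A w ≡ B w

-- A step adds at most one nonblank cell to the query tape, so the length of the pending query plus
-- the remaining fuel never grows.
run-local : ∀ M {A B N} f q ts → length (queryString ts) + f ≤ N → AgreeUpTo N A B → run M A f q ts ≡ run M B f q ts
run-local M zero    q ts l h = refl
run-local M {A} {B} {N} (suc f) q ts l h with OTM.δ M q (heads ts)
... | halt b       = refl
... | step q′ s m  = run-local M f q′ (update s m ts) (begin
  length (queryString (update s m ts)) + f ≤⟨ +-monoˡ-≤ f (update-size s m ts) ⟩
  suc (length (queryString ts)) + f ≡⟨ sym (+-suc _ f) ⟩
  length (queryString ts) + suc f ≤⟨ l ⟩
  N ∎) h
  where open ≤-Reasoning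
run-local M {A} {B} {N} (suc f) q (a ∷ b ∷ c ∷ d ∷ []) l h | query y n
  rewrite h (contents d) (≤-trans (m≤m+n _ (suc f)) l) =
  run-local M f _ (a ∷ b ∷ c ∷ blankTape ∷ []) (≤-trans (n≤1+n f) (≤-trans (m≤n+m (suc f) _) l)) h

exec-local : ∀ M {A B} T x y → AgreeUpTo T A B → exec M A T x y ≡ exec M B T x y
exec-local M T x y h = run-local M T _ _ ≤-refl h

count-cong : ∀ m {f g : Vec Bool m → Bool} → (∀ y → f y ≡ g y) → count m f ≡ count m g
count-cong zero    e rewrite e [] = refl
count-cong (suc m) e = cong₂ _+_ (count-cong m (λ y → e (false ∷ y))) (count-cong m (λ y → e (true ∷ y)))

-- A transition function has finitely many values; listing them as data makes machines countable up
-- to their behaviour.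
record Table : Set where
  constructor table
  field
    extra : ℕ
    begin-state : Fin (suc extra)
    rows  : Vec (Vec (Vec (Vec (Vec (Action (Fin (suc extra))) 3) 3) 3) 3) (suc extra)

symbol-index : Sym → Fin 3
symbol-index nothing      = zero
symbol-index (just false) = suc zero
symbol-index (just true)  = suc (suc zero)

index-symbol : Fin 3 → Sym
index-symbol zero             = nothing
index-symbol (suc zero)       = just false
index-symbol (suc (suc zero)) = just true

index-symbol-index : ∀ s → index-symbol (symbol-index s) ≡ s
index-symbol-index nothing      = refl
index-symbol-index (just false) = refl
index-symbol-index (just true)  = refl

machine : Table → OTM
machine (table n s rows) = record
  { nstates = suc n
  ; start = s
  ; δ = λ { q (a ∷ b ∷ c ∷ d ∷ []) → lookup (lookup (lookup (lookup (lookup rows q) (symbol-index a)) (symbol-index b)) (symbol-index c)) (symbol-index d) } }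

tabulated : ∀ n → Fin (suc n) → (Fin (suc n) → Vec Sym 4 → Action (Fin (suc n))) → Table
tabulated n s δ = table n s (tabulate λ q → tabulate λ a → tabulate λ b → tabulate λ c → tabulate λ d →
  δ q (index-symbol a ∷ index-symbol b ∷ index-symbol c ∷ index-symbol d ∷ []))

tabulated-δ : ∀ n s δ q hs → OTM.δ (machine (tabulated n s δ)) q hs ≡ δ q hs
tabulated-δ n s δ q (a ∷ b ∷ c ∷ d ∷ [])
  rewrite Vec.lookup∘tabulate (λ q → tabulate λ a → tabulate λ b → tabulate λ c → tabulate λ d →
            δ q (index-symbol a ∷ index-symbol b ∷ index-symbol c ∷ index-symbol d ∷ [])) q
        | Vec.lookup∘tabulate (λ a → tabulate λ b → tabulate λ c → tabulate λ d →
            δ q (index-symbol a ∷ index-symbol b ∷ index-symbol c ∷ index-symbol d ∷ [])) (symbol-index a)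
        | Vec.lookup∘tabulate (λ b → tabulate λ c → tabulate λ d →
            δ q (index-symbol (symbol-index a) ∷ index-symbol b ∷ index-symbol c ∷ index-symbol d ∷ [])) (symbol-index b)
        | Vec.lookup∘tabulate (λ c → tabulate λ d →
            δ q (index-symbol (symbol-index a) ∷ index-symbol (symbol-index b) ∷ index-symbol c ∷ index-symbol d ∷ [])) (symbol-index c)
        | Vec.lookup∘tabulate (λ d →
            δ q (index-symbol (symbol-index a) ∷ index-symbol (symbol-index b) ∷ index-symbol (symbol-index c) ∷ index-symbol d ∷ [])) (symbol-index d)
        | index-symbol-index a | index-symbol-index b | index-symbol-index c | index-symbol-index d = refl

run-ext : ∀ {n} (s s′ : Fin n) δ δ′ → (∀ q hs → δ q hs ≡ δ′ q hs) → ∀ A f q ts →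
          run (record { nstates = n ; start = s ; δ = δ }) A f q ts ≡ run (record { nstates = n ; start = s′ ; δ = δ′ }) A f q ts
run-ext s s′ δ δ′ e A zero    q ts = refl
run-ext s s′ δ δ′ e A (suc f) q ts with δ q (heads ts) | δ′ q (heads ts) | e q (heads ts)
... | halt b       | .(halt b)       | refl = refl
... | step q′ ss m | .(step q′ ss m) | refl = run-ext s s′ δ δ′ e A f q′ (update ss m ts)
... | query y n    | .(query y n)    | refl = run-ext s s′ δ δ′ e A f (if A (queryString ts) then y else n) (eraseQuery ts)

table-of : ∀ M → Σ Table λ t → ∀ A T x y → exec (machine t) A T x y ≡ exec M A T x y
table-of record { nstates = suc n ; start = s ; δ = δ } =
  tabulated n s δ , λ A T x y → run-ext s s _ δ (tabulated-δ n s δ) A T s _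

-- Enumerating the machines

record Countable (A : Set) : Set where
  field
    enum : ℕ → A
    surj : ∀ a → Σ ℕ λ n → enum n ≡ a

onto : ∀ {A B : Set} → Countable A → (g : A → B) → (∀ b → Σ A λ a → g a ≡ b) → Countable B
onto C g h = record
  { enum = λ n → g (Countable.enum C n)
  ; surj = λ b → let (a , e) = h b ; (n , e′) = Countable.surj C a in n , trans (cong g e′) e }

-- Walks along an antidiagonal and, at its end, jumps to the start of the next one.
successor : ℕ × ℕ → ℕ × ℕ
successor (a , zero)  = zero , suc a
successor (a , suc b) = suc a , b

unpair : ℕ → ℕ × ℕ
unpair zero    = zero , zero
unpair (suc n) = successor (unpair n)

unpair-walk : ∀ j a b n → unpair n ≡ (a , j + b) → Σ ℕ λ m → unpair m ≡ (j + a , b)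
unpair-walk zero    a b n e = n , e
unpair-walk (suc j) a b n e with unpair-walk j (suc a) b (suc n) (cong successor e)
... | m , e′ = m , trans e′ (cong (_, b) (+-suc j a))

unpair-axis : ∀ s → Σ ℕ λ n → unpair n ≡ (0 , s)
unpair-axis zero    = 0 , refl
unpair-axis (suc s) with unpair-axis s
... | n , e with unpair-walk s 0 0 n (trans e (cong (0 ,_) (sym (+-identityʳ s))))
...   | m , e′ = suc m , trans (cong successor e′) (cong (λ t → 0 , suc t) (+-identityʳ s))

unpair-onto : ∀ a b → Σ ℕ λ n → unpair n ≡ (a , b)
unpair-onto a b with unpair-axis (a + b)
... | n , e with unpair-walk a 0 b n e
...   | m , e′ = m , trans e′ (cong (_, b) (+-identityʳ a))

Countable-Σ : ∀ {A : Set} {B : A → Set} → Countable A → (∀ a → Countable (B a)) → Countable (Σ A B)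
Countable-Σ {A} {B} CA CB = record { enum = λ n → dependent (unpair n) ; surj = λ { (a , b) → hit a b } }
  where
  dependent : ℕ × ℕ → Σ A B
  dependent (i , j) = Countable.enum CA i , Countable.enum (CB (Countable.enum CA i)) j
  hit : ∀ a b → Σ ℕ λ n → dependent (unpair n) ≡ (a , b)
  hit a b with Countable.surj CA a
  ... | i , refl with Countable.surj (CB (Countable.enum CA i)) b
  ...   | j , refl with unpair-onto i j
  ...     | n , e = n , cong dependent e

Countable-× : ∀ {A B : Set} → Countable A → Countable B → Countable (A × B)
Countable-× CA CB = Countable-Σ CA (λ _ → CB)

Countable-ℕ : Countable ℕ
Countable-ℕ = record { enum = id ; surj = λ n → n , refl }

Countable-Fin : ∀ n → Countable (Fin (suc n))
Countable-Fin n = record { enum = clamp n ; surj = λ q → toℕ q , clamp-toℕ n q }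
  where
  clamp : ∀ n → ℕ → Fin (suc n)
  clamp n       zero    = zero
  clamp zero    (suc k) = zero
  clamp (suc n) (suc k) = suc (clamp n k)
  clamp-toℕ : ∀ n (q : Fin (suc n)) → clamp n (toℕ q) ≡ q
  clamp-toℕ n       zero    = refl
  clamp-toℕ (suc n) (suc q) = cong suc (clamp-toℕ n q)

Countable-Bool : Countable Bool
Countable-Bool = onto Countable-ℕ (λ n → n ≡ᵇ 0) (λ { true → 0 , refl ; false → 1 , refl })

Countable-Sym : Countable Sym
Countable-Sym = onto (Countable-Fin 2) index-symbol (λ s → symbol-index s , index-symbol-index s)

Countable-Move : Countable Move
Countable-Move = onto (Countable-Fin 2) (λ { zero → mL ; (suc zero) → mS ; (suc (suc zero)) → mR })
  (λ { mL → zero , refl ; mS → suc zero , refl ; mR → suc (suc zero) , refl })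

Countable-Vec : ∀ {A : Set} n → Countable A → Countable (Vec A n)
Countable-Vec zero    C = record { enum = λ _ → [] ; surj = λ { [] → 0 , refl } }
Countable-Vec (suc n) C = onto (Countable-× C (Countable-Vec n C)) (λ { (a , as) → a ∷ as }) (λ { (a ∷ as) → (a , as) , refl })

Countable-List : ∀ {A : Set} → Countable A → Countable (List A)
Countable-List {A} C = onto (Countable-Σ Countable-ℕ (λ n → Countable-Vec n C)) (λ { (n , as) → toList as }) listed
  where
  listed : ∀ l → Σ (Σ ℕ (Vec A)) λ { (n , as) → toList as ≡ l }
  listed []      = (0 , []) , refl
  listed (a ∷ l) with listed l
  ... | (n , as) , e = (suc n , a ∷ as) , cong (a ∷_) e

Countable-Action : ∀ {Q : Set} → Countable Q → Countable (Action Q)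
Countable-Action {Q} C = onto
  (Countable-× Countable-ℕ (Countable-× Countable-Bool (Countable-× (Countable-× C C) (Countable-× (Countable-Vec 4 Countable-Sym) (Countable-Vec 4 Countable-Move)))))
  choose
  (λ { (halt b) → (0 , b , (q₀ , q₀) , (s₀ , m₀)) , refl
     ; (step q s m) → (1 , true , (q , q₀) , (s , m)) , refl
     ; (query y n) → (2 , true , (y , n) , (s₀ , m₀)) , refl })
  where
  q₀ = Countable.enum C 0
  s₀ = Countable.enum (Countable-Vec 4 Countable-Sym) 0
  m₀ = Countable.enum (Countable-Vec 4 Countable-Move) 0
  choose : ℕ × Bool × (Q × Q) × Vec Sym 4 × Vec Move 4 → Action Q
  choose (0 , b , _ , _)           = halt b
  choose (1 , _ , (q , _) , s , m) = step q s m
  choose (_ , _ , (y , n) , _)     = query y n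

Countable-Table : Countable Table
Countable-Table = onto
  (Countable-Σ Countable-ℕ (λ n → Countable-× (Countable-Fin n)
    (Countable-Vec (suc n) (Countable-Vec 3 (Countable-Vec 3 (Countable-Vec 3 (Countable-Vec 3 (Countable-Action (Countable-Fin n)))))))))
  (λ { (n , s , rows) → table n s rows })
  (λ { (table n s rows) → (n , s , rows) , refl })

-- Towers of nondeterministic levels

data Mode : Set where
  exists odd : Mode

record Level : Set where
  constructor mkLevel
  field
    mode    : Mode
    code    : Table
    k c d e : ℕ

judge : Mode → ℕ → Bool
judge exists n = 0 <ᵇ n
judge odd    n = n % 2 ≡ᵇ 1

eval-level : Level → Lang → Lang
eval-level (mkLevel mode t k c d e) A x = judge mode (#acc (machine t) A (poly k c) (poly d e) x)

eval : List Level → Lang → Lang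
eval []       A = A
eval (l ∷ ls) A = eval-level l (eval ls A)

poly-mono : ∀ k c {m n} → m ≤ n → poly k c m ≤ poly k c n
poly-mono k c m≤n = +-monoˡ-≤ c (*-monoʳ-≤ c (^-monoˡ-≤ k m≤n))

-- A level queries only strings within its running time, so composing the time bounds limits how far
-- an evaluation looks into the base language.
reach : List Level → ℕ → ℕ
reach []       n = n
reach (l ∷ ls) n = reach ls (poly (Level.k l) (Level.c l) n)

reach-mono : ∀ ls {m n} → m ≤ n → reach ls m ≤ reach ls n
reach-mono []       h = h
reach-mono (l ∷ ls) h = reach-mono ls (poly-mono (Level.k l) (Level.c l) h)

eval-local : ∀ ls {A B} x → AgreeUpTo (reach ls (length x)) A B → eval ls A x ≡ eval ls B x
eval-local []                               x h = h x ≤-refl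
eval-local (mkLevel mode t k c d e ∷ ls) {A} {B} x h = cong (judge mode) (count-cong (poly d e (length x)) (λ y → cong accepts
  (exec-local (machine t) (poly k c (length x)) x (toList y) (λ w l → eval-local ls w (λ w′ l′ → h w′ (≤-trans l′ (reach-mono ls l)))))))

-- Three services of the oracle: storing verdicts of majority machines, simulating towers of levels,
-- and verifying certificates for the binary search. `majority` carries no time bound, since stage i
-- runs every machine for 2 ^ (2 ^ i) steps.
data Code : Set where
  majority : Table → ℕ → ℕ → Code
  levels   : List Level → Code
  search   : ℕ → ℕ → ℕ → Code

Countable-Level : Countable Level
Countable-Level = onto
  (Countable-× Countable-Bool (Countable-× Countable-Table (Countable-× (Countable-× Countable-ℕ Countable-ℕ) (Countable-× Countable-ℕ Countable-ℕ))))
  (λ { (b , t , (k , c) , (d , e)) → mkLevel (if b then exists else odd) t k c d e })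
  (λ { (mkLevel exists t k c d e) → (true , t , (k , c) , (d , e)) , refl
     ; (mkLevel odd t k c d e) → (false , t , (k , c) , (d , e)) , refl })

Countable-Code : Countable Code
Countable-Code = onto
  (Countable-× Countable-ℕ (Countable-× Countable-Table (Countable-× (Countable-List Countable-Level) (Countable-× Countable-ℕ (Countable-× Countable-ℕ Countable-ℕ)))))
  choose
  (λ { (majority t d e) → (0 , t , [] , 0 , d , e) , refl
     ; (levels ls) → (1 , t₀ , ls , 0 , 0 , 0) , refl
     ; (search i k c) → (2 , t₀ , [] , i , k , c) , refl })
  where
  t₀ = Countable.enum Countable-Table 0
  choose : ℕ × Table × List Level × ℕ × ℕ × ℕ → Code
  choose (0 , t , _ , _ , d , e) = majority t d e
  choose (1 , _ , ls , _)        = levels ls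
  choose (_ , _ , _ , i , k , c) = search i k c

opaque
  decode : ℕ → Code
  decode = Countable.enum Countable-Code

  encode : ∀ w → Σ ℕ λ n → decode n ≡ w
  encode = Countable.surj Countable-Code

-- The oracle

-- Every bit of `u` is announced by `true` and the end of `u` by `false`: a self-delimiting code
-- that a machine can write in one pass over two tapes.
pair-up : List Bool → List Bool → List Bool
pair-up []      z = false ∷ z
pair-up (b ∷ u) z = true ∷ b ∷ pair-up u z

parse : List Bool → List Bool × List Bool
parse []             = [] , []
parse (false ∷ q)    = [] , q
parse (true ∷ [])    = [] , []
parse (true ∷ b ∷ q) = b ∷ proj₁ (parse q) , proj₂ (parse q)

parse-pair-up : ∀ u z → parse (pair-up u z) ≡ (u , z)
parse-pair-up []      z = refl
parse-pair-up (b ∷ u) z rewrite parse-pair-up u z = refl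

parse-short : ∀ q → length (proj₂ (parse q)) ≤ length q
parse-short []             = z≤n
parse-short (false ∷ q)    = n≤1+n _
parse-short (true ∷ [])    = z≤n
parse-short (true ∷ b ∷ q) = ≤-trans (parse-short q) (≤-trans (n≤1+n _) (n≤1+n _))

tag : ℕ → List Bool → List Bool
tag zero    x = false ∷ x
tag (suc i) x = true ∷ tag i x

untag : List Bool → ℕ × List Bool
untag []          = 0 , []
untag (false ∷ x) = 0 , x
untag (true ∷ u)  = suc (proj₁ (untag u)) , proj₂ (untag u)

untag-tag : ∀ i x → untag (tag i x) ≡ (i , x)
untag-tag zero    x = refl
untag-tag (suc i) x rewrite untag-tag i x = refl

length-tag : ∀ i x → length (tag i x) ≡ suc (i + length x)
length-tag zero    x = refl
length-tag (suc i) x = cong suc (length-tag i x)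

opaque
  -- The i with onset i ≤ r < onset (suc i); lengths before `onset 0` also get 0.
  stage-of : ℕ → ℕ
  stage-of zero    = 0
  stage-of (suc r) = if does (suc r <? onset (suc (stage-of r))) then stage-of r else suc (stage-of r)

  stage-of-upper : ∀ r → r < onset (suc (stage-of r))
  stage-of-upper zero = ≤-trans (s≤s z≤n) (i<onset 1)
  stage-of-upper (suc r) with suc r <? onset (suc (stage-of r))
  ... | yes h rewrite dec-true (suc r <? onset (suc (stage-of r))) h = h
  ... | no ¬h rewrite dec-false (suc r <? onset (suc (stage-of r))) ¬h = begin
    suc (suc r) ≤⟨ s≤s (stage-of-upper r) ⟩
    suc (onset (suc (stage-of r))) ≤⟨ +-monoˡ-≤ (onset (suc (stage-of r))) (≤-trans (s≤s z≤n) (i<onset (suc (stage-of r)))) ⟩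
    onset (suc (stage-of r)) + onset (suc (stage-of r)) ≡⟨ sym (onset-suc (suc (stage-of r))) ⟩
    onset (suc (suc (stage-of r))) ∎
    where open ≤-Reasoning

  stage-of-small : ∀ r → r < onset 1 → stage-of r ≡ 0
  stage-of-small zero    h = refl
  stage-of-small (suc r) h rewrite stage-of-small r (<-trans (n<1+n r) h) | dec-true (suc r <? onset 1) h = refl

  stage-of-lower : ∀ r → onset 0 ≤ r → onset (stage-of r) ≤ r
  stage-of-lower zero    h = contradiction (≤-trans (i<onset 0) h) (λ ())
  stage-of-lower (suc r) h with suc r <? onset (suc (stage-of r))
  ... | no ¬l rewrite dec-false (suc r <? onset (suc (stage-of r))) ¬l = ≮⇒≥ ¬l
  ... | yes l rewrite dec-true (suc r <? onset (suc (stage-of r))) l with m≤n⇒m<n∨m≡n h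
  ...   | inj₁ (s≤s h′) = ≤-trans (stage-of-lower r h′) (n≤1+n r)
  ...   | inj₂ eq = ≤-trans (onset-mono (≤-reflexive (stage-of-small r (≤-trans (≤-reflexive (sym eq)) (onset≤onset-suc 0))))) h

isPrefix : List Bool → List Bool → Bool
isPrefix []      z       = true
isPrefix (b ∷ s) []      = false
isPrefix (b ∷ s) (a ∷ z) = does (b Bool.≟ a) ∧ isPrefix s z

search-length : ℕ → ℕ
search-length r = budget (suc (stage-of r)) + 2

-- After the input x, a leading `true` asks whether the prefix `s` is complete, which spares the
-- querying machine the computation of the zone length. A leading `false` asks whether `z` exhibits
-- a one of the region that starts with `s` and a further 1. `z` is cut to the region length of x
-- because certificates are sized by the longer string that pairs x with the prefix.
searching : Assignment → ℕ → ℕ → ℕ → List Bool × List Bool → List Bool → Bool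
searching σ i k c (x , [])        z = false
searching σ i k c (x , true ∷ s)  z = does (search-length (poly k c (length x)) ≤? length s)
searching σ i k c (x , false ∷ s) z =
  isPrefix (s ++ true ∷ []) (take (poly k c (length x)) z) ∧ σ (tag i x , take (poly k c (length x)) z)

-- The cut-off makes the recursion in the oracle well-founded, and it confines a simulation to
-- strings that are decided before the stage at hand.
clip : ℕ → Lang → Lang
clip n A w = if does (2 ^ length w ≤? n) then A w else false

respond : Assignment → Lang → ℕ → Code → List Bool → List Bool → List Bool → Bool
respond σ A n (majority _ _ _) u x z = σ (u , z)
respond σ A n (levels ls)      u x z = eval ls (clip n A) x
respond σ A n (search i k c)   u x z = searching σ i k c (parse x) z

answer : Assignment → Lang → Lang
answer σ A q =
  respond σ A (length q) (decode (proj₁ (untag (proj₁ (parse q))))) (proj₁ (parse q)) (proj₂ (untag (proj₁ (parse q)))) (proj₂ (parse q))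

answer-pair-up : ∀ σ A i x z → answer σ A (pair-up (tag i x) z) ≡ respond σ A (length (pair-up (tag i x) z)) (decode i) (tag i x) x z
answer-pair-up σ A i x z rewrite parse-pair-up (tag i x) z | untag-tag i x = refl

take-short : ∀ r (z : List Bool) → length (take r z) ≤ length z
take-short zero    z       = z≤n
take-short (suc r) []      = z≤n
take-short (suc r) (b ∷ z) = s≤s (take-short r z)

clip-agree : ∀ {A B} n → (∀ w → 2 ^ length w ≤ n → A w ≡ B w) → ∀ w → clip n A w ≡ clip n B w
clip-agree n h w with 2 ^ length w ≤? n
... | yes l rewrite dec-true (2 ^ length w ≤? n) l = h w l
... | no ¬l rewrite dec-false (2 ^ length w ≤? n) ¬l = refl

respond-agree : ∀ {σ τ A B} n w u x z → length z ≤ n → (∀ u z → length z ≤ n → σ (u , z) ≡ τ (u , z)) →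
                (∀ q → 2 ^ length q ≤ n → A q ≡ B q) → respond σ A n w u x z ≡ respond τ B n w u x z
respond-agree n (majority _ _ _) u x z l hσ hA = hσ u z l
respond-agree n (levels ls)      u x z l hσ hA = eval-local ls x (λ q _ → clip-agree n hA q)
respond-agree {σ} {τ} n (search i k c) u x z l hσ hA = go (parse x)
  where
  go : ∀ xs → searching σ i k c xs z ≡ searching τ i k c xs z
  go (x , [])        = refl
  go (x , true ∷ s)  = refl
  go (x , false ∷ s) = cong (isPrefix (s ++ true ∷ []) (take r z) ∧_) (hσ _ (take r z) (≤-trans (take-short r z) l))
    where r = poly k c (length x)

answer-agree : ∀ {σ τ A B} q → (∀ u z → length z ≤ length q → σ (u , z) ≡ τ (u , z)) →
               (∀ w → 2 ^ length w ≤ length q → A w ≡ B w) → answer σ A q ≡ answer τ B q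
answer-agree q hσ hA = respond-agree (length q) (decode (proj₁ (untag (proj₁ (parse q))))) _ _ _ (parse-short q) hσ hA

-- Once the simulated part of the oracle is fixed, an answer reads at most one bit of the
-- assignment, so a query raises the degree by at most one.
Atomic : (Assignment → Bool) → Set
Atomic F = (Σ Bool λ b → ∀ σ → F σ ≡ b) ⊎ (Σ Var λ v → ∀ σ → F σ ≡ σ v)

respond-cases : ∀ A n w u x z → Atomic (λ σ → respond σ A n w u x z)
respond-cases A n (majority _ _ _) u x z = inj₂ ((u , z) , λ _ → refl)
respond-cases A n (levels ls)      u x z = inj₁ (eval ls (clip n A) x , λ _ → refl)
respond-cases A n (search i k c)   u x z = go (parse x)
  where
  go : ∀ xs → Atomic (λ σ → searching σ i k c xs z)
  go (x , [])        = inj₁ (false , λ _ → refl)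
  go (x , true ∷ s)  = inj₁ (_ , λ _ → refl)
  go (x , false ∷ s) with isPrefix (s ++ true ∷ []) (take (poly k c (length x)) z)
  ... | false = inj₁ (false , λ _ → refl)
  ... | true  = inj₂ ((tag i x , take (poly k c (length x)) z) , λ _ → refl)

answer-cases : ∀ A q → Atomic (λ σ → answer σ A q)
answer-cases A q = respond-cases A (length q) (decode (proj₁ (untag (proj₁ (parse q))))) _ _ _

oracle-upto : Assignment → ℕ → Lang
oracle-upto σ zero    q = false
oracle-upto σ (suc f) q = answer σ (oracle-upto σ f) q

oracle : Assignment → Lang
oracle σ q = oracle-upto σ (suc (length q)) q

shorter : ∀ (w : List Bool) {n} → 2 ^ length w ≤ n → length w < n
shorter w h = ≤-trans (i<2^i (length w)) h

oracle-upto-stable : ∀ σ f g q → length q < f → length q < g → oracle-upto σ f q ≡ oracle-upto σ g q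
oracle-upto-stable σ (suc f) (suc g) q (s≤s lf) (s≤s lg) = answer-agree q (λ _ _ _ → refl)
  (λ w h → oracle-upto-stable σ f g w (≤-trans (shorter w h) lf) (≤-trans (shorter w h) lg))

oracle-unfold : ∀ σ q → oracle σ q ≡ answer σ (oracle σ) q
oracle-unfold σ q = answer-agree q (λ _ _ _ → refl)
  (λ w h → oracle-upto-stable σ (length q) (suc (length w)) w (shorter w h) ≤-refl)

oracle-upto-agree : ∀ {σ τ N} → (∀ u z → length z < N → σ (u , z) ≡ τ (u , z)) → ∀ f q → length q < N →
                    oracle-upto σ f q ≡ oracle-upto τ f q
oracle-upto-agree h zero    q l = refl
oracle-upto-agree h (suc f) q l = answer-agree q (λ u z l′ → h u z (≤-trans (s≤s l′) l))
  (λ w l′ → oracle-upto-agree h f w (<-trans (shorter w l′) l))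

2^-cancel-≤ : ∀ {a b} → 2 ^ a ≤ 2 ^ b → a ≤ b
2^-cancel-≤ {a} {b} h = ≮⇒≥ (λ b<a → <⇒≱ (^-monoʳ-< 2 (s≤s (s≤s z≤n)) b<a) h)

2^i<onset : ∀ i → 2 ^ i < onset i
2^i<onset i = subst (2 ^ i <_) (sym (onset-def i)) (^-monoʳ-< 2 (s≤s (s≤s z≤n)) (s≤s (m≤n+m i 9)))

-- The strings an exponentially long simulation query depends on are too short to mention stage i.
answer-oracle : ∀ i ρ σ → (∀ u z → length z < onset i → σ (u , z) ≡ ρ (u , z)) →
                ∀ q → length q ≤ 2 ^ (2 ^ i) → answer σ (oracle ρ) q ≡ oracle σ q
answer-oracle i ρ σ h q l = trans
  (answer-agree q (λ _ _ _ → refl) (λ w l′ → sym (oracle-upto-agree h (suc (length w)) w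
    (≤-trans (s≤s (2^-cancel-≤ {length w} {2 ^ i} (≤-trans l′ l))) (2^i<onset i)))))
  (sym (oracle-unfold σ q))

-- Verdicts as signs of low-degree polynomials

HasDegree-run : ∀ M A f q ts → HasDegree f (λ σ → bit (accepts (run M (answer σ A) f q ts)))
HasDegree-run M A zero    q ts = HasDegree-const 0ℤ
HasDegree-run M A (suc f) q ts with OTM.δ M q (heads ts)
... | halt b      = HasDegree-const (bit b)
... | step q′ s m = HasDegree-≤ (n≤1+n f) (HasDegree-run M A f q′ (update s m ts))
... | query y n with answer-cases A (queryString ts)
...   | inj₁ (b , e) = HasDegree-≤ (n≤1+n f) (HasDegree-cong
        (λ σ → cong (λ a → bit (accepts (run M (answer σ A) f (if a then y else n) (eraseQuery ts)))) (sym (e σ)))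
        (HasDegree-run M A f (if b then y else n) (eraseQuery ts)))
...   | inj₂ (v , e) = HasDegree-cong branch
        (HasDegree-+ (HasDegree-run⇑ n) (HasDegree-* (HasDegree-var v) (HasDegree-+ (HasDegree-run M A f y (eraseQuery ts)) (HasDegree-signed false (HasDegree-run M A f n (eraseQuery ts))))))
  where
  HasDegree-run⇑ : ∀ n → HasDegree (1 + f) (λ σ → bit (accepts (run M (answer σ A) f n (eraseQuery ts))))
  HasDegree-run⇑ n = HasDegree-≤ (n≤1+n f) (HasDegree-run M A f n (eraseQuery ts))
  branch : ∀ σ → bit (accepts (run M (answer σ A) f n (eraseQuery ts))) ℤ.+ bit (σ v) ℤ.*
             (bit (accepts (run M (answer σ A) f y (eraseQuery ts))) ℤ.+ ℤ.- bit (accepts (run M (answer σ A) f n (eraseQuery ts))))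
           ≡ bit (accepts (run M (answer σ A) f (if answer σ A (queryString ts) then y else n) (eraseQuery ts)))
  branch σ rewrite e σ with σ v
  ... | true  = taken (bit (accepts (run M (answer σ A) f n (eraseQuery ts)))) (bit (accepts (run M (answer σ A) f y (eraseQuery ts))))
    where
    taken : ∀ a b → a ℤ.+ 1ℤ ℤ.* (b ℤ.+ ℤ.- a) ≡ b
    taken = ℤ-solve
  ... | false = skipped (bit (accepts (run M (answer σ A) f n (eraseQuery ts)))) (bit (accepts (run M (answer σ A) f y (eraseQuery ts))))
    where
    skipped : ∀ a b → a ℤ.+ 0ℤ ℤ.* (b ℤ.+ ℤ.- a) ≡ a
    skipped = ℤ-solve

HasDegree-count : ∀ {D} m (f : Assignment → Vec Bool m → Bool) → (∀ y → HasDegree D (λ σ → bit (f σ y))) → HasDegree D (λ σ → + count m (f σ))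
HasDegree-count zero f h = HasDegree-cong (λ σ → single (f σ [])) (h [])
  where
  single : ∀ b → bit b ≡ + (if b then 1 else 0)
  single true  = refl
  single false = refl
HasDegree-count (suc m) f h = HasDegree-cong (λ σ → sym (ℤP.pos-+ (count m (λ y → f σ (false ∷ y))) (count m (λ y → f σ (true ∷ y)))))
  (HasDegree-+ (HasDegree-count m (λ σ y → f σ (false ∷ y)) (λ y → h (false ∷ y)))
               (HasDegree-count m (λ σ y → f σ (true ∷ y)) (λ y → h (true ∷ y))))

count≤ : ∀ m f → count m f ≤ 2 ^ m
count≤ zero    f with f []
... | true  = ≤-refl
... | false = z≤n
count≤ (suc m) f = +-mono-≤ (count≤ m _) (≤-trans (count≤ m _) (≤-reflexive (sym (+-identityʳ (2 ^ m)))))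

votes : Table → Lang → ℕ → ℕ → List Bool → ℕ
votes t A T m x = count m (λ y → accepts (exec (machine t) A T x (toList y)))

-- An odd number, hence never zero, and positive exactly when 2a > M, that is, when a strict
-- majority of M paths accepts.
excess : ℕ → ℕ → ℤ
excess a M = + (4 * a) ℤ.- + suc (2 * M)

-- Machines with too many choices for the stage, and names of the other kinds, get the constant 1,
-- so that the degree and the bounds hold uniformly for all keys.
margin : ℕ → Lang → Code → List Bool → ℤ
margin i A (majority t d e) x =
  if does (poly d e (length x) ≤? 2 ^ i)
  then excess (votes t A (2 ^ (2 ^ i)) (2 ^ poly d e (length x)) x) (2 ^ (2 ^ poly d e (length x)))
  else 1ℤ
margin i A (levels _)     x = 1ℤ
margin i A (search _ _ _) x = 1ℤ

-- Simulations are answered from the fixed state `ρ` and only direct look-ups from `σ`, which keeps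
-- every answer atomic. By `answer-oracle` this agrees with the real oracle on all queries within
-- the stage's running time.
margins : ℕ → Assignment → Key → Assignment → ℤ
margins i ρ (u , r) σ = margin i (answer σ (oracle ρ)) (decode (proj₁ (untag u))) (proj₂ (untag u))

margins-degree : ∀ i ρ κ → HasDegree (2 ^ (2 ^ i)) (margins i ρ κ)
margins-degree i ρ (u , r) with decode (proj₁ (untag u)) | proj₂ (untag u)
... | levels _       | x = HasDegree-const 1ℤ
... | search _ _ _   | x = HasDegree-const 1ℤ
... | majority t d e | x with does (poly d e (length x) ≤? 2 ^ i)
...   | false = HasDegree-const 1ℤ
...   | true  = HasDegree-+ (HasDegree-cong (λ σ → sym (ℤP.pos-* 4 (a σ))) (HasDegree-* {0} {2 ^ (2 ^ i)} (HasDegree-const (+ 4))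
      (HasDegree-count (2 ^ poly d e (length x)) (λ σ y → accepts (exec (machine t) (answer σ (oracle ρ)) (2 ^ (2 ^ i)) x (toList y)))
        (λ y → HasDegree-run (machine t) (oracle ρ) (2 ^ (2 ^ i)) _ _)))) (HasDegree-const (ℤ.- + suc (2 * 2 ^ (2 ^ poly d e (length x)))))
  where
  a : Assignment → ℕ
  a σ = votes t (answer σ (oracle ρ)) (2 ^ (2 ^ i)) (2 ^ poly d e (length x)) x

excess-nonzero : ∀ a M → 1 ≤ ∣ excess a M ∣
excess-nonzero a M with ∣ excess a M ∣ in e
... | suc _ = s≤s z≤n
... | zero  = ⊥-elim (odd≢even (2 * a) M (trans (double a) (ℤP.+-injective (ℤP.i-j≡0⇒i≡j _ _ (ℤP.∣i∣≡0⇒i≡0 e)))))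
  where
  double : ∀ a → 2 * (2 * a) ≡ 4 * a
  double = ℕ-solve
  odd≢even : ∀ a M → 2 * a ≡ suc (2 * M) → ⊥
  odd≢even (suc a) zero    h with () ← trans (sym (+-suc a (a + 0))) (suc-injective h)
  odd≢even (suc a) (suc M) h = odd≢even a M (suc-injective (suc-injective (trans (sym (2*suc a)) (trans h (cong suc (2*suc M))))))
    where
    2*suc : ∀ n → 2 * suc n ≡ suc (suc (2 * n))
    2*suc = ℕ-solve

excess-small : ∀ a M → 1 ≤ M → a ≤ M → ∣ excess a M ∣ < 4 * M
excess-small a M 1≤M a≤M rewrite ℤP.m-n≡m⊖n (4 * a) (suc (2 * M)) with ≤-total (suc (2 * M)) (4 * a)
... | inj₁ le rewrite ℤP.⊖-≥ le = ≤-trans (s≤s (∸-monoʳ-≤ (4 * a) (s≤s z≤n))) (≤-trans (≤-reflexive (m+[n∸m]≡n {1} (≤-trans (s≤s z≤n) le))) (*-monoʳ-≤ 4 a≤M))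
... | inj₂ ge rewrite ℤP.⊖-≤ ge | ℤP.∣-i∣≡∣i∣ (+ (suc (2 * M) ∸ 4 * a)) = begin
  suc (suc (2 * M) ∸ 4 * a) ≤⟨ s≤s (m∸n≤m (suc (2 * M)) (4 * a)) ⟩
  suc (suc (2 * M)) ≤⟨ +-monoˡ-≤ (2 * M) (*-monoʳ-≤ 2 1≤M) ⟩
  2 * M + 2 * M ≡⟨ four M ⟩
  4 * M ∎
  where
  open ≤-Reasoning
  four : ∀ M → 2 * M + 2 * M ≡ 4 * M
  four = ℕ-solve

excess-sign : ∀ a M → nonNegative (excess a M) ≡ true → M < 2 * a
excess-sign a M h with suc (2 * M) ≤? 4 * a
... | yes le = *-cancelˡ-< 2 M (2 * a) (≤-trans le (≤-reflexive (double a)))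
  where
  double : ∀ a → 4 * a ≡ 2 * (2 * a)
  double = ℕ-solve
... | no ¬le rewrite ℤP.m-n≡m⊖n (4 * a) (suc (2 * M)) | ℤP.⊖-< (≰⇒> ¬le) with suc (2 * M) ∸ 4 * a in e
...   | zero  = contradiction (m∸n≡0⇒m≤n e) ¬le
excess-sign a M () | no ¬le | suc _

excess-sign⁻ : ∀ a M → M < 2 * a → nonNegative (excess a M) ≡ true
excess-sign⁻ a M h = subst (λ t → nonNegative t ≡ true) (sym (trans (ℤP.m-n≡m⊖n (4 * a) (suc (2 * M))) (ℤP.⊖-≥ enough))) refl
  where
  two : ∀ M → suc (2 * M + 1) ≡ 2 * suc M
  two = ℕ-solve
  double : ∀ a → 2 * (2 * a) ≡ 4 * a
  double = ℕ-solve
  enough : suc (2 * M) ≤ 4 * a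
  enough = ≤-trans (s≤s (m≤m+n _ _)) (≤-trans (≤-reflexive (two M)) (≤-trans (*-monoʳ-≤ 2 h) (≤-reflexive (double a))))

margins-bounds : ∀ i ρ κ τ → 1 ≤ ∣ margins i ρ κ τ ∣ × ∣ margins i ρ κ τ ∣ < 2 ^ (2 ^ (2 ^ i) + 2)
margins-bounds i ρ (u , r) τ with decode (proj₁ (untag u)) | proj₂ (untag u)
... | levels _       | x = ≤-refl , ≤-trans (s≤s (s≤s z≤n)) (^-monoʳ-≤ 2 {2} (m≤n+m 2 (2 ^ (2 ^ i))))
... | search _ _ _   | x = ≤-refl , ≤-trans (s≤s (s≤s z≤n)) (^-monoʳ-≤ 2 {2} (m≤n+m 2 (2 ^ (2 ^ i))))
... | majority t d e | x with poly d e (length x) ≤? 2 ^ i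
...   | no ¬l rewrite dec-false (poly d e (length x) ≤? 2 ^ i) ¬l = ≤-refl , ≤-trans (s≤s (s≤s z≤n)) (^-monoʳ-≤ 2 {2} (m≤n+m 2 (2 ^ (2 ^ i))))
...   | yes l rewrite dec-true (poly d e (length x) ≤? 2 ^ i) l = excess-nonzero a M , (begin
        suc ∣ excess a M ∣ ≤⟨ excess-small a M (m^n>0 2 (2 ^ poly d e (length x))) (count≤ (2 ^ poly d e (length x)) _) ⟩
        4 * M ≤⟨ *-monoʳ-≤ 4 (^-monoʳ-≤ 2 (^-monoʳ-≤ 2 l)) ⟩
        4 * 2 ^ (2 ^ (2 ^ i)) ≡⟨ trans (*-comm 4 (2 ^ (2 ^ (2 ^ i)))) (sym (^-distribˡ-+-* 2 (2 ^ (2 ^ i)) 2)) ⟩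
        2 ^ (2 ^ (2 ^ i) + 2) ∎)
  where
  open ≤-Reasoning
  a = votes t (answer τ (oracle ρ)) (2 ^ (2 ^ i)) (2 ^ poly d e (length x)) x
  M = 2 ^ (2 ^ poly d e (length x))

margins-majority : ∀ i ρ σ → (∀ u z → length z < onset i → σ (u , z) ≡ ρ (u , z)) →
  ∀ j t d e x r → decode j ≡ majority t d e → poly d e (length x) ≤ 2 ^ i →
  margins i ρ (tag j x , r) σ ≡ excess (votes t (oracle σ) (2 ^ (2 ^ i)) (2 ^ poly d e (length x)) x) (2 ^ (2 ^ poly d e (length x)))
margins-majority i ρ σ agree j t d e x r dj l = begin
  margin i A (decode (proj₁ (untag (tag j x)))) (proj₂ (untag (tag j x)))
    ≡⟨ cong (λ ix → margin i A (decode (proj₁ ix)) (proj₂ ix)) (untag-tag j x) ⟩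
  margin i A (decode j) x
    ≡⟨ cong (λ w → margin i A w x) dj ⟩
  margin i A (majority t d e) x
    ≡⟨ cong (λ b → if b then excess (votes t A T m x) (2 ^ m) else 1ℤ) (dec-true (poly d e (length x) ≤? 2 ^ i) l) ⟩
  excess (votes t A T m x) (2 ^ m)
    ≡⟨ cong (λ a → excess a (2 ^ m)) votes-agree ⟩
  excess (votes t (oracle σ) T m x) (2 ^ m) ∎
  where
  open ≡-Reasoning
  A = answer σ (oracle ρ)
  T = 2 ^ (2 ^ i)
  m = 2 ^ poly d e (length x)
  votes-agree : votes t A T m x ≡ votes t (oracle σ) T m x
  votes-agree = count-cong m (λ y → cong accepts (exec-local (machine t) T x (toList y) (answer-oracle i ρ σ agree)))

-- Two machines

run-more : ∀ M {A} f g q ts {b} → run M A f q ts ≡ just b → f ≤ g → run M A g q ts ≡ just b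
run-more M {A} (suc f) (suc g) q ts e (s≤s f≤g) with OTM.δ M q (heads ts)
... | halt _       = e
... | step q′ s m  = run-more M f g q′ (update s m ts) e f≤g
... | query y n    = run-more M f g (if A (queryString ts) then y else n) (eraseQuery ts) e f≤g

written : List Bool → Tape
written ws = tape (map just ws) nothing []

contents-written : ∀ ws → contents (written ws) ≡ reverse ws
contents-written ws = trans (cong (λ l → mapMaybe id (l ++ nothing ∷ [])) (sym (List.map-ʳ++ just ws))) (forget (reverse ws))
  where
  forget : ∀ v → mapMaybe id (map just v ++ nothing ∷ []) ≡ v
  forget []      = refl
  forget (b ∷ v) = cong (b ∷_) (forget v)

cursor : List Sym → List Bool → Tape
cursor l []       = tape l nothing []
cursor l (b ∷ bs) = tape l (just b) (map just bs)

cursor-right : ∀ l b bs → move mR (write (just b) (cursor l (b ∷ bs))) ≡ cursor (just b ∷ l) bs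
cursor-right l b []       = refl
cursor-right l b (c ∷ bs) = refl

inputTape-cursor : ∀ x → inputTape x ≡ cursor [] x
inputTape-cursor []      = refl
inputTape-cursor (b ∷ x) = refl

-- Writes `pair-up x y` for its two input strings on the query tape and returns the oracle's answer;
-- the first two states handle the announced bits of x, the third copies y.
copy-δ : Fin 5 → Vec Sym 4 → Action (Fin 5)
copy-δ zero (just b ∷ s₂ ∷ s₃ ∷ s₄ ∷ [])        = step (suc zero) (just b ∷ s₂ ∷ s₃ ∷ just true ∷ []) (mS ∷ mS ∷ mS ∷ mR ∷ [])
copy-δ zero (nothing ∷ s₂ ∷ s₃ ∷ s₄ ∷ [])       = step (suc (suc zero)) (nothing ∷ s₂ ∷ s₃ ∷ just false ∷ []) (mS ∷ mS ∷ mS ∷ mR ∷ [])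
copy-δ (suc zero) (s₁ ∷ s₂ ∷ s₃ ∷ s₄ ∷ [])      = step zero (s₁ ∷ s₂ ∷ s₃ ∷ s₁ ∷ []) (mR ∷ mS ∷ mS ∷ mR ∷ [])
copy-δ (suc (suc zero)) (s₁ ∷ just b ∷ s₃ ∷ s₄ ∷ []) = step (suc (suc zero)) (s₁ ∷ just b ∷ s₃ ∷ just b ∷ []) (mS ∷ mR ∷ mS ∷ mR ∷ [])
copy-δ (suc (suc zero)) (s₁ ∷ nothing ∷ s₃ ∷ s₄ ∷ []) = query (suc (suc (suc zero))) (suc (suc (suc (suc zero))))
copy-δ (suc (suc (suc zero))) _                 = halt true
copy-δ (suc (suc (suc (suc zero)))) _           = halt false

relabel : ∀ {Q R : Set} → (Q → R) → Action Q → Action R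
relabel g (halt b)     = halt b
relabel g (step q s m) = step (g q) s m
relabel g (query y n)  = query (g y) (g n)

copier-states : List Bool → ℕ
copier-states []        = 5
copier-states (b ∷ pre) = suc (copier-states pre)

copier-start : ∀ pre → Fin (copier-states pre)
copier-start []        = zero
copier-start (b ∷ pre) = zero

copier-δ : ∀ pre → Fin (copier-states pre) → Vec Sym 4 → Action (Fin (copier-states pre))
copier-δ []        q       hs                       = copy-δ q hs
copier-δ (b ∷ pre) zero    (s₁ ∷ s₂ ∷ s₃ ∷ s₄ ∷ []) = step (suc (copier-start pre)) (s₁ ∷ s₂ ∷ s₃ ∷ just b ∷ []) (mS ∷ mS ∷ mS ∷ mR ∷ [])
copier-δ (b ∷ pre) (suc q) hs                       = relabel suc (copier-δ pre q hs)

copier : List Bool → OTM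
copier pre = record { nstates = copier-states pre ; start = copier-start pre ; δ = copier-δ pre }

copier-tail : ∀ b pre A f q ts → run (copier (b ∷ pre)) A f (suc q) ts ≡ run (copier pre) A f q ts
copier-tail b pre A zero    q ts = refl
copier-tail b pre A (suc f) q ts with copier-δ pre q (heads ts)
... | halt _      = refl
... | step q′ s m = copier-tail b pre A f q′ (update s m ts)
... | query y n with A (queryString ts)
...   | true  = copier-tail b pre A f y (eraseQuery ts)
...   | false = copier-tail b pre A f n (eraseQuery ts)

copy-certificate : ∀ A x ys l w ws f → run (copier []) A (length ys + (2 + f)) (suc (suc zero)) (x ∷ cursor l ys ∷ w ∷ written ws ∷ []) ≡ just (A (reverse (ys ʳ++ ws)))
copy-certificate A x [] l w ws f rewrite contents-written ws with A (reverse ws)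
... | true  = refl
... | false = refl
copy-certificate A x (b ∷ ys) l w ws f =
  trans (cong (λ t → run (copier []) A (length ys + (2 + f)) (suc (suc zero)) (x ∷ t ∷ w ∷ written (b ∷ ws) ∷ [])) (cursor-right l b ys))
    (copy-certificate A x ys (just b ∷ l) w (b ∷ ws) f)

copy-input : ∀ A xs l ys w ws f → run (copier []) A (length xs + (length xs + (1 + (length ys + (2 + f))))) zero (cursor l xs ∷ cursor [] ys ∷ w ∷ written ws ∷ []) ≡ just (A (reverse (pair-up xs ys ʳ++ ws)))
copy-input A []       l ys w ws f = copy-certificate A (cursor l []) ys [] w (false ∷ ws) f
copy-input A (b ∷ xs) l ys w ws f =
  trans (cong (λ n → run (copier []) A n (suc zero) (cursor l (b ∷ xs) ∷ cursor [] ys ∷ w ∷ written (true ∷ ws) ∷ [])) (+-suc (length xs) _))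
    (trans (cong (λ t → run (copier []) A (length xs + (length xs + (1 + (length ys + (2 + f))))) zero (t ∷ cursor [] ys ∷ w ∷ written (b ∷ true ∷ ws) ∷ [])) (cursor-right l b xs))
      (copy-input A xs (just b ∷ l) ys w (b ∷ true ∷ ws) f))

copy-prefix : ∀ A pre a b w ws f → run (copier pre) A (length pre + f) (copier-start pre) (a ∷ b ∷ w ∷ written ws ∷ []) ≡ run (copier []) A f zero (a ∷ b ∷ w ∷ written (pre ʳ++ ws) ∷ [])
copy-prefix A []        a b w ws f = refl
copy-prefix A (c ∷ pre) a b w ws f =
  trans (copier-tail c pre A (length pre + f) (copier-start pre) (a ∷ b ∷ w ∷ written (c ∷ ws) ∷ [])) (copy-prefix A pre a b w (c ∷ ws) f)

copier-time : List Bool → ℕ → ℕ → ℕ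
copier-time pre n m = length pre + (n + (n + (1 + (m + 2))))

copier-exec : ∀ A pre x y T → copier-time pre (length x) (length y) ≤ T → exec (copier pre) A T x y ≡ just (A (pre ++ pair-up x y))
copier-exec A pre x y T h = run-more (copier pre) _ T _ _ (begin
  run (copier pre) A (copier-time pre (length x) (length y)) (copier-start pre) (inputTape x ∷ inputTape y ∷ blankTape ∷ blankTape ∷ [])
    ≡⟨ cong₂ (λ s t → run (copier pre) A (copier-time pre (length x) (length y)) (copier-start pre) (s ∷ t ∷ blankTape ∷ blankTape ∷ [])) (inputTape-cursor x) (inputTape-cursor y) ⟩
  _ ≡⟨ copy-prefix A pre (cursor [] x) (cursor [] y) blankTape [] _ ⟩
  _ ≡⟨ copy-input A x [] y blankTape (pre ʳ++ []) 0 ⟩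
  just (A (reverse (pair-up x y ʳ++ (pre ʳ++ []))))
    ≡⟨ cong (λ w → just (A w)) (trans (cong reverse (sym (List.++-ʳ++ pre))) (List.reverse-involutive (pre ++ pair-up x y))) ⟩
  just (A (pre ++ pair-up x y)) ∎) h
  where open ≡-Reasoning

-- The unary tag in the announced form of `pair-up`, left open at its end so that the input
-- continues the same first component.
tag-prefix : ℕ → List Bool
tag-prefix zero    = true ∷ false ∷ []
tag-prefix (suc i) = true ∷ true ∷ tag-prefix i

tag-prefix-pair-up : ∀ i x y → tag-prefix i ++ pair-up x y ≡ pair-up (tag i x) y
tag-prefix-pair-up zero    x y = refl
tag-prefix-pair-up (suc i) x y = cong (λ w → true ∷ true ∷ w) (tag-prefix-pair-up i x y)

-- The flag is true in the phase asking whether to stop and false in the phase asking for the next bit.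
data SearchState : Set where
  copy₁ copy₂ rewind-input copy-found confirmed refuted rewind-found : Bool → SearchState
  finish : SearchState

-- The third tape holds the prefix found so far. A question copies the input, the flag and this
-- prefix to the query tape; the input is rewound before the query and the prefix after it, when the
-- answer may have been appended.
search-δ : SearchState → Vec Sym 4 → Action SearchState
search-δ (copy₁ ph) (just b ∷ s₂ ∷ s₃ ∷ s₄ ∷ [])         = step (copy₂ ph) (just b ∷ s₂ ∷ s₃ ∷ just true ∷ []) (mS ∷ mS ∷ mS ∷ mR ∷ [])
search-δ (copy₁ ph) (nothing ∷ s₂ ∷ s₃ ∷ s₄ ∷ [])        = step (rewind-input ph) (nothing ∷ s₂ ∷ s₃ ∷ just false ∷ []) (mL ∷ mS ∷ mS ∷ mR ∷ [])
search-δ (copy₂ ph) (s₁ ∷ s₂ ∷ s₃ ∷ s₄ ∷ [])             = step (copy₁ ph) (s₁ ∷ s₂ ∷ s₃ ∷ s₁ ∷ []) (mR ∷ mS ∷ mS ∷ mR ∷ [])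
search-δ (rewind-input ph) (just b ∷ s₂ ∷ s₃ ∷ s₄ ∷ [])  = step (rewind-input ph) (just b ∷ s₂ ∷ s₃ ∷ s₄ ∷ []) (mL ∷ mS ∷ mS ∷ mS ∷ [])
search-δ (rewind-input ph) (nothing ∷ s₂ ∷ s₃ ∷ s₄ ∷ []) = step (copy-found ph) (nothing ∷ s₂ ∷ s₃ ∷ just ph ∷ []) (mR ∷ mS ∷ mS ∷ mR ∷ [])
search-δ (copy-found ph) (s₁ ∷ s₂ ∷ just b ∷ s₄ ∷ [])    = step (copy-found ph) (s₁ ∷ s₂ ∷ just b ∷ just b ∷ []) (mS ∷ mS ∷ mR ∷ mR ∷ [])
search-δ (copy-found ph) (s₁ ∷ s₂ ∷ nothing ∷ s₄ ∷ [])   = query (confirmed ph) (refuted ph)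
search-δ (confirmed true) (s₁ ∷ s₂ ∷ s₃ ∷ s₄ ∷ [])             = step finish (s₁ ∷ s₂ ∷ s₃ ∷ s₄ ∷ []) (mS ∷ mS ∷ mL ∷ mS ∷ [])
search-δ (refuted true) (s₁ ∷ s₂ ∷ s₃ ∷ s₄ ∷ [])              = step (rewind-found true) (s₁ ∷ s₂ ∷ s₃ ∷ s₄ ∷ []) (mS ∷ mS ∷ mL ∷ mS ∷ [])
search-δ (confirmed false) (s₁ ∷ s₂ ∷ s₃ ∷ s₄ ∷ [])            = step (rewind-found false) (s₁ ∷ s₂ ∷ just true ∷ s₄ ∷ []) (mS ∷ mS ∷ mL ∷ mS ∷ [])
search-δ (refuted false) (s₁ ∷ s₂ ∷ s₃ ∷ s₄ ∷ [])             = step (rewind-found false) (s₁ ∷ s₂ ∷ just false ∷ s₄ ∷ []) (mS ∷ mS ∷ mL ∷ mS ∷ [])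
search-δ (rewind-found ph) (s₁ ∷ s₂ ∷ just b ∷ s₄ ∷ [])  = step (rewind-found ph) (s₁ ∷ s₂ ∷ just b ∷ s₄ ∷ []) (mS ∷ mS ∷ mL ∷ mS ∷ [])
search-δ (rewind-found ph) (s₁ ∷ s₂ ∷ nothing ∷ s₄ ∷ []) = step (copy₁ (not ph)) (s₁ ∷ s₂ ∷ nothing ∷ s₄ ∷ []) (mS ∷ mS ∷ mR ∷ mS ∷ [])
search-δ finish (s₁ ∷ s₂ ∷ just b ∷ s₄ ∷ [])             = halt b
search-δ finish (s₁ ∷ s₂ ∷ nothing ∷ s₄ ∷ [])            = halt false

search-states : Vec SearchState 15
search-states =
  copy₁ true ∷ copy₁ false ∷ copy₂ true ∷ copy₂ false ∷ rewind-input true ∷ rewind-input false ∷ copy-found true ∷ copy-found false ∷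
  confirmed true ∷ confirmed false ∷ refuted true ∷ refuted false ∷ rewind-found true ∷ rewind-found false ∷ finish ∷ []

state-index : SearchState → Fin 15
state-index (copy₁ true)         = # 0
state-index (copy₁ false)        = # 1
state-index (copy₂ true)         = # 2
state-index (copy₂ false)        = # 3
state-index (rewind-input true)  = # 4
state-index (rewind-input false) = # 5
state-index (copy-found true)    = # 6
state-index (copy-found false)   = # 7
state-index (confirmed true)           = # 8
state-index (confirmed false)          = # 9
state-index (refuted true)            = # 10
state-index (refuted false)           = # 11
state-index (rewind-found true)  = # 12
state-index (rewind-found false) = # 13
state-index finish               = # 14

state-index-lookup : ∀ q → lookup search-states (state-index q) ≡ q
state-index-lookup (copy₁ true)         = refl
state-index-lookup (copy₁ false)        = refl
state-index-lookup (copy₂ true)         = refl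
state-index-lookup (copy₂ false)        = refl
state-index-lookup (rewind-input true)  = refl
state-index-lookup (rewind-input false) = refl
state-index-lookup (copy-found true)    = refl
state-index-lookup (copy-found false)   = refl
state-index-lookup (confirmed true)           = refl
state-index-lookup (confirmed false)          = refl
state-index-lookup (refuted true)            = refl
state-index-lookup (refuted false)           = refl
state-index-lookup (rewind-found true)  = refl
state-index-lookup (rewind-found false) = refl
state-index-lookup finish               = refl

searcher : OTM
searcher = record { nstates = 15 ; start = state-index (copy₁ true) ; δ = λ q hs → relabel state-index (search-δ (lookup search-states q) hs) }

simulate : Lang → ℕ → SearchState → Tapes → Maybe Bool
simulate A zero    q ts = nothing
simulate A (suc f) q ts with search-δ q (heads ts)
... | halt b      = just b
... | step q′ s m = simulate A f q′ (update s m ts)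
... | query y n   = simulate A f (if A (queryString ts) then y else n) (eraseQuery ts)

run-simulate : ∀ A f q q′ ts → lookup search-states q ≡ q′ → run searcher A f q ts ≡ simulate A f q′ ts
run-simulate A zero    q _ ts refl = refl
run-simulate A (suc f) q _ ts refl with search-δ (lookup search-states q) (heads ts)
... | halt b      = refl
... | step q″ s m = run-simulate A f (state-index q″) q″ (update s m ts) (state-index-lookup q″)
... | query y n with A (queryString ts)
...   | true  = run-simulate A f (state-index y) y (eraseQuery ts) (state-index-lookup y)
...   | false = run-simulate A f (state-index n) n (eraseQuery ts) (state-index-lookup n)

-- Rewinding leaves visited blanks at the ends of a word, and as lists such tapes differ from fresh
-- ones; a flag for each end records whether a blank cell is there.
blanks : Bool → List Sym
blanks true  = nothing ∷ []
blanks false = []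

scan : List Sym → List Bool → Bool → Tape
scan l []       e = tape l nothing []
scan l (b ∷ bs) e = tape l (just b) (map just bs ++ blanks e)

scan-right : ∀ l b bs e → move mR (write (just b) (scan l (b ∷ bs) e)) ≡ scan (just b ∷ l) bs e
scan-right l b []       true  = refl
scan-right l b []       false = refl
scan-right l b (c ∷ bs) e     = refl

passed : List Bool → Bool → List Sym
passed ds e = map just ds ++ blanks e

doubled : List Bool → List Bool → List Bool
doubled []      ws = ws
doubled (b ∷ x) ws = doubled x (b ∷ true ∷ ws)

pair-up-doubled : ∀ x z ws → pair-up x z ʳ++ ws ≡ z ʳ++ (false ∷ doubled x ws)
pair-up-doubled []      z ws = refl
pair-up-doubled (b ∷ x) z ws = pair-up-doubled x z (b ∷ true ∷ ws)

-- Fuel that recurs on the word being scanned, so that runs unfold along with it; the closed forms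
-- come afterwards in `ticks-sum` and `double-ticks-sum`.
ticks double-ticks : List Bool → ℕ → ℕ
ticks []             f = f
ticks (_ ∷ x)        f = suc (ticks x f)
double-ticks []      f = f
double-ticks (_ ∷ x) f = suc (suc (double-ticks x f))

copying-input : ∀ A ph x ds e e′ t₂ t₃ ws f →
  simulate A (double-ticks x f) (copy₁ ph) (scan (passed ds e) x e′ ∷ t₂ ∷ t₃ ∷ written ws ∷ []) ≡
  simulate A f (copy₁ ph) (tape (passed (x ʳ++ ds) e) nothing [] ∷ t₂ ∷ t₃ ∷ written (doubled x ws) ∷ [])
copying-input A ph []      ds e e′ t₂ t₃ ws f = refl
copying-input A ph (b ∷ x) ds e e′ t₂ t₃ ws f =
  trans (cong (λ t → simulate A (double-ticks x f) (copy₁ ph) (t ∷ t₂ ∷ t₃ ∷ written (b ∷ true ∷ ws) ∷ [])) (scan-right (passed ds e) b x e′))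
    (copying-input A ph x (b ∷ ds) e e′ t₂ t₃ (b ∷ true ∷ ws) f)

rewinding-input : ∀ A ph ds c cs e e′ t₂ t₃ ws f →
  simulate A (suc (ticks ds (suc f))) (rewind-input ph) (tape (passed ds e) (just c) (passed cs e′) ∷ t₂ ∷ t₃ ∷ written ws ∷ []) ≡
  simulate A f (copy-found ph) (scan (nothing ∷ []) (ds ʳ++ (c ∷ cs)) e′ ∷ t₂ ∷ t₃ ∷ written (ph ∷ ws) ∷ [])
rewinding-input A ph []       c cs true  e′ t₂ t₃ ws f = refl
rewinding-input A ph []       c cs false e′ t₂ t₃ ws f = refl
rewinding-input A ph (d ∷ ds) c cs e     e′ t₂ t₃ ws f = rewinding-input A ph ds d (c ∷ cs) e e′ t₂ t₃ ws f

rewound-input : ∀ A ph ds e t₂ t₃ ws f →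
  simulate A (suc (ticks ds (suc f))) (copy₁ ph) (tape (passed ds e) nothing [] ∷ t₂ ∷ t₃ ∷ written ws ∷ []) ≡
  simulate A f (copy-found ph) (scan (blanks true) (reverse ds) true ∷ t₂ ∷ t₃ ∷ written (ph ∷ false ∷ ws) ∷ [])
rewound-input A ph []       true  t₂ t₃ ws f = refl
rewound-input A ph []       false t₂ t₃ ws f = refl
rewound-input A ph (d ∷ ds) e     t₂ t₃ ws f = rewinding-input A ph ds d [] e true t₂ t₃ (false ∷ ws) f

copying-found : ∀ A ph s ds e e′ t₁ t₂ ws f →
  simulate A (ticks s f) (copy-found ph) (t₁ ∷ t₂ ∷ scan (passed ds e) s e′ ∷ written ws ∷ []) ≡
  simulate A f (copy-found ph) (t₁ ∷ t₂ ∷ tape (passed (s ʳ++ ds) e) nothing [] ∷ written (s ʳ++ ws) ∷ [])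
copying-found A ph []      ds e e′ t₁ t₂ ws f = refl
copying-found A ph (b ∷ s) ds e e′ t₁ t₂ ws f =
  trans (cong (λ t → simulate A (ticks s f) (copy-found ph) (t₁ ∷ t₂ ∷ t ∷ written (b ∷ ws) ∷ [])) (scan-right (passed ds e) b s e′))
    (copying-found A ph s (b ∷ ds) e e′ t₁ t₂ (b ∷ ws) f)

rewinding-found : ∀ A ph ds c cs e e′ t₁ t₂ t₄ f →
  simulate A (suc (ticks ds (suc f))) (rewind-found ph) (t₁ ∷ t₂ ∷ tape (passed ds e) (just c) (passed cs e′) ∷ t₄ ∷ []) ≡
  simulate A f (copy₁ (not ph)) (t₁ ∷ t₂ ∷ scan (nothing ∷ []) (ds ʳ++ (c ∷ cs)) e′ ∷ t₄ ∷ [])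
rewinding-found A ph []       c cs true  e′ t₁ t₂ t₄ f = refl
rewinding-found A ph []       c cs false e′ t₁ t₂ t₄ f = refl
rewinding-found A ph (d ∷ ds) c cs e     e′ t₁ t₂ t₄ f = rewinding-found A ph ds d (c ∷ cs) e e′ t₁ t₂ t₄ f

continue : ∀ A ds e t₁ t₂ t₄ f →
  simulate A (suc (ticks ds (suc f))) (refuted true) (t₁ ∷ t₂ ∷ tape (passed ds e) nothing [] ∷ t₄ ∷ []) ≡
  simulate A f (copy₁ false) (t₁ ∷ t₂ ∷ scan (blanks true) (reverse ds) true ∷ t₄ ∷ [])
continue A []       true  t₁ t₂ t₄ f = refl
continue A []       false t₁ t₂ t₄ f = refl
continue A (d ∷ ds) e     t₁ t₂ t₄ f = rewinding-found A true ds d [] e true t₁ t₂ t₄ f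

append : ∀ A b ds e t₁ t₂ t₄ f →
  simulate A (suc (ticks ds (suc f))) (if b then confirmed false else refuted false) (t₁ ∷ t₂ ∷ tape (passed ds e) nothing [] ∷ t₄ ∷ []) ≡
  simulate A f (copy₁ true) (t₁ ∷ t₂ ∷ scan (blanks true) (ds ʳ++ (b ∷ [])) false ∷ t₄ ∷ [])
append A true  []       true  t₁ t₂ t₄ f = refl
append A true  []       false t₁ t₂ t₄ f = refl
append A false []       true  t₁ t₂ t₄ f = refl
append A false []       false t₁ t₂ t₄ f = refl
append A true  (d ∷ ds) e     t₁ t₂ t₄ f = rewinding-found A false ds d (true ∷ []) e false t₁ t₂ t₄ f
append A false (d ∷ ds) e     t₁ t₂ t₄ f = rewinding-found A false ds d (false ∷ []) e false t₁ t₂ t₄ f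

asking-time : List Bool → List Bool → ℕ → ℕ
asking-time x s f = double-ticks x (suc (ticks (reverse x) (suc (ticks s (suc f)))))

asking : ∀ A ph x s e₁ e₁′ e₃ e₃′ t₂ f →
  simulate A (asking-time x s f) (copy₁ ph) (scan (blanks e₁) x e₁′ ∷ t₂ ∷ scan (blanks e₃) s e₃′ ∷ blankTape ∷ []) ≡
  simulate A f (if A (pair-up x (ph ∷ s)) then confirmed ph else refuted ph) (scan (blanks true) x true ∷ t₂ ∷ tape (passed (reverse s) e₃) nothing [] ∷ blankTape ∷ [])
asking A ph x s e₁ e₁′ e₃ e₃′ t₂ f = begin
  _ ≡⟨ copying-input A ph x [] e₁ e₁′ t₂ _ [] _ ⟩
  _ ≡⟨ rewound-input A ph (reverse x) e₁ t₂ _ (doubled x []) _ ⟩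
  _ ≡⟨ copying-found A ph s [] e₃ e₃′ _ t₂ (ph ∷ false ∷ doubled x []) (suc f) ⟩
  simulate A f (if A (contents (written (s ʳ++ (ph ∷ false ∷ doubled x [])))) then confirmed ph else refuted ph) (scan (blanks true) (reverse (reverse x)) true ∷ t₂ ∷ tape (passed (reverse s) e₃) nothing [] ∷ blankTape ∷ [])
    ≡⟨ cong₂ (λ w x → simulate A f (if A w then confirmed ph else refuted ph) (scan (blanks true) x true ∷ t₂ ∷ tape (passed (reverse s) e₃) nothing [] ∷ blankTape ∷ []))
         (trans (contents-written (s ʳ++ (ph ∷ false ∷ doubled x []))) (trans (cong reverse (sym (pair-up-doubled x (ph ∷ s) []))) (List.reverse-involutive (pair-up x (ph ∷ s)))))
         (List.reverse-involutive x) ⟩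
  _ ∎
  where open ≡-Reasoning

round-time : List Bool → List Bool → ℕ → ℕ
round-time x s f = asking-time x s (suc (ticks (reverse s) (suc f)))

extend : Lang → List Bool → ℕ → List Bool → List Bool
extend A x zero    s = s
extend A x (suc k) s = extend A x k (s ++ A (pair-up x (false ∷ s)) ∷ [])

last-bit : List Bool → Bool
last-bit []          = false
last-bit (b ∷ [])    = b
last-bit (_ ∷ b ∷ s) = last-bit (b ∷ s)

last-bit-snoc : ∀ s b → last-bit (s ++ b ∷ []) ≡ b
last-bit-snoc []          b = refl
last-bit-snoc (_ ∷ [])    b = refl
last-bit-snoc (_ ∷ c ∷ s) b = last-bit-snoc (c ∷ s) b

finishing : ∀ A s e t₁ t₂ t₄ f → 1 ≤ length s →
  simulate A (suc (suc f)) (confirmed true) (t₁ ∷ t₂ ∷ tape (passed (reverse s) e) nothing [] ∷ t₄ ∷ []) ≡ just (last-bit s)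
finishing A s e t₁ t₂ t₄ f l with reverse s in eq
... | []     = contradiction l (subst (λ n → ¬ (1 ≤ n)) (trans (sym (cong length eq)) (List.length-reverse s)) (λ ()))
... | d ∷ ds = cong just (trans (sym (last-bit-snoc (reverse ds) d))
  (cong last-bit (trans (sym (List.unfold-reverse d ds)) (trans (cong reverse (sym eq)) (List.reverse-involutive s)))))

search-time : List Bool → List Bool → ℕ → ℕ
search-time x s zero    = asking-time x s 2
-- The appended bit is a placeholder: the time depends only on lengths, not on the bit that is
-- found.
search-time x s (suc k) = round-time x s (round-time x s (search-time x (s ++ false ∷ []) k))

ticks-length : ∀ x y {f g} → length x ≡ length y → f ≡ g → ticks x f ≡ ticks y g
ticks-length []      []      _ e = e
ticks-length (_ ∷ x) (_ ∷ y) l e = cong suc (ticks-length x y (suc-injective l) e)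

asking-time-length : ∀ x {s s′ f g} → length s ≡ length s′ → f ≡ g → asking-time x s f ≡ asking-time x s′ g
asking-time-length x {s} {s′} l e = cong (λ t → double-ticks x (suc (ticks (reverse x) (suc t)))) (ticks-length s s′ l (cong suc e))

round-time-length : ∀ x {s s′ f g} → length s ≡ length s′ → f ≡ g → round-time x s f ≡ round-time x s′ g
round-time-length x {s} {s′} l e = asking-time-length x l
  (cong suc (ticks-length (reverse s) (reverse s′) (trans (List.length-reverse s) (trans l (sym (List.length-reverse s′)))) (cong suc e)))

search-time-length : ∀ x {s s′} k → length s ≡ length s′ → search-time x s k ≡ search-time x s′ k
search-time-length x zero    l = asking-time-length x l refl
search-time-length x {s} {s′} (suc k) l = round-time-length x l (round-time-length x l (search-time-length x {s ++ false ∷ []} {s′ ++ false ∷ []} k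
  (trans (List.length-++ s) (trans (cong (_+ 1) l) (sym (List.length-++ s′))))))

-- The tape flags are arbitrary because the first round starts on fresh tapes and all later ones on
-- tapes with visited blanks.
searching-loop : ∀ A x N → (∀ s → length s < N → A (pair-up x (true ∷ s)) ≡ false) → (∀ s → length s ≡ N → A (pair-up x (true ∷ s)) ≡ true) → 1 ≤ N →
  ∀ k s → length s + k ≡ N → ∀ e₁ e₁′ e₃ e₃′ t₂ →
  simulate A (search-time x s k) (copy₁ true) (scan (blanks e₁) x e₁′ ∷ t₂ ∷ scan (blanks e₃) s e₃′ ∷ blankTape ∷ []) ≡ just (last-bit (extend A x k s))
searching-loop A x N go stop 1≤N zero s l e₁ e₁′ e₃ e₃′ t₂ = begin
  _ ≡⟨ asking A true x s e₁ e₁′ e₃ e₃′ t₂ 2 ⟩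
  _ ≡⟨ cong (λ a → simulate A 2 (if a then confirmed true else refuted true) (scan (blanks true) x true ∷ t₂ ∷ tape (passed (reverse s) e₃) nothing [] ∷ blankTape ∷ []))
         (stop s (trans (sym (+-identityʳ _)) l)) ⟩
  _ ≡⟨ finishing A s e₃ _ t₂ blankTape 0 (subst (1 ≤_) (sym (trans (sym (+-identityʳ _)) l)) 1≤N) ⟩
  _ ∎
  where open ≡-Reasoning
searching-loop A x N go stop 1≤N (suc k) s l e₁ e₁′ e₃ e₃′ t₂ = begin
  _ ≡⟨ asking A true x s e₁ e₁′ e₃ e₃′ t₂ _ ⟩
  _ ≡⟨ cong (λ a → simulate A (suc (ticks (reverse s) (suc F))) (if a then confirmed true else refuted true) (scan (blanks true) x true ∷ t₂ ∷ tape (passed (reverse s) e₃) nothing [] ∷ blankTape ∷ []))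
         (go s (≤-trans (s≤s (m≤m+n (length s) k)) (≤-reflexive (trans (sym (+-suc (length s) k)) l)))) ⟩
  _ ≡⟨ continue A (reverse s) e₃ _ t₂ blankTape F ⟩
  _ ≡⟨ cong (λ s′ → simulate A F (copy₁ false) (scan (blanks true) x true ∷ t₂ ∷ scan (blanks true) s′ true ∷ blankTape ∷ [])) (List.reverse-involutive s) ⟩
  _ ≡⟨ asking A false x s true true true true t₂ _ ⟩
  _ ≡⟨ append A b (reverse s) true _ t₂ blankTape (search-time x (s ++ false ∷ []) k) ⟩
  _ ≡⟨ cong₂ (λ n s′ → simulate A n (copy₁ true) (scan (blanks true) x true ∷ t₂ ∷ scan (blanks true) s′ false ∷ blankTape ∷ []))
         (search-time-length x {s ++ false ∷ []} {s ++ b ∷ []} k (trans (List.length-++ s) (sym (List.length-++ s))))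
         (trans (List.ʳ++-defn (reverse s)) (cong (_++ b ∷ []) (List.reverse-involutive s))) ⟩
  _ ≡⟨ searching-loop A x N go stop 1≤N k (s ++ b ∷ []) (trans (cong (_+ k) (List.length-++ s)) (trans (+-assoc (length s) 1 k) l)) true true true false t₂ ⟩
  _ ∎
  where
  open ≡-Reasoning
  b = A (pair-up x (false ∷ s))
  F = round-time x s (search-time x (s ++ false ∷ []) k)

inputTape-scan : ∀ x → inputTape x ≡ scan [] x false
inputTape-scan []      = refl
inputTape-scan (b ∷ x) = cong (tape [] (just b)) (sym (List.++-identityʳ _))

searcher-exec : ∀ A x N T → (∀ s → length s < N → A (pair-up x (true ∷ s)) ≡ false) → (∀ s → length s ≡ N → A (pair-up x (true ∷ s)) ≡ true) → 1 ≤ N →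
  search-time x [] N ≤ T → exec searcher A T x [] ≡ just (last-bit (extend A x N []))
searcher-exec A x N T go stop 1≤N h = run-more searcher (search-time x [] N) T _ _ (begin
  _ ≡⟨ run-simulate A (search-time x [] N) _ (copy₁ true) _ refl ⟩
  _ ≡⟨ cong (λ t → simulate A (search-time x [] N) (copy₁ true) (t ∷ blankTape ∷ blankTape ∷ blankTape ∷ [])) (inputTape-scan x) ⟩
  _ ≡⟨ searching-loop A x N go stop 1≤N N [] refl false false false false blankTape ⟩
  _ ∎) h
  where open ≡-Reasoning

ticks-sum : ∀ x f → ticks x f ≡ length x + f
ticks-sum []      f = refl
ticks-sum (_ ∷ x) f = cong suc (ticks-sum x f)

double-ticks-sum : ∀ x f → double-ticks x f ≡ 2 * length x + f
double-ticks-sum []      f = refl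
double-ticks-sum (_ ∷ x) f rewrite double-ticks-sum x f | +-suc (length x) (length x + 0) = refl

asking-time-sum : ∀ x s f → asking-time x s f ≡ 3 * length x + length s + 3 + f
asking-time-sum x s f = begin
  asking-time x s f ≡⟨ double-ticks-sum x _ ⟩
  _ ≡⟨ cong (λ t → 2 * length x + suc t) (ticks-sum (reverse x) _) ⟩
  _ ≡⟨ cong₂ (λ a t → 2 * length x + suc (a + suc t)) (List.length-reverse x) (ticks-sum s (suc f)) ⟩
  _ ≡⟨ collect (length x) (length s) f ⟩
  _ ∎
  where
  open ≡-Reasoning
  collect : ∀ n m f → 2 * n + suc (n + suc (m + suc f)) ≡ 3 * n + m + 3 + f
  collect = ℕ-solve

round-time-sum : ∀ x s f → round-time x s f ≡ 3 * length x + 2 * length s + 5 + f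
round-time-sum x s f = trans (asking-time-sum x s _) (trans (cong (λ t → 3 * length x + length s + 3 + suc t) (trans (ticks-sum (reverse s) (suc f)) (cong (_+ suc f) (List.length-reverse s))))
  (collect (length x) (length s) f))
  where
  collect : ∀ n m f → 3 * n + m + 3 + suc (m + suc f) ≡ 3 * n + 2 * m + 5 + f
  collect = ℕ-solve

search-time-bound : ∀ x s k → search-time x s k ≤ suc k * (2 * (3 * length x + 2 * (length s + k) + 5))
search-time-bound x s zero = ≤-trans (≤-reflexive (asking-time-sum x s 2)) (≤-trans (m≤m+n _ (3 * length x + 3 * length s + 5)) (≤-reflexive (collect (length x) (length s))))
  where
  collect : ∀ n m → 3 * n + m + 3 + 2 + (3 * n + 3 * m + 5) ≡ 1 * (2 * (3 * n + 2 * (m + 0) + 5))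
  collect = ℕ-solve
search-time-bound x s (suc k) = begin
  search-time x s (suc k) ≡⟨ trans (round-time-sum x s _) (cong (λ t → r + t) (round-time-sum x s _)) ⟩
  r + (r + search-time x (s ++ false ∷ []) k) ≤⟨ +-mono-≤ r≤ (+-mono-≤ r≤ (≤-trans (search-time-bound x (s ++ false ∷ []) k) (≤-reflexive same))) ⟩
  R + (R + suc k * (2 * R)) ≡⟨ collect k R ⟩
  suc (suc k) * (2 * R) ∎
  where
  open ≤-Reasoning
  n = length x
  m = length s
  r = 3 * n + 2 * m + 5
  R = 3 * n + 2 * (m + suc k) + 5
  r≤ : r ≤ R
  r≤ = +-monoˡ-≤ 5 (+-monoʳ-≤ (3 * n) (*-monoʳ-≤ 2 (m≤m+n m (suc k))))
  same : suc k * (2 * (3 * n + 2 * (length (s ++ false ∷ []) + k) + 5)) ≡ suc k * (2 * R)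
  same rewrite List.length-++ s {false ∷ []} | +-assoc m 1 k = refl
  collect : ∀ k R → R + (R + suc k * (2 * R)) ≡ suc (suc k) * (2 * R)
  collect = ℕ-solve

-- Polynomial bounds and counting

-- The base `suc n` makes sums, products and compositions work without a special case at 0.
-- `bounded-by-poly` returns to `poly`: the factor 2 ^ k pays for suc n ≤ 2n when n is positive, and
-- the constant term covers 0.
PolyBounded : (ℕ → ℕ) → Set
PolyBounded f = Σ ℕ λ k → Σ ℕ λ c → ∀ n → f n ≤ c * suc n ^ k

PolyBounded-const : ∀ a → PolyBounded (λ _ → a)
PolyBounded-const a = 0 , a , λ n → ≤-reflexive (sym (*-identityʳ a))

PolyBounded-id : PolyBounded (λ n → n)
PolyBounded-id = 1 , 1 , λ n → ≤-trans (n≤1+n n) (≤-reflexive (sym (trans (*-identityˡ _) (*-identityʳ (suc n)))))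

PolyBounded-+ : ∀ {f g} → PolyBounded f → PolyBounded g → PolyBounded (λ n → f n + g n)
PolyBounded-+ {f} {g} (k , c , b) (k′ , c′ , b′) = k + k′ , c + c′ , λ n → begin
  f n + g n ≤⟨ +-mono-≤ (b n) (b′ n) ⟩
  c * suc n ^ k + c′ * suc n ^ k′ ≤⟨ +-mono-≤ (*-monoʳ-≤ c (^-monoʳ-≤ (suc n) (m≤m+n k k′))) (*-monoʳ-≤ c′ (^-monoʳ-≤ (suc n) (m≤n+m k′ k))) ⟩
  c * suc n ^ (k + k′) + c′ * suc n ^ (k + k′) ≡⟨ sym (*-distribʳ-+ (suc n ^ (k + k′)) c c′) ⟩
  (c + c′) * suc n ^ (k + k′) ∎
  where open ≤-Reasoning

PolyBounded-* : ∀ {f g} → PolyBounded f → PolyBounded g → PolyBounded (λ n → f n * g n)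
PolyBounded-* {f} {g} (k , c , b) (k′ , c′ , b′) = k + k′ , c * c′ , λ n → begin
  f n * g n ≤⟨ *-mono-≤ (b n) (b′ n) ⟩
  c * suc n ^ k * (c′ * suc n ^ k′) ≡⟨ swap c (suc n ^ k) c′ (suc n ^ k′) ⟩
  c * c′ * (suc n ^ k * suc n ^ k′) ≡⟨ cong (c * c′ *_) (sym (^-distribˡ-+-* (suc n) k k′)) ⟩
  c * c′ * suc n ^ (k + k′) ∎
  where
  open ≤-Reasoning
  swap : ∀ a x b y → a * x * (b * y) ≡ a * b * (x * y)
  swap = ℕ-solve

PolyBounded-∘ : ∀ {f g} → PolyBounded f → PolyBounded g → PolyBounded (λ n → f (g n))
PolyBounded-∘ {f} {g} (k , c , b) (k′ , c′ , b′) = k′ * k , c * suc c′ ^ k , λ n → begin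
  f (g n) ≤⟨ b (g n) ⟩
  c * suc (g n) ^ k ≤⟨ *-monoʳ-≤ c (^-monoˡ-≤ k (+-mono-≤ (m^n>0 (suc n) k′) (b′ n))) ⟩
  c * (suc c′ * suc n ^ k′) ^ k ≡⟨ cong (c *_) (trans (^-distribʳ (suc c′) (suc n ^ k′) k) (cong (suc c′ ^ k *_) (^-*-assoc (suc n) k′ k))) ⟩
  c * (suc c′ ^ k * suc n ^ (k′ * k)) ≡⟨ sym (*-assoc c (suc c′ ^ k) _) ⟩
  c * suc c′ ^ k * suc n ^ (k′ * k) ∎
  where open ≤-Reasoning

PolyBounded-poly : ∀ k c → PolyBounded (poly k c)
PolyBounded-poly k c = k , c + c , λ n → begin
  c * n ^ k + c ≤⟨ +-mono-≤ (*-monoʳ-≤ c (^-monoˡ-≤ k (n≤1+n n))) (≤-trans (≤-reflexive (sym (*-identityʳ c))) (*-monoʳ-≤ c (m^n>0 (suc n) k))) ⟩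
  c * suc n ^ k + c * suc n ^ k ≡⟨ sym (*-distribʳ-+ (suc n ^ k) c c) ⟩
  (c + c) * suc n ^ k ∎
  where open ≤-Reasoning

bounded-by-poly : ∀ {f} → PolyBounded f → Σ ℕ λ k → Σ ℕ λ c → ∀ n → f n ≤ poly k c n
bounded-by-poly {f} (k , c , b) = k , c * 2 ^ k , λ n → ≤-trans (b n) (shape n)
  where
  open ≤-Reasoning
  shape : ∀ n → c * suc n ^ k ≤ poly k (c * 2 ^ k) n
  shape zero    = ≤-trans (*-monoʳ-≤ c (^-monoˡ-≤ k {1} {2} (s≤s z≤n))) (m≤n+m (c * 2 ^ k) _)
  shape (suc n) = begin
    c * suc (suc n) ^ k ≤⟨ *-monoʳ-≤ c (^-monoˡ-≤ k (+-mono-≤ (s≤s z≤n) (≤-reflexive (sym (+-identityʳ (suc n)))))) ⟩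
    c * (2 * suc n) ^ k ≡⟨ cong (c *_) (^-distribʳ 2 (suc n) k) ⟩
    c * (2 ^ k * suc n ^ k) ≡⟨ sym (*-assoc c (2 ^ k) _) ⟩
    c * 2 ^ k * suc n ^ k ≤⟨ m≤m+n _ (c * 2 ^ k) ⟩
    poly k (c * 2 ^ k) (suc n) ∎

PolyBounded-reach : ∀ ls → PolyBounded (reach ls)
PolyBounded-reach []       = PolyBounded-id
PolyBounded-reach (l ∷ ls) = PolyBounded-∘ (PolyBounded-reach ls) (PolyBounded-poly (Level.k l) (Level.c l))

judge-split : ∀ a b → judge exists (a + b) ≡ true → judge exists a ≡ true ⊎ judge exists b ≡ true
judge-split zero    b h = inj₂ h
judge-split (suc a) b h = inj₁ refl

judge-left : ∀ a b → judge exists a ≡ true → judge exists (a + b) ≡ true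
judge-left (suc a) b h = refl

judge-right : ∀ a b → judge exists b ≡ true → judge exists (a + b) ≡ true
judge-right zero    b h = h
judge-right (suc a) b h = refl

count-positive : ∀ m (f : Vec Bool m → Bool) → judge exists (count m f) ≡ true → Σ (Vec Bool m) λ y → f y ≡ true
count-positive zero f h with f [] in e
... | true = [] , e
count-positive (suc m) f h with judge-split (count m (λ y → f (false ∷ y))) (count m (λ y → f (true ∷ y))) h
... | inj₁ p = let (y , e) = count-positive m (λ y → f (false ∷ y)) p in false ∷ y , e
... | inj₂ p = let (y , e) = count-positive m (λ y → f (true ∷ y)) p in true ∷ y , e

count-positive⁻ : ∀ m (f : Vec Bool m → Bool) y → f y ≡ true → judge exists (count m f) ≡ true
count-positive⁻ zero    f []          e rewrite e = refl
count-positive⁻ (suc m) f (false ∷ y) e = judge-left (count m (λ y → f (false ∷ y))) _ (count-positive⁻ m (λ y → f (false ∷ y)) y e)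
count-positive⁻ (suc m) f (true ∷ y)  e = judge-right (count m (λ y → f (false ∷ y))) _ (count-positive⁻ m (λ y → f (true ∷ y)) y e)

count-parity : ∀ m (F : List Bool → Bool) → count m (λ y → F (toList y)) % 2 ≡ (if parityOn m F then 1 else 0)
count-parity zero    F with F []
... | true  = refl
... | false = refl
count-parity (suc m) F = begin
  (a + b) % 2 ≡⟨ %-distribˡ-+ a b 2 ⟩
  (a % 2 + b % 2) % 2 ≡⟨ cong₂ (λ s t → (s + t) % 2) (count-parity m (λ z → F (false ∷ z))) (count-parity m (λ z → F (true ∷ z))) ⟩
  ((if p then 1 else 0) + (if q then 1 else 0)) % 2 ≡⟨ add p q ⟩
  (if p xor q then 1 else 0) ∎
  where
  open ≡-Reasoning
  a = count m (λ y → F (toList (false ∷ y)))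
  b = count m (λ y → F (toList (true ∷ y)))
  p = parityOn m (λ z → F (false ∷ z))
  q = parityOn m (λ z → F (true ∷ z))
  add : ∀ p q → ((if p then 1 else 0) + (if q then 1 else 0)) % 2 ≡ (if p xor q then 1 else 0)
  add true  true  = refl
  add true  false = refl
  add false true  = refl
  add false false = refl

count-all : ∀ m (f : Vec Bool m → Bool) b → (∀ y → f y ≡ b) → count m f ≡ (if b then 2 ^ m else 0)
count-all zero    f b h rewrite h [] = refl
count-all (suc m) f b h rewrite count-all m (λ y → f (false ∷ y)) b (λ y → h _) | count-all m (λ y → f (true ∷ y)) b (λ y → h _) = double b
  where
  double : ∀ b → (if b then 2 ^ m else 0) + (if b then 2 ^ m else 0) ≡ (if b then 2 ^ suc m else 0)
  double true  = cong (λ t → 2 ^ m + t) (sym (+-identityʳ (2 ^ m)))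
  double false = refl

same-truth : ∀ {a b} → (a ≡ true → b ≡ true) → (b ≡ true → a ≡ true) → a ≡ b
same-truth {true}  {b}     f g = sym (f refl)
same-truth {false} {true}  f g = g refl
same-truth {false} {false} f g = refl

-- The classes relative to the oracle

module E = Encoding margins margins-degree margins-bounds

opaque
  σ∞ : Assignment
  σ∞ = E.core

  slot-level : ℕ → List Bool
  slot-level = E.level

  slot-level-length : ∀ i → length (slot-level i) ≡ budget (suc i)
  slot-level-length = E.level-length

  O : Lang
  O = oracle σ∞

  O-answer : ∀ q → O q ≡ answer σ∞ O q
  O-answer = oracle-unfold σ∞

  encoded : ∀ i j t d e x r → decode j ≡ majority t d e → (tag j x , r) ∈ keys i → poly d e (length x) ≤ 2 ^ i →
    Settled (slot-level i) (nonNegative (excess (votes t O (2 ^ (2 ^ i)) (2 ^ poly d e (length x)) x) (2 ^ (2 ^ poly d e (length x))))) σ∞ (tag j x) r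
  encoded i j t d e x r dj κ∈ l =
    subst (λ m → Settled (slot-level i) (nonNegative m) σ∞ (tag j x) r) (margins-majority i (E.state i) E.core (E.core-state i) j t d e x r dj l) (E.core-settled i (tag j x) r κ∈)

  scale : ℕ
  scale = 2 ^ 11

  onset-scale : ∀ i → onset (suc i) ≡ scale * 2 ^ i
  onset-scale i = trans (onset-def (suc i)) (trans (cong (2 ^_) (+-suc 10 i)) (^-distribˡ-+-* 2 11 i))

  onset-0≤scale : onset 0 ≤ scale
  onset-0≤scale = ≤-trans (≤-reflexive (onset-def 0)) (^-monoʳ-≤ 2 (n≤1+n 10))

-- Every sufficiently long region of x carries the verdict, so the machines may round the length up
-- to a `poly` of their choice.
record Encoded (L : Lang) : Set where
  field
    index   : ℕ
    core    : ∀ x z → O (pair-up (tag index x) z) ≡ σ∞ (tag index x , z)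
    slots   : ℕ → ℕ
    slots-poly : PolyBounded slots
    settled : ∀ x r → slots (length x) ≤ r → Settled (slot-level (stage-of r)) (L x) σ∞ (tag index x) r
    large   : ∀ (x : List Bool) r → slots (length x) ≤ r → onset (stage-of r) ≤ r

respond-at : ∀ j {w} → decode j ≡ w → ∀ x z → O (pair-up (tag j x) z) ≡ respond σ∞ O (length (pair-up (tag j x) z)) w (tag j x) x z
respond-at j dj x z = trans (O-answer (pair-up (tag j x) z)) (trans (answer-pair-up σ∞ O j x z)
  (cong (λ w → respond σ∞ O (length (pair-up (tag j x) z)) w (tag j x) x z) dj))

PEXP-encoded : ∀ L → PEXP O L → Encoded L
PEXP-encoded L (M , k , c , d , e , total , correct) with table-of M
... | t , same with encode (majority t d e)
...   | j , dj = record
  { index = j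
  ; core = respond-at j dj
  ; slots = λ n → scale * need n
  ; slots-poly = PolyBounded-* (PolyBounded-const scale)
      (PolyBounded-+ (PolyBounded-+ (PolyBounded-+ (PolyBounded-const (suc j)) PolyBounded-id) (PolyBounded-poly k c)) (PolyBounded-poly d e))
  ; settled = settled
  ; large = λ x r h → stage-of-lower r (big x r h) }
  where
  -- At the stage i of the region, the length of the name and the exponents of time and choices must
  -- all be at most 2 ^ i. Length r ≥ scale * need ensures this, because r < onset (suc i) = scale *
  -- 2 ^ i.
  need : ℕ → ℕ
  need n = suc j + n + poly k c n + poly d e n
  big : ∀ (x : List Bool) r → scale * need (length x) ≤ r → onset 0 ≤ r
  big x r h = ≤-trans onset-0≤scale (≤-trans (m≤m*n scale (need (length x))) h)
  need<2^ : ∀ (x : List Bool) r → scale * need (length x) ≤ r → need (length x) ≤ 2 ^ stage-of r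
  need<2^ x r h = <⇒≤ (*-cancelˡ-< scale (need (length x)) (2 ^ stage-of r)
    (≤-trans (s≤s h) (≤-trans (stage-of-upper r) (≤-reflexive (onset-scale (stage-of r))))))
  settled : ∀ x r → scale * need (length x) ≤ r → Settled (slot-level (stage-of r)) (L x) σ∞ (tag j x) r
  settled x r h = subst (λ b → Settled (slot-level i) b σ∞ (tag j x) r) verdict
    (encoded i j t d e x r dj (∈-keys i (tag j x) r tag-short (stage-of-lower r (big x r h)) (stage-of-upper r))
      (≤-trans (m≤n+m (poly d e n) (suc j + n + poly k c n)) (need<2^ x r h)))
    where
    n = length x
    i = stage-of r
    m = 2 ^ poly d e n
    tag-short : length (tag j x) ≤ 2 ^ i
    tag-short = ≤-trans (≤-reflexive (length-tag j x)) (≤-trans (m≤m+n (suc j + n) (poly k c n)) (≤-trans (m≤m+n (suc j + n + poly k c n) (poly d e n)) (need<2^ x r h)))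
    time : 2 ^ poly k c n ≤ 2 ^ (2 ^ i)
    time = ^-monoʳ-≤ 2 (≤-trans (m≤n+m (poly k c n) (suc j + n)) (≤-trans (m≤m+n (suc j + n + poly k c n) (poly d e n)) (need<2^ x r h)))
    runs : ∀ y → exec (machine t) O (2 ^ (2 ^ i)) x (toList y) ≡ exec M O (2 ^ poly k c n) x (toList y)
    runs y with total x y
    ... | b , halts = trans (same O (2 ^ (2 ^ i)) x (toList y)) (trans (run-more M (2 ^ poly k c n) (2 ^ (2 ^ i)) _ _ halts time) (sym halts))
    a = votes t O (2 ^ (2 ^ i)) m x
    a-correct : a ≡ #acc M O (λ n → 2 ^ poly k c n) (λ n → 2 ^ poly d e n) x
    a-correct = count-cong m (λ y → cong accepts (runs y))
    verdict : nonNegative (excess a (2 ^ m)) ≡ L x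
    verdict = same-truth
      (λ p → Equivalence.from (correct x) (subst (λ v → 2 ^ m < 2 * v) a-correct (excess-sign a (2 ^ m) p)))
      (λ p → excess-sign⁻ a (2 ^ m) (subst (λ v → 2 ^ m < 2 * v) (sym a-correct) (Equivalence.to (correct x) p)))

copier-poly : ∀ pre d e → Σ ℕ λ k → Σ ℕ λ c → ∀ A x (y : Vec Bool (poly d e (length x))) →
              exec (copier pre) A (poly k c (length x)) x (toList y) ≡ just (A (pre ++ pair-up x (toList y)))
copier-poly pre d e with bounded-by-poly {λ n → copier-time pre n (poly d e n)}
  (PolyBounded-+ (PolyBounded-const (length pre)) (PolyBounded-+ PolyBounded-id (PolyBounded-+ PolyBounded-id
    (PolyBounded-+ (PolyBounded-const 1) (PolyBounded-+ (PolyBounded-poly d e) (PolyBounded-const 2))))))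
... | k , c , fits = k , c , λ A x y → copier-exec A pre x (toList y) (poly k c (length x))
  (subst (λ m → copier-time pre (length x) m ≤ poly k c (length x)) (sym (Vec.length-toList y)) (fits (length x)))

tagged : ∀ j x z → tag-prefix j ++ pair-up x z ≡ pair-up (tag j x) z
tagged = tag-prefix-pair-up

-- Guessing z and looking up its bit accepts on as many paths as the region has ones, and the parity
-- of that number is the verdict.
PEXP⊆ParityP : ∀ L → PEXP O L → ParityP O L
PEXP⊆ParityP L pexp with PEXP-encoded L pexp
... | enc with bounded-by-poly (Encoded.slots-poly enc)
...   | d , e , roomy with copier-poly (tag-prefix (Encoded.index enc)) d e
...     | k , c , copies = copier (tag-prefix index) , k , c , d , e , (λ x y → _ , copies O x y) , correct
  where
  open Encoded enc
  bits : List Bool → List Bool → Bool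
  bits x z = σ∞ (tag index x , z)
  odd-count : ∀ x → #acc (copier (tag-prefix index)) O (poly k c) (poly d e) x % 2 ≡ (if L x then 1 else 0)
  odd-count x = begin
    #acc (copier (tag-prefix index)) O (poly k c) (poly d e) x % 2
      ≡⟨ cong (_% 2) (count-cong (poly d e (length x)) (λ y → trans (cong accepts (copies O x y)) (trans (cong O (tagged index x (toList y))) (core x (toList y))))) ⟩
    count (poly d e (length x)) (λ y → bits x (toList y)) % 2
      ≡⟨ count-parity (poly d e (length x)) (bits x) ⟩
    (if parityOn (poly d e (length x)) (bits x) then 1 else 0)
      ≡⟨ cong (λ b → if b then 1 else 0) (Settled.parity (settled x (poly d e (length x)) (roomy (length x)))) ⟩
    (if L x then 1 else 0) ∎
    where open ≡-Reasoning
  correct : ∀ x → (L x ≡ true) ⇔ (#acc (copier (tag-prefix index)) O (poly k c) (poly d e) x % 2 ≡ 1)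
  correct x = mk⇔ (λ p → trans (odd-count x) (cong (λ b → if b then 1 else 0) p)) (λ p → one (trans (sym (odd-count x)) p))
    where
    one : ∀ {b} → (if b then 1 else 0) ≡ 1 → b ≡ true
    one {true} _ = refl

-- Towers of levels are decided in PEXP

Computable : Lang → Set
Computable L = Σ (List Level) λ ls → ∀ x → L x ≡ eval ls O x

one-level : ∀ l {A} ls → (∀ x → A x ≡ eval ls O x) → ∀ x → eval-level l A x ≡ eval (l ∷ ls) O x
one-level l ls h x = eval-local (l ∷ []) x (λ w _ → h w)

NP-computable : ∀ {A L} → Computable A → NP A L → Computable L
NP-computable {A} {L} (ls , h) (M , k , c , d , e , total , correct) with table-of M
... | t , same = mkLevel exists t k c d e ∷ ls , λ x → trans (decides x) (one-level (mkLevel exists t k c d e) ls h x)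
  where
  decides : ∀ x → L x ≡ judge exists (#acc (machine t) A (poly k c) (poly d e) x)
  decides x = same-truth
    (λ p → let (y , acc) = Equivalence.to (correct x) p in
      count-positive⁻ (poly d e (length x)) _ y (cong accepts (trans (same A (poly k c (length x)) x (toList y)) acc)))
    (λ p → let (y , acc) = count-positive (poly d e (length x)) _ p in Equivalence.from (correct x) (y , accepted y acc))
    where
    accepted : ∀ y → accepts (exec (machine t) A (poly k c (length x)) x (toList y)) ≡ true → exec M A (poly k c (length x)) x (toList y) ≡ just true
    accepted y acc with total x y
    ... | b , halts = trans halts (cong just (trans (sym (cong accepts (trans (same A (poly k c (length x)) x (toList y)) halts))) acc))

-- Since poly 0 0 n = 0, the level below has only the empty certificate and is deterministic.
P-computable : ∀ {A L} → Computable A → P A L → Computable L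
P-computable {A} {L} (ls , h) (M , k , c , runs) with table-of M
... | t , same = mkLevel exists t k c 0 0 ∷ ls , λ x → trans (decides x) (one-level (mkLevel exists t k c 0 0) ls h x)
  where
  decides : ∀ x → L x ≡ judge exists (#acc (machine t) A (poly k c) (poly 0 0) x)
  decides x rewrite trans (same A (poly k c (length x)) x []) (runs x) with L x
  ... | true  = refl
  ... | false = refl

ParityP-computable : ∀ {L} → ParityP O L → Computable L
ParityP-computable {L} (M , k , c , d , e , total , correct) with table-of M
... | t , same = mkLevel odd t k c d e ∷ [] , decides
  where
  counts : ∀ x → #acc (machine t) O (poly k c) (poly d e) x ≡ #acc M O (poly k c) (poly d e) x
  counts x = count-cong (poly d e (length x)) (λ y → cong accepts (same O (poly k c (length x)) x (toList y)))
  odd-true : ∀ n → n % 2 ≡ 1 → judge odd n ≡ true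
  odd-true n h rewrite h = refl
  true-odd : ∀ n → judge odd n ≡ true → n % 2 ≡ 1
  true-odd n h = ≡ᵇ⇒≡ (n % 2) 1 (subst T (sym h) _)
    where open import Data.Bool using (T)
  decides : ∀ x → L x ≡ judge odd (#acc (machine t) O (poly k c) (poly d e) x)
  decides x = trans
    (same-truth (λ p → odd-true (#acc M O (poly k c) (poly d e) x) (Equivalence.to (correct x) p))
                (λ p → Equivalence.from (correct x) (true-odd (#acc M O (poly k c) (poly d e) x) p)))
    (cong (judge odd) (sym (counts x)))

pair-up-long : ∀ u z → length z ≤ length (pair-up u z)
pair-up-long []      z = n≤1+n _
pair-up-long (b ∷ u) z = ≤-trans (pair-up-long u z) (≤-trans (n≤1+n _) (n≤1+n _))

-- The exponentially long choice string is copied into the query as padding; the answer does not depend on it.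
Computable⊆PEXP : ∀ L → Computable L → PEXP O L
Computable⊆PEXP L (ls , h) with encode (levels ls) | bounded-by-poly (PolyBounded-reach ls)
... | j , dj | d , e , deep with bounded-by-poly {λ n → length (tag-prefix j) + (n + (n + 3)) + poly d e n}
        (PolyBounded-+ (PolyBounded-+ (PolyBounded-const (length (tag-prefix j))) (PolyBounded-+ PolyBounded-id (PolyBounded-+ PolyBounded-id (PolyBounded-const 3)))) (PolyBounded-poly d e))
...   | k , c , fits = copier (tag-prefix j) , k , c , d , e , (λ x y → _ , runs x y) , correct
  where
  runs : ∀ x (y : Vec Bool (2 ^ poly d e (length x))) → exec (copier (tag-prefix j)) O (2 ^ poly k c (length x)) x (toList y) ≡ just (L x)
  runs x y = trans (copier-exec O (tag-prefix j) x (toList y) (2 ^ poly k c n) enough)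
    (cong just (trans (cong O (tagged j x (toList y))) (trans (respond-at j dj x (toList y))
      (trans (eval-local ls x unclipped) (sym (h x))))))
    where
    open ≤-Reasoning
    n = length x
    q = pair-up (tag j x) (toList y)
    unclipped : ∀ w → length w ≤ reach ls n → clip (length q) O w ≡ O w
    unclipped w l = cong (λ b → if b then O w else false) (dec-true (2 ^ length w ≤? length q)
      (≤-trans (^-monoʳ-≤ 2 (≤-trans l (deep n))) (≤-trans (≤-reflexive (sym (Vec.length-toList y))) (pair-up-long (tag j x) (toList y)))))
    a = length (tag-prefix j) + (n + (n + 3))
    regroup : ∀ p n m → p + (n + (n + (1 + (m + 2)))) ≡ p + (n + (n + 3)) + m
    regroup = ℕ-solve
    enough : copier-time (tag-prefix j) n (length (toList y)) ≤ 2 ^ poly k c n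
    enough = begin
      copier-time (tag-prefix j) n (length (toList y)) ≡⟨ trans (cong (copier-time (tag-prefix j) n) (Vec.length-toList y)) (regroup (length (tag-prefix j)) n (2 ^ poly d e n)) ⟩
      a + 2 ^ poly d e n ≤⟨ +-monoˡ-≤ (2 ^ poly d e n) (m≤m*n a (2 ^ poly d e n) {{m^n≢0 2 (poly d e n)}}) ⟩
      a * 2 ^ poly d e n + 2 ^ poly d e n ≡⟨ +-comm (a * 2 ^ poly d e n) _ ⟩
      suc a * 2 ^ poly d e n ≤⟨ *-monoˡ-≤ (2 ^ poly d e n) (i<2^i a) ⟩
      2 ^ a * 2 ^ poly d e n ≡⟨ sym (^-distribˡ-+-* 2 a (poly d e n)) ⟩
      2 ^ (a + poly d e n) ≤⟨ ^-monoʳ-≤ 2 (fits n) ⟩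
      2 ^ poly k c n ∎
  correct : ∀ x → (L x ≡ true) ⇔ (2 ^ (2 ^ poly d e (length x)) < 2 * #acc (copier (tag-prefix j)) O (λ n → 2 ^ poly k c n) (λ n → 2 ^ poly d e n) x)
  correct x = subst (λ a → (L x ≡ true) ⇔ (2 ^ m < 2 * a)) (sym (count-all m _ (L x) (λ y → cong accepts (runs x y)))) (unanimous (L x))
    where
    m = 2 ^ poly d e (length x)
    unanimous : ∀ b → (b ≡ true) ⇔ (2 ^ m < 2 * (if b then 2 ^ m else 0))
    unanimous true  = mk⇔ (λ _ → ≤-trans (s≤s (≤-reflexive (sym (+-identityʳ (2 ^ m))))) (+-monoˡ-≤ (2 ^ m + 0) (m^n>0 2 m))) (λ _ → refl)
    unanimous false = mk⇔ (λ ()) (λ ())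

-- Binary search for the largest one of a region

isPrefix-++ : ∀ s z → isPrefix s (s ++ z) ≡ true
isPrefix-++ []          z = refl
isPrefix-++ (true ∷ s)  z = isPrefix-++ s z
isPrefix-++ (false ∷ s) z = isPrefix-++ s z

isPrefix-atMost : ∀ s t z → isPrefix (s ++ true ∷ []) z ≡ true → atMost (s ++ false ∷ t) z ≡ false
isPrefix-atMost []          t (true ∷ z)  h = refl
isPrefix-atMost (true ∷ s)  t (true ∷ z)  h = isPrefix-atMost s t z h
isPrefix-atMost (false ∷ s) t (false ∷ z) h = isPrefix-atMost s t z h

padded : ∀ (z : List Bool) m → length z ≤ m → Σ (Vec Bool m) λ y → take (length z) (toList y) ≡ z
padded []      m       _       = Vec.replicate m false , refl
padded (b ∷ z) (suc m) (s≤s l) with padded z m l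
... | y , e = b ∷ y , cong (b ∷_) e

length-take : ∀ r (z : List Bool) → r ≤ length z → length (take r z) ≡ r
length-take zero    z       _       = refl
length-take (suc r) (b ∷ z) (s≤s l) = cong suc (length-take r z l)

∧-true : ∀ {a b} → a ∧ b ≡ true → a ≡ true × b ≡ true
∧-true {true} h = refl , h

-- The same polynomial gives the region length for x and the certificate length for the pair of x
-- with a prefix; the pair is longer than x, so a certificate always has room for a string of the
-- region.
module Searching (L : Lang) (enc : Encoded L) (k₂ c₂ : ℕ) (roomy : ∀ n → Encoded.slots enc n ≤ poly k₂ c₂ n) where

  open Encoded enc

  code : Σ ℕ λ j → decode j ≡ search index k₂ c₂
  code = encode (search index k₂ c₂)

  j₂ : ℕ
  j₂ = proj₁ code

  checks : ∀ a → Vec Bool (poly k₂ c₂ (length a)) → Bool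
  checks a y = O (pair-up (tag j₂ a) (toList y))

  A : Lang
  A a = judge exists (count (poly k₂ c₂ (length a)) (checks a))

  A-true : ∀ a → A a ≡ true → Σ (Vec Bool (poly k₂ c₂ (length a))) λ y → checks a y ≡ true
  A-true a = count-positive (poly k₂ c₂ (length a)) (checks a)

  A-true⁻ : ∀ a y → checks a y ≡ true → A a ≡ true
  A-true⁻ a = count-positive⁻ (poly k₂ c₂ (length a)) (checks a)

  A-NP : NP O A
  A-NP with copier-poly (tag-prefix j₂) k₂ c₂
  ... | k , c , copies = copier (tag-prefix j₂) , k , c , k₂ , c₂ , (λ x y → _ , copies O x y) , λ a → mk⇔
    (λ p → let (y , e) = A-true a p in y , trans (copies O a y) (cong just (trans (cong O (tagged j₂ a (toList y))) e)))
    (λ { (y , e) → A-true⁻ a y (trans (cong O (sym (tagged j₂ a (toList y)))) (just-injective (trans (sym (copies O a y)) e))) })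

  found : ∀ x w z → O (pair-up (tag j₂ (pair-up x w)) z) ≡ searching σ∞ index k₂ c₂ (x , w) z
  found x w z = trans (respond-at j₂ (proj₂ code) (pair-up x w) z) (cong (λ xs → searching σ∞ index k₂ c₂ xs z) (parse-pair-up x w))

  module _ (x : List Bool) where

    r N : ℕ
    r = poly k₂ c₂ (length x)
    N = search-length r

    π : List Bool
    π = slot-level (stage-of r)

    S : Settled π (L x) σ∞ (tag index x) r
    S = settled x r (roomy (length x))

    r≤ : ∀ w → r ≤ poly k₂ c₂ (length (pair-up x w))
    r≤ w = poly-mono k₂ c₂ (input-short x)
      where
      input-short : ∀ x → length x ≤ length (pair-up x w)
      input-short []      = z≤n
      input-short (b ∷ x) = s≤s (≤-trans (input-short x) (n≤1+n _))

    stop : ∀ s → A (pair-up x (true ∷ s)) ≡ does (N ≤? length s)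
    stop s = same-truth
      (λ p → let (y , e) = A-true (pair-up x (true ∷ s)) p in trans (sym (found x (true ∷ s) (toList y))) e)
      (λ p → A-true⁻ (pair-up x (true ∷ s)) (Vec.replicate _ false) (trans (found x (true ∷ s) _) p))

    next-true : ∀ s z → length z ≡ r → isPrefix (s ++ true ∷ []) z ≡ true → σ∞ (tag index x , z) ≡ true → A (pair-up x (false ∷ s)) ≡ true
    next-true s z l p e with padded z (poly k₂ c₂ (length (pair-up x (false ∷ s)))) (≤-trans (≤-reflexive l) (r≤ (false ∷ s)))
    ... | y , cut = A-true⁻ (pair-up x (false ∷ s)) y
      (trans (found x (false ∷ s) (toList y))
        (trans (cong (λ z → isPrefix (s ++ true ∷ []) z ∧ σ∞ (tag index x , z)) (trans (cong (λ n → take n (toList y)) (sym l)) cut))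
          (trans (cong (_∧ σ∞ (tag index x , z)) p) e)))

    next-false : ∀ s → (∀ z → length z ≡ r → isPrefix (s ++ true ∷ []) z ≡ true → σ∞ (tag index x , z) ≡ false) → A (pair-up x (false ∷ s)) ≡ false
    next-false s none = Bool.¬-not (λ eq → refute (A-true (pair-up x (false ∷ s)) eq))
      where
      refute : (Σ (Vec Bool (poly k₂ c₂ (length (pair-up x (false ∷ s))))) λ y → checks (pair-up x (false ∷ s)) y ≡ true) → ⊥
      refute (y , e) with ∧-true {isPrefix (s ++ true ∷ []) (take r (toList y))} (trans (sym (found x (false ∷ s) (toList y))) e)
      ... | p , set with () ← trans (sym (none (take r (toList y))
                (length-take r (toList y) (≤-trans (r≤ (false ∷ s)) (≤-reflexive (sym (Vec.length-toList y))))) p)) set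

    target : List Bool
    target = π ++ true ∷ L x ∷ []

    target-length : length target ≡ N
    target-length = trans (List.length-++ π) (cong (_+ 2) (slot-level-length (stage-of r)))

    -- If the next bit of the target is 1, the largest one of the region is itself a witness. If it
    -- is 0, any one starting with `s` and a 1 would lie above the target, where the region is
    -- empty.
    next-bit : ∀ s b t → target ≡ s ++ b ∷ t → A (pair-up x (false ∷ s)) ≡ b
    next-bit s true t e = next-true s (target ++ Settled.top S)
      (trans (cong length (List.++-assoc π (true ∷ L x ∷ []) (Settled.top S))) (Settled.top-len S))
      (subst (λ z → isPrefix (s ++ true ∷ []) z ≡ true) (sym split) (isPrefix-++ (s ++ true ∷ []) (t ++ Settled.top S)))
      (trans (cong (λ z → σ∞ (tag index x , z)) (List.++-assoc π (true ∷ L x ∷ []) (Settled.top S))) (Settled.top-set S))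
      where
      split : target ++ Settled.top S ≡ (s ++ true ∷ []) ++ (t ++ Settled.top S)
      split = trans (cong (_++ Settled.top S) e) (trans (List.++-assoc s (true ∷ t) (Settled.top S)) (sym (List.++-assoc s (true ∷ []) (t ++ Settled.top S))))
    next-bit s false t e = next-false s (λ z l p → Settled.nothing-above S z l (subst (λ τ → atMost τ z ≡ false) (sym e) (isPrefix-atMost s t z p)))

    extend-target : ∀ t s → target ≡ s ++ t → extend A x (length t) s ≡ target
    extend-target []      s e = sym (trans e (List.++-identityʳ s))
    extend-target (b ∷ t) s e = trans (cong (λ a → extend A x (length t) (s ++ a ∷ [])) (next-bit s b t e))
      (extend-target t (s ++ b ∷ []) (trans e (sym (List.++-assoc s (b ∷ []) t))))

    answer-found : last-bit (extend A x N []) ≡ L x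
    answer-found = begin
      last-bit (extend A x N []) ≡⟨ cong (λ n → last-bit (extend A x n [])) (sym target-length) ⟩
      last-bit (extend A x (length target) []) ≡⟨ cong last-bit (extend-target target [] refl) ⟩
      last-bit target ≡⟨ cong last-bit (sym (List.++-assoc π (true ∷ []) (L x ∷ []))) ⟩
      last-bit ((π ++ true ∷ []) ++ L x ∷ []) ≡⟨ last-bit-snoc (π ++ true ∷ []) (L x) ⟩
      L x ∎
      where open ≡-Reasoning

    N≤r : N ≤ r
    -- The bound on the prefix length is the same for any number of keys, so it is taken for 0 keys.
    N≤r = proj₁ (Numerics.room (stage-of r) 0 z≤n r (large x r (roomy (length x))))

    search-runs : ∀ T → suc r * (2 * (3 * length x + 2 * r + 5)) ≤ T → exec searcher A T x [] ≡ just (L x)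
    search-runs T h = trans (searcher-exec A x N T
      (λ s l → trans (stop s) (dec-false (N ≤? length s) (<⇒≱ l)))
      (λ s l → trans (stop s) (dec-true (N ≤? length s) (≤-reflexive (sym l))))
      (≤-trans (s≤s z≤n) (m≤n+m 2 (budget (suc (stage-of r)))))
      (≤-trans (search-time-bound x [] N) (≤-trans (*-mono-≤ (s≤s N≤r) (*-monoʳ-≤ 2 (+-monoˡ-≤ 5 (+-monoʳ-≤ (3 * length x) (*-monoʳ-≤ 2 N≤r))))) h)))
      (cong just answer-found)

  search-time-poly : ℕ → ℕ
  search-time-poly n = suc (poly k₂ c₂ n) * (2 * (3 * n + 2 * poly k₂ c₂ n + 5))

  search-time-bounded : PolyBounded search-time-poly
  search-time-bounded =
    PolyBounded-* {λ n → suc (R n)} {λ n → 2 * Z n} (PolyBounded-+ {λ _ → 1} {R} (PolyBounded-const 1) (PolyBounded-poly k₂ c₂))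
      (PolyBounded-* {λ _ → 2} {Z} (PolyBounded-const 2) (PolyBounded-+ {λ n → 3 * n + 2 * R n} {λ _ → 5}
        (PolyBounded-+ {λ n → 3 * n} {λ n → 2 * R n} (PolyBounded-* {λ _ → 3} {λ n → n} (PolyBounded-const 3) PolyBounded-id)
          (PolyBounded-* {λ _ → 2} {R} (PolyBounded-const 2) (PolyBounded-poly k₂ c₂))) (PolyBounded-const 5)))
    where
    R Z : ℕ → ℕ
    R = poly k₂ c₂
    Z n = 3 * n + 2 * R n + 5

  L-P : P A L
  L-P = in-time (bounded-by-poly search-time-bounded)
    where
    in-time : (Σ ℕ λ k → Σ ℕ λ c → ∀ n → search-time-poly n ≤ poly k c n) → P A L
    in-time (k , c , fits) = searcher , k , c , λ x → search-runs x (poly k c (length x)) (fits (length x))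

PEXP⊆P^NP : ∀ L → PEXP O L → (P ^ᶜ NP) O L
PEXP⊆P^NP L pexp with PEXP-encoded L pexp
... | enc with bounded-by-poly (Encoded.slots-poly enc)
...   | k₂ , c₂ , roomy = A , A-NP , L-P
  where open Searching L enc k₂ c₂ roomy

O-computable : Computable O
O-computable = [] , λ _ → refl

P^NP-computable : ∀ {L} → (P ^ᶜ NP) O L → Computable L
P^NP-computable (A , np , p) = P-computable (NP-computable O-computable np) p

-- The inclusion of `PEXP` in P^NP first brings the innermost language down to finitely many levels;
-- `NP` and `P` then add two more.
P^NP^PEXP-computable : ∀ {L} → (P ^ᶜ (NP ^ᶜ PEXP)) O L → Computable L
P^NP^PEXP-computable (B , (A , pexp , np) , p) = P-computable (NP-computable (P^NP-computable (PEXP⊆P^NP A pexp)) np) p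

theorem12 : (Σ Lang λ O → (PEXP ≐ (P ^ᶜ NP) at O) × ((P ^ᶜ NP) ≐ (P ^ᶜ (NP ^ᶜ PEXP)) at O))
    × (Σ Lang λ O → ParityP ≐ PEXP at O)
theorem12 =
  (O , (λ L → mk⇔ (PEXP⊆P^NP L) (λ h → Computable⊆PEXP L (P^NP-computable h)))
     -- `O` is itself a `PEXP` language relative to `O`, so an `NP` machine with oracle `O` is one
     -- with a `PEXP` oracle.
     , (λ L → mk⇔ (λ { (A , np , p) → A , (O , Computable⊆PEXP O O-computable , np) , p })
                  (λ h → PEXP⊆P^NP L (Computable⊆PEXP L (P^NP^PEXP-computable h)))))
  , (O , λ L → mk⇔ (λ h → Computable⊆PEXP L (ParityP-computable h)) (PEXP⊆ParityP L))
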